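{- Let $p$ and $q$ be distinct positive odd integers with $\gcd(p,q) = 1$. For each positive integer $n$, let $m(n)$ denote the greatest integer $m \ge 1$ such that the grid graph $\square_m$ embeds into the leaper graph $\mathcal{L}_n$ of the $(p,q)$-leaper. Then there is a constant $C$, depending only on $p$ and $q$ (and not on $n$), such that $|m(n) - n/2| \le C$ for all positive integers $n$; i.e., $m(n) = n/2 + O_{p,q}(1)$.
   Context: Let $[n] = \{1, 2, \ldots, n\}$. The grid graph $\square_n$ has vertex set $[n]^2$, with $(x', y')$ and $(x'', y'')$ adjacent iff they are at Euclidean distance $1$. For positive integers $p \ne q$, the $(p,q)$-leaper graph $\mathcal{L}_n$ has vertex set $[n]^2$, with $(x', y')$ and $(x'', y'')$ adjacent iff $\{|x' - x''|, |y' - y''|\} = \{p, q\}$. A graph $G$ embeds into a graph $H$ if $G$ is isomorphic to a (not necessarily induced) subgraph of $H$. -}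

module Defs where

open import Data.Nat using (ℕ; suc; _+_; _*_; _≤_; ∣_-_∣)
open import Data.Fin using (Fin; toℕ)
open import Data.Product using (_×_; Σ; ∃; _,_)
open import Data.Sum using (_⊎_)
open import Relation.Binary.PropositionalEquality using (_≡_)
open import Function.Definitions using (Injective)

Odd : ℕ → Set
Odd p = ∃ λ k → p ≡ 2 * k + 1

-- Vertex set [n]^2, represented 0-indexed as Fin n × Fin n
-- (adjacency depends only on coordinate differences, so the shift is harmless).
Cell : ℕ → Set
Cell n = Fin n × Fin n

dx : ∀ {n} → Cell n → Cell n → ℕ
dx (x₁ , _) (x₂ , _) = ∣ toℕ x₁ - toℕ x₂ ∣

dy : ∀ {n} → Cell n → Cell n → ℕ
dy (_ , y₁) (_ , y₂) = ∣ toℕ y₁ - toℕ y₂ ∣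

GridAdj : (n : ℕ) → Cell n → Cell n → Set
GridAdj n u v = dx u v * dx u v + dy u v * dy u v ≡ 1

LeaperAdj : (p q n : ℕ) → Cell n → Cell n → Set
LeaperAdj p q n u v = (dx u v ≡ p × dy u v ≡ q) ⊎ (dx u v ≡ q × dy u v ≡ p)

-- □_m embeds into L_n: an injective map on vertices preserving adjacency
-- (isomorphic to a not-necessarily-induced subgraph).
GridEmbedsInLeaper : (p q m n : ℕ) → Set
GridEmbedsInLeaper p q m n =
  Σ (Cell m → Cell n) λ f →
    Injective _≡_ _≡_ f × (∀ u v → GridAdj m u v → LeaperAdj p q n (f u) (f v))

IsMaxGrid : (p q n m : ℕ) → Set
IsMaxGrid p q n m =
  1 ≤ m × GridEmbedsInLeaper p q m n ×
  (∀ m' → 1 ≤ m' → GridEmbedsInLeaper p q m' n → m' ≤ m)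

{-# OPTIONS --safe #-}

-- A unit square of the grid is mapped to a rhombus, so an embedding has the form (i , j) ↦ Aᵢ + Bⱼ, and the
-- leaper directions used by the walk A are not used by the walk B.  If one of the walks is straight, the bound is
-- clear.  Otherwise each of them uses two of the four directions, A and B are walks in two planar grids
-- (with coordinates along these directions), and these two lattices meet in the lattice spanned by e₁ = N (1 , 1) and
-- e₂ = N (1 , -1), where N is pq, (p² + q²) / 2 or (q² - p²) / 2.  Since all sums Aᵢ + Bⱼ are distinct, a vector of the
-- common lattice cannot be a chord of both walks.  By planarity, a walk without the chord e₁ has no chord k e₁
-- (and likewise for e₂), and if it has neither e₁ nor e₂ then all its chords k e₁ + l e₂ have k l > 0, or all have
-- k l < 0.  By the pigeonhole principle a walk of m points without chords k e₁ spans at least 2m - O(1) in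
-- the direction x - y, one without chords k e₂ spans as much in the direction x + y, and one without e₁ and e₂ spans
-- as much in the direction x or y.  In each case 2m ≤ n + O(1).
--
-- Conversely, put P = (p + q) / 2 and Q = (q - p) / 2.  In the coordinates (x + y) / 2 and (x - y) / 2, let A run through
-- all points (P s , Q t) with s ≡ t (mod 2) of a long horizontal strip 0 ≤ t < 2P, and let B be its mirror image.
-- As P and Q are coprime and P + Q is odd, all sums are distinct, and m points of A have length m.

module Submission where

open import Defs
open import Data.Bool.Base using (Bool; true; false; _∧_; _xor_; not; if_then_else_)
open import Data.Bool.Properties using (xor-same; ∧-zeroʳ)
open import Data.Bool.Solver using (module xor-∧-Solver)
open import Data.Empty using (⊥; ⊥-elim)
open import Data.Fin.Base using (Fin; zero; suc; inject₁; toℕ; fromℕ<; combine; remQuot; finToFun; funToFin)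
import Data.Fin.Properties as Fin
import Data.Nat.Base as ℕ
import Data.Nat.DivMod as ℕ
import Data.Nat.Properties as ℕ
import Data.Nat.Tactic.RingSolver as ℕ-Solver
open import Data.Nat.Base using (ℕ; zero; suc; NonZero)
open import Data.Product using (Σ; ∃; ∃₂; _×_; _,_; proj₁; proj₂; swap)
open import Data.Product.Properties using (≡-dec)
open import Data.Sum using (_⊎_; inj₁; inj₂; [_,_]′)
import Data.Sum as Sum
open import Function using (_∘_; id; case_of_)
open import Function.Definitions using (Injective)
open import Relation.Binary.Definitions using (DecidableEquality; Tri; tri<; tri≈; tri>)
open import Relation.Binary.PropositionalEquality
open import Relation.Nullary using (¬_; Dec; yes; no; does)
open import Relation.Nullary.Decidable
  using (dec-true; dec-false; decidable-stable; map′; ¬?; _×-dec_; _⊎-dec_; _→-dec_)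

-- Planarity enters in one form only: two lattice paths that cross share a vertex. To exploit it, a
-- chord `δ` at the first point of a walk is turned into a periodic band, the union of the
-- translates by multiples of `δ` of the walk without that point. The first step of the walk, moved
-- along `δ`, ties consecutive translates together. Two points of the band differ by a chord of the
-- shortened walk plus a multiple of `δ`, so a meeting of the band with a translate of itself is a
-- statement about a shorter walk. This is why the chord arguments remove one point at a time. Each
-- of e₁ and e₂ is missing from at least one of the walks. If the same walk lacks both, it alone
-- gives the bound. Otherwise one walk is long in the direction x - y and the other in the direction
-- x + y. Each of these spans alone gives only m ≤ n + O(1); the factor 2 comes from combining them
-- on suitable corners of the grid. None of these alternatives has to be decided, because the final
-- inequality is decidable.

module GridPaths where

  open import Data.Integer.Base using (ℤ; _<_; _≤_) renaming (suc to sucℤ)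
  open import Data.Integer.Properties

  -- Crossing parity of lattice paths in the plane.

  Pt : Set
  Pt = ℤ × ℤ

  infix 4 _~_
  data _~_ : Pt → Pt → Set where
    east  : ∀ {x y} → (x , y) ~ (sucℤ x , y)
    west  : ∀ {x y} → (sucℤ x , y) ~ (x , y)
    north : ∀ {x y} → (x , y) ~ (x , sucℤ y)
    south : ∀ {x y} → (x , sucℤ y) ~ (x , y)

  ~-sym : ∀ {P Q} → P ~ Q → Q ~ P
  ~-sym east  = west
  ~-sym west  = east
  ~-sym north = south
  ~-sym south = north

  data Path (S : Pt → Set) : Pt → Pt → Set where
    stay : ∀ {P} → S P → Path S P P
    go   : ∀ {P Q R} → S P → P ~ Q → Path S Q R → Path S P R

  first : ∀ {S P Q} → Path S P Q → S P
  first (stay s) = s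
  first (go s _ _) = s

  lt : ℤ → ℤ → Bool
  lt a b = does (a <? b)

  lt-yes : ∀ {a b} → a < b → lt a b ≡ true
  lt-yes {a} {b} = dec-true (a <? b)

  lt-no : ∀ {a b} → b ≤ a → lt a b ≡ false
  lt-no {a} {b} b≤a = dec-false (a <? b) (≤⇒≯ b≤a)

  lt-sucʳ : ∀ a b → a ≡ b ⊎ lt a (sucℤ b) ≡ lt a b
  lt-sucʳ a b with <-cmp a b
  ... | tri< a<b _ _ = inj₂ (trans (lt-yes (<-≤-trans a<b (i≤suc[i] b))) (sym (lt-yes a<b)))
  ... | tri≈ _ a≡b _ = inj₁ a≡b
  ... | tri> _ _ b<a = inj₂ (trans (lt-no (i<j⇒suc[i]≤j b<a)) (sym (lt-no (<⇒≤ b<a))))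

  <suc⇒≤ : ∀ {a b} → b < sucℤ a → b ≤ a
  <suc⇒≤ {a} b<sa = subst (_ ≤_) (pred-suc a) (i<j⇒i≤pred[j] b<sa)

  lt-sucˡ : ∀ a b → b ≡ sucℤ a ⊎ lt (sucℤ a) b ≡ lt a b
  lt-sucˡ a b with <-cmp (sucℤ a) b
  ... | tri< sa<b _ _ = inj₂ (trans (lt-yes sa<b) (sym (lt-yes (≤-<-trans (i≤suc[i] a) sa<b))))
  ... | tri≈ _ sa≡b _ = inj₁ (sym sa≡b)
  ... | tri> _ _ b<sa = inj₂ (trans (lt-no (<⇒≤ b<sa)) (sym (lt-no (<suc⇒≤ {a} b<sa))))

  module _ (Z : Pt → Set) where

    -- Parity of the number of edges of a path that cross the upward ray from a + (½ , ½).
    crossings : ∀ {U V} → Pt → Path Z U V → Bool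
    crossings a (stay _) = false
    crossings a@(x , y) (go {P = P} {Q} _ _ π) =
      (lt y (proj₂ P) ∧ (lt x (proj₁ Q) xor lt x (proj₁ P))) xor crossings a π

    xor-telescope : ∀ u v w → (v xor u) xor (w xor v) ≡ w xor u
    xor-telescope = solve 3 (λ u v w → (v :+ u) :+ (w :+ v) := w :+ u) refl
      where open xor-∧-Solver

    ∧-xor-same : ∀ c b → c ∧ (b xor b) ≡ false
    ∧-xor-same c b = trans (cong (c ∧_) (xor-same b)) (∧-zeroʳ c)

    -- Only a horizontal edge with an endpoint in the column x can cross the line at x + ½.
    column-edge : ∀ {P Q} x (c : Bool) → P ~ Q → Z P → Z Q →
      (∀ {w} → Z (x , w) → w ≡ proj₂ P → c ≡ true) →
      c ∧ (lt x (proj₁ Q) xor lt x (proj₁ P)) ≡ lt x (proj₁ Q) xor lt x (proj₁ P)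
    column-edge x c (east {x′} {y}) p q h with lt-sucʳ x x′
    ... | inj₁ refl rewrite h p refl = refl
    ... | inj₂ e rewrite e | ∧-xor-same c (lt x x′) = sym (xor-same (lt x x′))
    column-edge x c (west {x′} {y}) p q h with lt-sucʳ x x′
    ... | inj₁ refl rewrite h q refl = refl
    ... | inj₂ e rewrite e | ∧-xor-same c (lt x x′) = sym (xor-same (lt x x′))
    column-edge x c (north {x′}) p q h rewrite ∧-xor-same c (lt x x′) = sym (xor-same (lt x x′))
    column-edge x c (south {x′}) p q h rewrite ∧-xor-same c (lt x x′) = sym (xor-same (lt x x′))

    -- An edge that crosses the line at x + ½ has an endpoint in the column `x`, hence lies above
    -- the base point. So every crossing of that line is counted, and the parity depends only on the
    -- sides on which the path starts and ends.
    crossings-above : ∀ {U V} x y (π : Path Z U V) → (∀ {w} → Z (x , w) → y < w) →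
      crossings (x , y) π ≡ lt x (proj₁ V) xor lt x (proj₁ U)
    crossings-above {U} x y (stay _) h = sym (xor-same (lt x (proj₁ U)))
    crossings-above {U} {V} x y (go {Q = Q} p e π) h = trans
      (cong₂ _xor_ (column-edge x _ e p (first π) λ z eq → lt-yes (subst (y <_) eq (h z)))
                   (crossings-above x y π h))
      (xor-telescope (lt x (proj₁ U)) (lt x (proj₁ Q)) (lt x (proj₁ V)))

    crossings-below : ∀ {U V} x y (π : Path Z U V) → (∀ {w} → Z (x , w) → w < y) →
      crossings (x , y) π ≡ false
    crossings-below x y (stay _) h = refl
    crossings-below x y (go {P} {Q} p e π) h = trans (cong₂ _xor_ (edge e p (first π)) (crossings-below x y π h)) refl
      where
      edge : ∀ {P Q} → P ~ Q → Z P → Z Q → lt y (proj₂ P) ∧ (lt x (proj₁ Q) xor lt x (proj₁ P)) ≡ false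
      edge (east {x′}) p q with lt-sucʳ x x′
      ... | inj₁ refl rewrite lt-no (<⇒≤ (h p)) = refl
      ... | inj₂ eq rewrite eq = ∧-xor-same _ (lt x x′)
      edge (west {x′}) p q with lt-sucʳ x x′
      ... | inj₁ refl rewrite lt-no (<⇒≤ (h q)) = refl
      ... | inj₂ eq rewrite eq = ∧-xor-same _ (lt x x′)
      edge (north {x′}) p q = ∧-xor-same _ (lt x x′)
      edge (south {x′}) p q = ∧-xor-same _ (lt x x′)

    -- Moving the base point up shortens the ray by a piece that only the horizontal edge from
    -- `(x , sucℤ y)` to the right could cross.
    crossings-north : ∀ {U V} x y (π : Path Z U V) → ¬ Z (x , sucℤ y) →
      crossings (x , sucℤ y) π ≡ crossings (x , y) π
    crossings-north x y (stay _) ∉Z = refl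
    crossings-north x y (go p e π) ∉Z = cong₂ _xor_ (edge e p (first π)) (crossings-north x y π ∉Z)
      where
      edge : ∀ {P Q} → P ~ Q → Z P → Z Q →
        lt (sucℤ y) (proj₂ P) ∧ (lt x (proj₁ Q) xor lt x (proj₁ P)) ≡ lt y (proj₂ P) ∧ (lt x (proj₁ Q) xor lt x (proj₁ P))
      edge (east {x′} {y′}) p q with lt-sucʳ x x′ | lt-sucˡ y y′
      ... | inj₁ refl | inj₁ refl = ⊥-elim (∉Z p)
      ... | _ | inj₂ eq rewrite eq = refl
      ... | inj₂ eq | _ rewrite eq = trans (∧-xor-same _ (lt x x′)) (sym (∧-xor-same _ (lt x x′)))
      edge (west {x′} {y′}) p q with lt-sucʳ x x′ | lt-sucˡ y y′
      ... | inj₁ refl | inj₁ refl = ⊥-elim (∉Z q)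
      ... | _ | inj₂ eq rewrite eq = refl
      ... | inj₂ eq | _ rewrite eq = trans (∧-xor-same _ (lt x x′)) (sym (∧-xor-same _ (lt x x′)))
      edge (north {x′}) p q = trans (∧-xor-same _ (lt x x′)) (sym (∧-xor-same _ (lt x x′)))
      edge (south {x′}) p q = trans (∧-xor-same _ (lt x x′)) (sym (∧-xor-same _ (lt x x′)))

    module _ (x y : ℤ) (∉Z : ¬ Z (sucℤ x , y)) where

      inColumn : Pt → Bool
      inColumn P = lt x (proj₁ P) xor lt (sucℤ x) (proj₁ P)

      aboveInColumn : Pt → Bool
      aboveInColumn P = lt y (proj₂ P) ∧ inColumn P

      slide : ∀ {P Q} → P ~ Q → Z P → Z Q → lt y (proj₂ P) ∧ inColumn Q ≡ aboveInColumn Q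
      slide east p q = refl
      slide west p q = refl
      slide (north {x′} {y′}) p q with lt-sucˡ x x′ | lt-sucʳ y y′
      ... | inj₁ refl | inj₁ refl = ⊥-elim (∉Z p)
      ... | _ | inj₂ eq rewrite eq = refl
      ... | inj₂ eq | _ rewrite eq = trans (∧-xor-same _ (lt x x′)) (sym (∧-xor-same _ (lt x x′)))
      slide (south {x′} {y′}) p q with lt-sucˡ x x′ | lt-sucʳ y y′
      ... | inj₁ refl | inj₁ refl = ⊥-elim (∉Z q)
      ... | _ | inj₂ eq rewrite eq = refl
      ... | inj₂ eq | _ rewrite eq = trans (∧-xor-same _ (lt x x′)) (sym (∧-xor-same _ (lt x x′)))

      -- The rays from two neighbouring base points bound a half-strip whose only vertices are those
      -- of the column `sucℤ x` above height `y`. A path enters or leaves it through one of the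
      -- rays; doing so through the bottom would use the missing vertex `(sucℤ x , y)`. Hence the
      -- endpoints decide the difference of the two parities.
      crossings-east : ∀ {U V} (π : Path Z U V) →
        crossings (sucℤ x , y) π xor crossings (x , y) π ≡ aboveInColumn V xor aboveInColumn U
      crossings-east {U} (stay _) = sym (xor-same (aboveInColumn U))
      crossings-east {U} {V} (go {P} {Q} p e π) = begin
        ((c ∧ (r′ Q xor r′ P)) xor crossings (sucℤ x , y) π) xor ((c ∧ (r Q xor r P)) xor crossings (x , y) π)
          ≡⟨ regroup c (r Q) (r P) (r′ Q) (r′ P) _ _ ⟩
        ((c ∧ inColumn Q) xor aboveInColumn P) xor (crossings (sucℤ x , y) π xor crossings (x , y) π)
          ≡⟨ cong₂ (λ u v → (u xor aboveInColumn P) xor v) (slide e p (first π)) (crossings-east π) ⟩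
        (aboveInColumn Q xor aboveInColumn P) xor (aboveInColumn V xor aboveInColumn Q)
          ≡⟨ xor-telescope (aboveInColumn P) (aboveInColumn Q) (aboveInColumn V) ⟩
        aboveInColumn V xor aboveInColumn P ∎
        where
        open ≡-Reasoning
        c = lt y (proj₂ P)
        r = λ (R : Pt) → lt x (proj₁ R)
        r′ = λ (R : Pt) → lt (sucℤ x) (proj₁ R)
        regroup : ∀ c r s r′ s′ k l → ((c ∧ (r′ xor s′)) xor k) xor ((c ∧ (r xor s)) xor l)
          ≡ ((c ∧ (r xor r′)) xor (c ∧ (s xor s′))) xor (k xor l)
        regroup = solve 7 (λ c r s r′ s′ k l →
          ((c :* (r′ :+ s′)) :+ k) :+ ((c :* (r :+ s)) :+ l) :=
          ((c :* (r :+ r′)) :+ (c :* (s :+ s′))) :+ (k :+ l)) refl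
          where open xor-∧-Solver

    xor-false : ∀ {a b} → a xor b ≡ false → a ≡ b
    xor-false {false} {false} _ = refl
    xor-false {true} {true} _ = refl

    crossings-east′ : ∀ {U V} x y (π : Path Z U V) → ¬ Z (sucℤ x , y) →
      proj₁ U < x → sucℤ x < proj₁ V → crossings (sucℤ x , y) π ≡ crossings (x , y) π
    crossings-east′ {U} {V} x y π ∉Z U<x x<V = xor-false (begin
      crossings (sucℤ x , y) π xor crossings (x , y) π ≡⟨ crossings-east x y ∉Z π ⟩
      aboveInColumn x y ∉Z V xor aboveInColumn x y ∉Z U ≡⟨ cong₂ (λ u v → (lt y (proj₂ V) ∧ u) xor (lt y (proj₂ U) ∧ v)) inV inU ⟩
      (lt y (proj₂ V) ∧ false) xor (lt y (proj₂ U) ∧ false) ≡⟨ cong₂ _xor_ (∧-zeroʳ (lt y (proj₂ V))) (∧-zeroʳ (lt y (proj₂ U))) ⟩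
      false ∎)
      where
      open ≡-Reasoning
      inV : inColumn x y ∉Z V ≡ false
      inV rewrite lt-yes x<V | lt-yes (≤-<-trans (i≤suc[i] x) x<V) = refl
      inU : inColumn x y ∉Z U ≡ false
      inU rewrite lt-no (<⇒≤ U<x) | lt-no (≤-trans (<⇒≤ U<x) (i≤suc[i] x)) = refl

    module _ {S : Pt → Set} (disjoint : ∀ {P} → S P → ¬ Z P) {U V} (π : Path Z U V)
             (U<S : ∀ {P} → S P → proj₁ U < proj₁ P) (S<V : ∀ {P} → S P → proj₁ P < proj₁ V) where

      crossings-step : ∀ {P Q} → P ~ Q → S P → S Q → crossings Q π ≡ crossings P π
      crossings-step (east {x} {y}) p q = crossings-east′ x y π (disjoint q) (U<S p) (S<V q)
      crossings-step (west {x} {y}) p q = sym (crossings-east′ x y π (disjoint p) (U<S q) (S<V p))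
      crossings-step (north {x} {y}) p q = crossings-north x y π (disjoint q)
      crossings-step (south {x} {y}) p q = sym (crossings-north x y π (disjoint p))

      crossings-path : ∀ {X Y} → Path S X Y → crossings Y π ≡ crossings X π
      crossings-path (stay _) = refl
      crossings-path (go p e σ) = trans (crossings-path σ) (crossings-step e p (first σ))

      -- The parity is constant along `σ`. At `X` the upward ray meets no edge of `π`; at `Y` it
      -- catches every crossing of a vertical line that separates the ends `U` and `V`, an odd
      -- number.
      paths-cross : ∀ {X Y} → Path S X Y →
        (∀ {w} → Z (proj₁ X , w) → w < proj₂ X) → (∀ {w} → Z (proj₁ Y , w) → proj₂ Y < w) →
        S X → S Y → ⊥
      paths-cross {X} {Y} σ top bottom sX sY = true≢false (begin
        true ≡⟨ cong₂ _xor_ (lt-yes (S<V sY)) (lt-no (<⇒≤ (U<S sY))) ⟨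
        lt (proj₁ Y) (proj₁ V) xor lt (proj₁ Y) (proj₁ U) ≡⟨ crossings-above _ _ π bottom ⟨
        crossings Y π ≡⟨ crossings-path σ ⟩
        crossings X π ≡⟨ crossings-below _ _ π top ⟩
        false ∎)
        where
        open ≡-Reasoning
        true≢false : true ≡ false → ⊥
        true≢false ()

-- Periodic bands and how they separate the plane.

module Bands where

  open import Data.Integer.Base hiding (_⊖_; suc; NonZero)
  open import Data.Integer.Properties
  open import Data.Integer.Tactic.RingSolver using (solve-∀)
  open GridPaths

  -- Linear inequalities are proved by writing the difference of the two sides as an evidently nonnegative expression.
  ≤-by : ∀ {a b e} → 0ℤ ≤ e → b - a ≡ e → a ≤ b
  ≤-by 0≤e eq = 0≤i-j⇒j≤i (subst (0ℤ ≤_) (sym eq) 0≤e)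

  infixl 6 _⊹_
  _⊹_ : ∀ {a b} → 0ℤ ≤ a → 0ℤ ≤ b → 0ℤ ≤ a + b
  _⊹_ = +-mono-≤

  infixl 7 _⊛_
  _⊛_ : ∀ {a b} → 0ℤ ≤ a → 0ℤ ≤ b → 0ℤ ≤ a * b
  _⊛_ {+ m} {+ n} _ _ = subst (0ℤ ≤_) (pos-* m n) (+≤+ ℕ.z≤n)

  diff : ∀ {a b} → a ≤ b → 0ℤ ≤ b - a
  diff = i≤j⇒0≤j-i

  infixl 6 _⊕_ _⊖_
  _⊕_ _⊖_ : Pt → Pt → Pt
  (a , b) ⊕ (c , d) = a + c , b + d
  (a , b) ⊖ (c , d) = a - c , b - d

  infixl 7 _•_
  _•_ : ℤ → Pt → Pt
  k • (a , b) = k * a , k * b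

  𝟎 : Pt
  𝟎 = 0ℤ , 0ℤ

  -- As a function of its second argument, this is the height across the direction of the first one,
  -- up to scale: it is constant along `δ`.
  det : Pt → Pt → ℤ
  det (a , b) (x , y) = a * y - b * x

  ⊕⊖ : ∀ P Q → P ⊕ Q ⊖ Q ≡ P
  ⊕⊖ (a , b) (c , d) = cong₂ _,_ (eq a c) (eq b d)
    where eq : ∀ a c → a + c - c ≡ a
          eq = solve-∀

  ⊖⊕ : ∀ P Q → P ⊖ Q ⊕ Q ≡ P
  ⊖⊕ (a , b) (c , d) = cong₂ _,_ (eq a c) (eq b d)
    where eq : ∀ a c → a - c + c ≡ a
          eq = solve-∀

  det-⊕ : ∀ δ P Q → det δ (P ⊕ Q) ≡ det δ P + det δ Q
  det-⊕ (a , b) (x , y) (z , w) = eq a b x y z w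
    where eq : ∀ a b x y z w → a * (y + w) - b * (x + z) ≡ (a * y - b * x) + (a * w - b * z)
          eq = solve-∀

  det-⊖ : ∀ δ P Q → det δ (P ⊖ Q) ≡ det δ P - det δ Q
  det-⊖ (a , b) (x , y) (z , w) = eq a b x y z w
    where eq : ∀ a b x y z w → a * (y - w) - b * (x - z) ≡ (a * y - b * x) - (a * w - b * z)
          eq = solve-∀

  det-self : ∀ δ → det δ δ ≡ 0ℤ
  det-self (a , b) = eq a b
    where eq : ∀ a b → a * b - b * a ≡ 0ℤ
          eq = solve-∀

  det-neg : ∀ δ P → det (𝟎 ⊖ δ) P ≡ - det δ P
  det-neg (a , b) (x , y) = eq a b x y
    where eq : ∀ a b x y → (0ℤ - a) * y - (0ℤ - b) * x ≡ - (a * y - b * x)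
          eq = solve-∀

  det-swap : ∀ δ P → det (swap δ) (swap P) ≡ - det δ P
  det-swap (a , b) (x , y) = eq a b x y
    where eq : ∀ a b x y → b * x - a * y ≡ - (a * y - b * x)
          eq = solve-∀

  ~-shift : ∀ {P Q} V → P ~ Q → P ⊕ V ~ Q ⊕ V
  ~-shift (a , b) (east {x} {y}) = subst (λ z → (x + a , y + b) ~ (z , y + b)) (sym (+-assoc 1ℤ x a)) east
  ~-shift (a , b) (west {x} {y}) = subst (λ z → (z , y + b) ~ (x + a , y + b)) (sym (+-assoc 1ℤ x a)) west
  ~-shift (a , b) (north {x} {y}) = subst (λ z → (x + a , y + b) ~ (x + a , z)) (sym (+-assoc 1ℤ y b)) north
  ~-shift (a , b) (south {x} {y}) = subst (λ z → (x + a , z) ~ (x + a , y + b)) (sym (+-assoc 1ℤ y b)) south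

  ~-swap : ∀ {P Q} → P ~ Q → swap P ~ swap Q
  ~-swap east = north
  ~-swap west = south
  ~-swap north = east
  ~-swap south = west

  path-map : ∀ {S S′ : Pt → Set} (f : Pt → Pt) → (∀ {P Q} → P ~ Q → f P ~ f Q) → (∀ {P} → S P → S′ (f P)) →
    ∀ {P Q} → Path S P Q → Path S′ (f P) (f Q)
  path-map f step S⇒S′ (stay s) = stay (S⇒S′ s)
  path-map f step S⇒S′ (go s e π) = go (S⇒S′ s) (step e) (path-map f step S⇒S′ π)

  weaken : ∀ {S S′ : Pt → Set} → (∀ {P} → S P → S′ P) → ∀ {P Q} → Path S P Q → Path S′ P Q
  weaken = path-map (λ P → P) (λ e → e)

  shift : ∀ {S S′ : Pt → Set} V → (∀ {P} → S P → S′ (P ⊕ V)) → ∀ {P Q} → Path S P Q → Path S′ (P ⊕ V) (Q ⊕ V)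
  shift V = path-map (_⊕ V) (~-shift V)

  module _ {S : Pt → Set} where

    infixr 5 _◅◅_
    _◅◅_ : ∀ {P Q R} → Path S P Q → Path S Q R → Path S P R
    stay _ ◅◅ π = π
    go s e ρ ◅◅ π = go s e (ρ ◅◅ π)

    last : ∀ {P Q} → Path S P Q → S Q
    last (stay s) = s
    last (go _ _ π) = last π

    reverse : ∀ {P Q} → Path S P Q → Path S Q P
    reverse (stay s) = stay s
    reverse (go s e π) = reverse π ◅◅ go (first π) (~-sym e) (stay s)

    Within : ℕ → Pt → Set
    Within b P = S P × ∣ proj₁ P ∣ ℕ.< b

    -- A path is finite, so a band can be followed on both sides to columns beyond it.
    bounded : ∀ {P Q} → Path S P Q → ∃ λ b → Path (Within b) P Q
    bounded (stay {P} s) = ℕ.suc ∣ proj₁ P ∣ , stay (s , ℕ.≤-refl)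
    bounded (go {P} s e π) with bounded π
    ... | b , π′ = (ℕ.suc ∣ proj₁ P ∣) ℕ.⊔ b , go (s , ℕ.m≤m⊔n _ b) e
      (weaken (λ (s′ , lt) → s′ , ℕ.<-≤-trans lt (ℕ.m≤n⊔m _ _)) π′)

  -- A discrete substitute for a bi-infinite periodic curve. Its extreme heights are attained, so
  -- `top` and `bottom` express being above or below it without speaking of components of the
  -- complement.
  record Band (Δ : Pt → Set) (δ : Pt) : Set where
    field
      connected : ∀ {P Q} → Δ P → Δ Q → Path Δ P Q
      shift⁺ : ∀ {P} → Δ P → Δ (P ⊕ δ)
      shift⁻ : ∀ {P} → Δ P → Δ (P ⊖ δ)
      top bottom : Pt
      top∈ : Δ top
      bottom∈ : Δ bottom
      ≤top : ∀ {P} → Δ P → det δ P ≤ det δ top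
      bottom≤ : ∀ {P} → Δ P → det δ bottom ≤ det δ P

  open Band

  Separates : (Pt → Set) → Pt → Set₁
  Separates Δ δ = (B : Band Δ δ) → ∀ {S X Y} → (∀ {P} → S P → ¬ Δ P) → Path S X Y →
    det δ (top B) ≤ det δ X → det δ Y ≤ det δ (bottom B) → ⊥

  <b⇒ : ∀ {b} i → ∣ i ∣ ℕ.< b → - (+ b) < i × i < + b
  <b⇒ {ℕ.suc b} (+ n) lt = -<+ , +<+ lt
  <b⇒ {ℕ.suc b} -[1+ n ] lt = -<- (ℕ.s<s⁻¹ lt) , -<+

  -- When `δ` points to the right, `det δ` increases with y in each column. A point at least as high
  -- as `top` in the sense of `det δ` is therefore above all points of the band in its own column,
  -- as the crossing lemma requires.
  separates-right : ∀ {Δ δ} → 0ℤ < proj₁ δ → Separates Δ δ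
  separates-right {Δ} {δ@(a , b)} 0<a B {S} {X} {Y} disjoint π high low with bounded π
  ... | w , π′ = paths-cross Δ (disjoint ∘ proj₁) (connected B (proj₁ (proj₂ left)) (proj₁ (proj₂ right)))
      (λ (_ , lt) → ≤-<-trans (proj₂ (proj₂ left)) (proj₁ (<b⇒ _ lt)))
      (λ (_ , lt) → <-≤-trans (proj₂ (<b⇒ _ lt)) (proj₂ (proj₂ right)))
      π′ below above (first π′) (last π′)
    where
    0≤a-1 : 0ℤ ≤ a - 1ℤ
    0≤a-1 = diff (i<j⇒suc[i]≤j 0<a)
    steps⁺ : ∀ n → ∃ λ P → Δ P × proj₁ (top B) + + n ≤ proj₁ P
    steps⁺ ℕ.zero = top B , top∈ B , ≤-reflexive (+-identityʳ _)
    steps⁺ (ℕ.suc n) with steps⁺ n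
    ... | P , P∈ , le = P ⊕ δ , shift⁺ B P∈ , ≤-by (diff le ⊹ 0≤a-1) (eq (proj₁ (top B)) (+ n) (proj₁ P) a)
      where eq : ∀ t n p a → p + a - (t + (1ℤ + n)) ≡ (p - (t + n)) + (a - 1ℤ)
            eq = solve-∀
    steps⁻ : ∀ n → ∃ λ P → Δ P × proj₁ P ≤ proj₁ (top B) - + n
    steps⁻ ℕ.zero = top B , top∈ B , ≤-reflexive (sym (+-identityʳ _))
    steps⁻ (ℕ.suc n) with steps⁻ n
    ... | P , P∈ , le = P ⊖ δ , shift⁻ B P∈ , ≤-by (diff le ⊹ 0≤a-1) (eq (proj₁ (top B)) (+ n) (proj₁ P) a)
      where eq : ∀ t n p a → (t - (1ℤ + n)) - (p - a) ≡ (t - n - p) + (a - 1ℤ)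
            eq = solve-∀
    t = proj₁ (top B)
    -- Each period advances by at least one column, so this many periods lead from column `t` beyond
    -- distance `w` on either side.
    k = ℕ.suc ∣ t ∣ ℕ.+ w
    right : ∃ λ P → Δ P × + w ≤ proj₁ P
    right = let P , P∈ , le = steps⁺ k in P , P∈ , ≤-by (diff le ⊹ diff (<⇒≤ (proj₁ (<b⇒ t ℕ.≤-refl))))
      (eq t (+ ∣ t ∣) (+ w) (proj₁ P))
      where eq : ∀ t s w p → p - w ≡ (p - (t + (1ℤ + s + w))) + (t - (- (1ℤ + s)))
            eq = solve-∀
    left : ∃ λ P → Δ P × proj₁ P ≤ - + w
    left = let P , P∈ , le = steps⁻ k in P , P∈ , ≤-by (diff le ⊹ diff (<⇒≤ (proj₂ (<b⇒ t ℕ.≤-refl))))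
      (eq t (+ ∣ t ∣) (+ w) (proj₁ P))
      where eq : ∀ t s w p → - w - p ≡ ((t - (1ℤ + s + w)) - p) + ((1ℤ + s) - t)
            eq = solve-∀
    column : ∀ x u v → det δ (x , u) ≤ det δ (x , v) → u ≤ v
    column x u v le = *-cancelˡ-≤-pos u v a {{positive 0<a}} (≤-by (diff le) (eq a b x u v))
      where eq : ∀ a b x u v → a * v - a * u ≡ (a * v - b * x) - (a * u - b * x)
            eq = solve-∀
    below : ∀ {v} → Δ (proj₁ X , v) → v < proj₂ X
    below {v} v∈ = ≤∧≢⇒< (column _ _ _ (≤-trans (≤top B v∈) high)) λ { refl → disjoint (first π) v∈ }
    above : ∀ {v} → Δ (proj₁ Y , v) → proj₂ Y < v
    above {v} v∈ = ≤∧≢⇒< (column _ _ _ (≤-trans low (bottom≤ B v∈))) λ { refl → disjoint (last π) v∈ }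

  band-neg : ∀ {Δ δ} → Band Δ δ → Band Δ (𝟎 ⊖ δ)
  band-neg {Δ} {δ} B = record
    { connected = connected B
    ; shift⁺ = λ {P} P∈ → subst Δ (eq₁ P δ) (shift⁻ B P∈)
    ; shift⁻ = λ {P} P∈ → subst Δ (eq₂ P δ) (shift⁺ B P∈)
    ; top = bottom B ; bottom = top B ; top∈ = bottom∈ B ; bottom∈ = top∈ B
    ; ≤top = λ {P} P∈ → subst₂ _≤_ (sym (det-neg δ P)) (sym (det-neg δ (bottom B))) (neg-mono-≤ (bottom≤ B P∈))
    ; bottom≤ = λ {P} P∈ → subst₂ _≤_ (sym (det-neg δ (top B))) (sym (det-neg δ P)) (neg-mono-≤ (≤top B P∈))
    }
    where
    eq₁ : ∀ P δ → P ⊖ δ ≡ P ⊕ (𝟎 ⊖ δ)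
    eq₁ (a , b) (c , d) = cong₂ _,_ (eq a c) (eq b d)
      where eq : ∀ a c → a - c ≡ a + (0ℤ - c)
            eq = solve-∀
    eq₂ : ∀ P δ → P ⊕ δ ≡ P ⊖ (𝟎 ⊖ δ)
    eq₂ (a , b) (c , d) = cong₂ _,_ (eq a c) (eq b d)
      where eq : ∀ a c → a + c ≡ a - (0ℤ - c)
            eq = solve-∀

  -- A reflection reverses orientation, so `top` and `bottom` trade places.
  band-swap : ∀ {Δ δ} → Band Δ δ → Band (Δ ∘ swap) (swap δ)
  band-swap {Δ} {δ} B = record
    { connected = λ p q → path-map swap ~-swap (λ r → r) (connected B p q)
    ; shift⁺ = shift⁺ B
    ; shift⁻ = shift⁻ B
    ; top = swap (bottom B) ; bottom = swap (top B) ; top∈ = bottom∈ B ; bottom∈ = top∈ B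
    ; ≤top = λ {P} P∈ → subst₂ _≤_ (sym (det-swap δ (swap P))) (sym (det-swap δ (bottom B))) (neg-mono-≤ (bottom≤ B P∈))
    ; bottom≤ = λ {P} P∈ → subst₂ _≤_ (sym (det-swap δ (top B))) (sym (det-swap δ (swap P))) (neg-mono-≤ (≤top B P∈))
    }

  separates-neg : ∀ {Δ δ} → Separates Δ (𝟎 ⊖ δ) → Separates Δ δ
  separates-neg {δ = δ} sep B {X = X} {Y} disjoint π high low = sep (band-neg B) disjoint (reverse π)
    (subst₂ _≤_ (sym (det-neg δ (bottom B))) (sym (det-neg δ Y)) (neg-mono-≤ low))
    (subst₂ _≤_ (sym (det-neg δ X)) (sym (det-neg δ (top B))) (neg-mono-≤ high))

  separates-swap : ∀ {Δ δ} → Separates (Δ ∘ swap) (swap δ) → Separates Δ δ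
  separates-swap {δ = δ} sep B {S} {X} {Y} disjoint π high low =
    sep (band-swap B) {S = S ∘ swap} disjoint (path-map swap ~-swap (λ s → s) (reverse π))
    (subst₂ _≤_ (sym (det-swap δ (bottom B))) (sym (det-swap δ Y)) (neg-mono-≤ low))
    (subst₂ _≤_ (sym (det-swap δ X)) (sym (det-swap δ (top B))) (neg-mono-≤ high))

  separates-x : ∀ {Δ δ} → proj₁ δ ≢ 0ℤ → Separates Δ δ
  separates-x {δ = a , b} a≢0 with <-cmp 0ℤ a
  ... | tri< 0<a _ _ = separates-right 0<a
  ... | tri≈ _ 0≡a _ = ⊥-elim (a≢0 (sym 0≡a))
  ... | tri> _ _ a<0 = separates-neg (separates-right (subst (0ℤ <_) (sym (+-identityˡ (- a))) (neg-mono-< a<0)))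

  separates : ∀ {Δ δ} → δ ≢ 𝟎 → Separates Δ δ
  separates {δ = a , b} δ≢0 with a ≟ 0ℤ | b ≟ 0ℤ
  ... | no a≢0 | _ = separates-x a≢0
  ... | yes _ | no b≢0 = separates-swap (separates-x b≢0)
  ... | yes refl | yes refl = ⊥-elim (δ≢0 refl)

-- Bands generated by walks, and their disjoint translates.

module Walks where

  open import Data.Integer.Base hiding (_⊖_; suc; NonZero)
  open import Data.Integer.Properties
  open import Data.Integer.Tactic.RingSolver using (solve-∀)
  open GridPaths
  open Bands

  open Band

  ⊕-identityʳ : ∀ P → P ⊕ 𝟎 ≡ P
  ⊕-identityʳ (a , b) = cong₂ _,_ (+-identityʳ a) (+-identityʳ b)

  det-• : ∀ δ s P → det δ (s • P) ≡ s * det δ P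
  det-• (a , b) s (x , y) = eq a b s x y
    where eq : ∀ a b s x y → a * (s * y) - b * (s * x) ≡ s * (a * y - b * x)
          eq = solve-∀

  IsWalk : ∀ {n} → (Fin (suc n) → Pt) → Set
  IsWalk W = ∀ i → W (inject₁ i) ~ W (suc i)

  Image : ∀ {n} → (Fin n → Pt) → Pt → Set
  Image W P = ∃ λ i → P ≡ W i

  walk-path₀ : ∀ {n} {W : Fin (suc n) → Pt} → IsWalk W → ∀ i → Path (Image W) (W zero) (W i)
  walk-path₀ walk zero = stay (zero , refl)
  walk-path₀ {suc n} walk (suc i) =
    go (zero , refl) (walk zero) (weaken (λ (j , eq) → suc j , eq) (walk-path₀ (walk ∘ suc) i))

  argmax : ∀ {n} (g : Fin (suc n) → ℤ) → ∃ λ i → ∀ j → g j ≤ g i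
  argmax {zero} g = zero , λ { zero → ≤-refl }
  argmax {suc n} g with argmax (g ∘ suc)
  ... | i , max with ≤-total (g (suc i)) (g zero)
  ... | inj₁ le = zero , λ { zero → ≤-refl ; (suc j) → ≤-trans (max j) le }
  ... | inj₂ le = suc i , λ { zero → le ; (suc j) → max j }

  argmin : ∀ {n} (g : Fin (suc n) → ℤ) → ∃ λ i → ∀ j → g i ≤ g j
  argmin g with argmax (-_ ∘ g)
  ... | i , max = i , neg-cancel-≤ ∘ max

  Translates : ∀ {n} → (Fin n → Pt) → Pt → Pt → Set
  Translates W δ P = ∃₂ λ i s → P ≡ W i ⊕ s • δ

  module _ {n} {W : Fin (suc n) → Pt} (walk : IsWalk W) (δ : Pt) where

    private
      Δ = Translates W δ

    det-translate : ∀ {P} → (P∈ : Δ P) → det δ P ≡ det δ (W (proj₁ P∈))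
    det-translate (i , s , refl) = begin
      det δ (W i ⊕ s • δ)             ≡⟨ det-⊕ δ (W i) (s • δ) ⟩
      det δ (W i) + det δ (s • δ)     ≡⟨ cong (λ z → det δ (W i) + z) (trans (det-• δ s δ) (cong (s *_) (det-self δ))) ⟩
      det δ (W i) + s * 0ℤ            ≡⟨ eq (det δ (W i)) s ⟩
      det δ (W i)                     ∎
      where
      open ≡-Reasoning
      eq : ∀ d s → d + s * 0ℤ ≡ d
      eq = solve-∀

    translates-shift : ∀ k {P} → Δ P → Δ (P ⊕ k • δ)
    translates-shift k (i , s , refl) = i , s + k , eq (W i) δ
      where
      eq : ∀ P δ → P ⊕ s • δ ⊕ k • δ ≡ P ⊕ (s + k) • δ
      eq (a , b) (c , d) = cong₂ _,_ (eq′ a c s k) (eq′ b d s k)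
        where eq′ : ∀ a c s k → a + s * c + k * c ≡ a + (s + k) * c
              eq′ = solve-∀

    along : ∀ i s → Path Δ (W zero ⊕ s • δ) (W i ⊕ s • δ)
    along i s = shift {Image W} {Δ} (s • δ) (λ { (j , refl) → j , s , refl }) {W zero} {W i} (walk-path₀ {W = W} walk i)

    module _ (j : Fin (suc n)) (link : W j ~ W zero ⊕ δ) where

      next : ∀ s → Path Δ (W zero ⊕ s • δ) (W zero ⊕ (1ℤ + s) • δ)
      next s = along j s ◅◅ go (j , s , refl) (subst (W j ⊕ s • δ ~_) (eq (W zero) δ) (~-shift (s • δ) link))
        (stay (zero , 1ℤ + s , refl))
        where
        eq : ∀ P δ → P ⊕ δ ⊕ s • δ ≡ P ⊕ (1ℤ + s) • δ
        eq (a , b) (c , d) = cong₂ _,_ (eq′ a c s) (eq′ b d s)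
          where eq′ : ∀ a c s → a + c + s * c ≡ a + (1ℤ + s) * c
                eq′ = solve-∀

      to-start : ∀ s → Path Δ (W zero ⊕ 0ℤ • δ) (W zero ⊕ s • δ)
      to-start (+ zero) = stay (zero , 0ℤ , refl)
      to-start (+ suc m) = to-start (+ m) ◅◅ next (+ m)
      to-start -[1+ zero ] = reverse (next -[1+ zero ])
      to-start -[1+ suc m ] = to-start -[1+ m ] ◅◅ reverse (next -[1+ suc m ])

      -- `link` joins each translate of the walk to the next. As `det δ` agrees on all translates of
      -- a point, its extremes over the infinite band are those over the finite walk.
      translates-band : Band Δ δ
      translates-band = record
        { connected = λ P∈ Q∈ → reverse (reach P∈) ◅◅ reach Q∈
        ; shift⁺ = λ {P} P∈ → subst (λ Q → Δ (P ⊕ Q)) (1• δ) (translates-shift 1ℤ P∈)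
        ; shift⁻ = λ {P} P∈ → subst Δ (-1• P δ) (translates-shift -1ℤ P∈)
        ; top = W t ; bottom = W b
        ; top∈ = t , 0ℤ , sym (0• (W t) δ) ; bottom∈ = b , 0ℤ , sym (0• (W b) δ)
        ; ≤top = λ P∈ → ≤-trans (≤-reflexive (det-translate P∈)) (t-max (proj₁ P∈))
        ; bottom≤ = λ P∈ → ≤-trans (b-min (proj₁ P∈)) (≤-reflexive (sym (det-translate P∈)))
        }
        where
        reach : ∀ {P} → Δ P → Path Δ (W zero ⊕ 0ℤ • δ) P
        reach (i , s , refl) = to-start s ◅◅ along i s
        t = proj₁ (argmax (det δ ∘ W))
        t-max = proj₂ (argmax (det δ ∘ W))
        b = proj₁ (argmin (det δ ∘ W))
        b-min = proj₂ (argmin (det δ ∘ W))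
        1• : ∀ P → 1ℤ • P ≡ P
        1• (a , b) = cong₂ _,_ (*-identityˡ a) (*-identityˡ b)
        0• : ∀ P δ → P ⊕ 0ℤ • δ ≡ P
        0• (a , b) (c , d) = cong₂ _,_ (+-identityʳ a) (+-identityʳ b)
        -1• : ∀ P δ → P ⊕ -1ℤ • δ ≡ P ⊖ δ
        -1• (a , b) (c , d) = cong₂ _,_ (eq a c) (eq b d)
          where eq : ∀ a c → a + -1ℤ * c ≡ a - c
                eq = solve-∀

  Avoids : (Pt → Set) → Pt → Set
  Avoids Δ β = ∀ {P} → Δ P → ¬ Δ (P ⊕ β)

  module _ {Δ : Pt → Set} {δ : Pt} (B : Band Δ δ) (δ≢0 : δ ≢ 𝟎) where

    -- A translate of the band along itself would have to cross it.
    parallel-meets : ∀ β → det δ β ≡ 0ℤ → ¬ Avoids Δ β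
    parallel-meets β β∥δ avoids = separates δ≢0 B {S = λ P → Δ (P ⊖ β)}
      (λ {P} P∈ P∈′ → avoids P∈ (subst Δ (sym (⊖⊕ P β)) P∈′))
      (shift β (λ {P} → subst Δ (sym (⊕⊖ P β))) (connected B (top∈ B) (bottom∈ B)))
      (≤-reflexive (sym (same (top B)))) (≤-reflexive (same (bottom B)))
      where
      same : ∀ P → det δ (P ⊕ β) ≡ det δ P
      same P = trans (det-⊕ δ P β) (trans (cong (λ z → det δ P + z) β∥δ) (+-identityʳ _))

    -- By the sign of det δ, a disjoint translate lies above the band, and "lies above" is transitive.
    avoids-⊕ : ∀ {β ε} → 0ℤ ≤ det δ β → 0ℤ ≤ det δ ε → Avoids Δ β → Avoids Δ ε → Avoids Δ (β ⊕ ε)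
    avoids-⊕ {β} {ε} 0≤β 0≤ε avoids-β avoids-ε {Q} Q∈ Q+β+ε∈ = separates δ≢0 B {S = S} disjoint
      (upper ◅◅ lower) high low
      where
      -- The path runs in the translate by `β` from above the band to `Q ⊕ β`. This point also lies
      -- in the translate by the opposite of `ε`, in which the path continues to below the band.
      S : Pt → Set
      S P = Δ (P ⊖ β) ⊎ Δ (P ⊕ ε)
      disjoint : ∀ {P} → S P → ¬ Δ P
      disjoint {P} (inj₁ P-β∈) P∈ = avoids-β P-β∈ (subst Δ (sym (⊖⊕ P β)) P∈)
      disjoint (inj₂ P+ε∈) P∈ = avoids-ε P∈ P+ε∈
      upper : Path S (top B ⊕ β) (Q ⊕ β)
      upper = shift β (λ {P} P∈ → inj₁ (subst Δ (sym (⊕⊖ P β)) P∈)) (connected B (top∈ B) Q∈)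
      move : ∀ P ε → P ⊕ (𝟎 ⊖ ε) ⊕ ε ≡ P
      move (a , b) (c , d) = cong₂ _,_ (eq a c) (eq b d)
        where eq : ∀ a c → a + (0ℤ - c) + c ≡ a
              eq = solve-∀
      move′ : ∀ P β ε → P ⊕ (β ⊕ ε) ⊕ (𝟎 ⊖ ε) ≡ P ⊕ β
      move′ (a , b) (c , d) (e , f) = cong₂ _,_ (eq a c e) (eq b d f)
        where eq : ∀ a c e → a + (c + e) + (0ℤ - e) ≡ a + c
              eq = solve-∀
      lower : Path S (Q ⊕ β) (bottom B ⊕ (𝟎 ⊖ ε))
      lower = subst (λ R → Path S R (bottom B ⊕ (𝟎 ⊖ ε))) (move′ Q β ε)
        (shift (𝟎 ⊖ ε) (λ {P} P∈ → inj₂ (subst Δ (sym (move P ε)) P∈)) (connected B Q+β+ε∈ (bottom∈ B)))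
      high : det δ (top B) ≤ det δ (top B ⊕ β)
      high = ≤-by 0≤β (trans (cong (_- det δ (top B)) (det-⊕ δ (top B) β)) (eq (det δ (top B)) (det δ β)))
        where eq : ∀ a b → a + b - a ≡ b
              eq = solve-∀
      low : det δ (bottom B ⊕ (𝟎 ⊖ ε)) ≤ det δ (bottom B)
      low = ≤-by 0≤ε (trans (cong (λ z → det δ (bottom B) - z) (trans (det-⊕ δ (bottom B) (𝟎 ⊖ ε)) (cong (λ z → det δ (bottom B) + z) (det-⊖ δ 𝟎 ε))))
        (trans (cong (λ z → det δ (bottom B) - (det δ (bottom B) + (z - det δ ε))) (det-0 δ)) (eq (det δ (bottom B)) (det δ ε))))
        where eq : ∀ a b → a - (a + (0ℤ - b)) ≡ b
              eq = solve-∀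
              det-0 : ∀ δ → det δ 𝟎 ≡ 0ℤ
              det-0 (a , b) = eq′ a b
                where eq′ : ∀ a b → a * 0ℤ - b * 0ℤ ≡ 0ℤ
                      eq′ = solve-∀

    avoids-• : ∀ {ε} → 0ℤ ≤ det δ ε → Avoids Δ ε → ∀ n → Avoids Δ (+ suc n • ε)
    avoids-• {ε} 0≤ε avoids zero = subst (Avoids Δ) (cong₂ _,_ (sym (*-identityˡ (proj₁ ε))) (sym (*-identityˡ (proj₂ ε)))) avoids
    avoids-• {ε} 0≤ε avoids (suc n) = subst (Avoids Δ) (eq ε)
      (avoids-⊕ (subst (0ℤ ≤_) (sym (det-• δ (+ suc n) ε)) (_⊛_ {+ suc n} {det δ ε} (+≤+ ℕ.z≤n) 0≤ε)) 0≤ε (avoids-• 0≤ε avoids n) avoids)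
      where
      eq : ∀ ε → + suc n • ε ⊕ ε ≡ + suc (suc n) • ε
      eq (a , b) = cong₂ _,_ (eq′ a (+ suc n)) (eq′ b (+ suc n))
        where eq′ : ∀ a n → n * a + a ≡ (1ℤ + n) * a
              eq′ = solve-∀

-- Chords of lattice walks.

module Chords where

  open import Data.Integer.Base hiding (_⊖_; suc; NonZero)
  open import Data.Integer.Properties
  open import Data.Integer.Tactic.RingSolver using (solve-∀)
  open GridPaths
  open Bands
  open Walks

  •-nonzero : ∀ {k E} → k ≢ 0ℤ → E ≢ 𝟎 → k • E ≢ 𝟎
  •-nonzero {k} {a , b} k≢0 E≢0 eq = E≢0 (cong₂ _,_ (cancel (cong proj₁ eq)) (cancel (cong proj₂ eq)))
    where
    cancel : ∀ {a} → k * a ≡ 0ℤ → a ≡ 0ℤ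
    cancel ka≡0 = [ ⊥-elim ∘ k≢0 , (λ a≡0 → a≡0) ]′ (i*j≡0⇒i≡0∨j≡0 k ka≡0)

  ⊕-cancel-𝟎 : ∀ P {Q} → P ≡ P ⊕ Q → Q ≡ 𝟎
  ⊕-cancel-𝟎 (a , b) eq = cong₂ _,_ (cancel a (cong proj₁ eq)) (cancel b (cong proj₂ eq))
    where
    cancel : ∀ a {c} → a ≡ a + c → c ≡ 0ℤ
    cancel a {c} eq = trans (e a c) (trans (cong (λ z → z - a) (sym eq)) (+-inverseʳ a))
      where e : ∀ a c → c ≡ a + c - a
            e = solve-∀

  unit-factor : ∀ r k → 1ℤ + r * k ≡ 0ℤ → k ≡ 1ℤ ⊎ k ≡ -1ℤ
  unit-factor r k eq = cases k (ℕ.m*n≡1⇒n≡1 ∣ r ∣ ∣ k ∣ (trans (sym (∣i*j∣≡∣i∣*∣j∣ r k)) (cong ∣_∣ rk≡-1)))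
    where
    rk≡-1 : r * k ≡ -1ℤ
    rk≡-1 = trans (e (r * k)) (cong (_- 1ℤ) eq)
      where e : ∀ x → x ≡ 1ℤ + x - 1ℤ
            e = solve-∀
    cases : ∀ k → ∣ k ∣ ≡ 1 → k ≡ 1ℤ ⊎ k ≡ -1ℤ
    cases (+ n) refl = inj₁ refl
    cases -[1+ n ] refl = inj₂ refl

  link : ∀ {n} {W : Fin (suc (suc n)) → Pt} → IsWalk W → ∀ j δ → W (suc j) ≡ W zero ⊕ δ → W (suc j) ~ W (suc zero) ⊕ δ
  link {W = W} walk j δ eq = subst (_~ W (suc zero) ⊕ δ) (sym eq) (~-shift δ (walk zero))

  -- A chord `k • E` at the first point makes the rest of the walk a band along a multiple of `E`,
  -- which must meet its own translate by `E`. A meeting gives a chord of the rest with coefficient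
  -- 1 + (s - t) k. By `old` this coefficient vanishes, which leaves k = 1 and k = -1, excluded by
  -- `noE`.
  no-first-multiple : ∀ {n} (W : Fin (suc (suc n)) → Pt) → IsWalk W → ∀ {E} → E ≢ 𝟎 → (∀ i j → W j ≢ W i ⊕ E) →
    (∀ k → k ≢ 0ℤ → ∀ i j → W (suc j) ≢ W (suc i) ⊕ k • E) → ∀ k → k ≢ 0ℤ → ∀ j → W (suc j) ≢ W zero ⊕ k • E
  no-first-multiple W walk {E} E≢0 noE old k k≢0 j eq =
    parallel-meets (translates-band {W = V} (walk ∘ suc) (k • E) j (link {W = W} walk j (k • E) eq)) (•-nonzero k≢0 E≢0) E (det-k E) avoids
    where
    V = W ∘ suc
    det-k : ∀ E → det (k • E) E ≡ 0ℤ
    det-k (a , b) = eq′ k a b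
      where eq′ : ∀ k a b → k * a * b - k * b * a ≡ 0ℤ
            eq′ = solve-∀
    avoids : Avoids (Translates V (k • E)) E
    avoids (x , s , refl) (y , t , eq′) = contra (collect (V x) (V y) E eq′)
      where
      collect : ∀ P Q E → P ⊕ s • (k • E) ⊕ E ≡ Q ⊕ t • (k • E) → Q ≡ P ⊕ (1ℤ + (s - t) * k) • E
      collect (a , b) (c , d) (e , f) eq = cong₂ _,_ (one a c e (cong proj₁ eq)) (one b d f (cong proj₂ eq))
        where
        one : ∀ a c e → a + s * (k * e) + e ≡ c + t * (k * e) → c ≡ a + (1ℤ + (s - t) * k) * e
        one a c e eq = trans (i₁ c t k e) (trans (cong (_- t * (k * e)) (sym eq)) (i₂ a s t k e))
          where
          i₁ : ∀ c t k e → c ≡ c + t * (k * e) - t * (k * e)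
          i₁ = solve-∀
          i₂ : ∀ a s t k e → a + s * (k * e) + e - t * (k * e) ≡ a + (1ℤ + (s - t) * k) * e
          i₂ = solve-∀
      contra : V y ≡ V x ⊕ (1ℤ + (s - t) * k) • E → ⊥
      contra eq″ with 1ℤ + (s - t) * k ≟ 0ℤ
      ... | no c≢0 = old _ c≢0 x y eq″
      ... | yes c≡0 with unit-factor (s - t) k c≡0
      ... | inj₁ refl = noE zero (suc j) (trans eq (cong (W zero ⊕_) (1• E)))
        where 1• : ∀ E → 1ℤ • E ≡ E
              1• (a , b) = cong₂ _,_ (*-identityˡ a) (*-identityˡ b)
      ... | inj₂ refl = noE (suc j) zero (back (W zero) (W (suc j)) E eq)
        where
        back : ∀ P Q E → Q ≡ P ⊕ -1ℤ • E → P ≡ Q ⊕ E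
        back (a , b) (c , d) (e , f) refl = cong₂ _,_ (i a e) (i b f)
          where i : ∀ a e → a ≡ a + -1ℤ * e + e
                i = solve-∀

  -- Hopf's theorem on horizontal chords of planar curves, for lattice walks.
  no-multiples : ∀ {n} (W : Fin (suc n) → Pt) → IsWalk W → ∀ {E} → E ≢ 𝟎 → (∀ i j → W j ≢ W i ⊕ E) →
    ∀ k → k ≢ 0ℤ → ∀ i j → W j ≢ W i ⊕ k • E
  no-multiples W walk E≢0 noE k k≢0 zero zero eq = •-nonzero k≢0 E≢0 (⊕-cancel-𝟎 (W zero) eq)
  no-multiples {suc n} W walk {E} E≢0 noE k k≢0 i j = cases i j
    where
    old : ∀ k → k ≢ 0ℤ → ∀ i j → W (suc j) ≢ W (suc i) ⊕ k • E
    old = no-multiples (W ∘ suc) (walk ∘ suc) E≢0 (λ i j → noE (suc i) (suc j))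
    flip : ∀ P Q E → P ≡ Q ⊕ k • E → Q ≡ P ⊕ (- k) • E
    flip (a , b) (c , d) (e , f) refl = cong₂ _,_ (eq′ c k e) (eq′ d k f)
      where eq′ : ∀ c k e → c ≡ c + k * e + - k * e
            eq′ = solve-∀
    cases : ∀ i j → W j ≢ W i ⊕ k • E
    cases zero zero eq = •-nonzero k≢0 E≢0 (⊕-cancel-𝟎 (W zero) eq)
    cases (suc i) (suc j) eq = old k k≢0 i j eq
    cases zero (suc j) eq = no-first-multiple W walk E≢0 noE old k k≢0 j eq
    cases (suc i) zero eq = no-first-multiple W walk E≢0 noE old (- k) (k≢0 ∘ neg-injective) i (flip (W zero) (W (suc i)) E eq)

  comb : Pt → Pt → ℤ → ℤ → Pt
  comb E₁ E₂ k l = k • E₁ ⊕ l • E₂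

  Chord : ∀ {n} → (Fin n → Pt) → Pt → Pt → ℤ → ℤ → Set
  Chord W E₁ E₂ k l = ∃₂ λ i j → W j ≡ W i ⊕ comb E₁ E₂ k l

  -- Reversing a chord negates both coefficients, so up to reversal these are all chords with two
  -- nonzero coefficients.
  Positive-chord Mixed-chord : ∀ {n} → (Fin n → Pt) → Pt → Pt → Set
  Positive-chord W E₁ E₂ = ∃₂ λ a b → Chord W E₁ E₂ (+ suc a) (+ suc b)
  Mixed-chord W E₁ E₂ = ∃₂ λ a b → Chord W E₁ E₂ (+ suc a) -[1+ b ]

  AxisFree : ∀ {n} → (Fin n → Pt) → Pt → Pt → Set
  AxisFree W E₁ E₂ = ∀ k → k ≢ 0ℤ → ¬ Chord W E₁ E₂ k 0ℤ × ¬ Chord W E₁ E₂ 0ℤ k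

  chord-reverse : ∀ {n} (W : Fin n → Pt) E₁ E₂ k l → Chord W E₁ E₂ k l → Chord W E₁ E₂ (- k) (- l)
  chord-reverse W E₁ E₂ k l (i , j , eq) = j , i , flip (W i) (W j) E₁ E₂ eq
    where
    flip : ∀ P Q E F → Q ≡ P ⊕ comb E F k l → P ≡ Q ⊕ comb E F (- k) (- l)
    flip (a , b) (c , d) (e , f) (g , h) refl = cong₂ _,_ (i′ a k e l g) (i′ b k f l h)
      where i′ : ∀ a k e l g → a ≡ a + (k * e + l * g) + (- k * e + - l * g)
            i′ = solve-∀

  same-sign : ∀ {n} (W : Fin n → Pt) E₁ E₂ → AxisFree W E₁ E₂ → ¬ Mixed-chord W E₁ E₂ →
    ∀ k l → Chord W E₁ E₂ k l → 0ℤ < k * l ⊎ k ≡ 0ℤ × l ≡ 0ℤ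
  same-sign W E₁ E₂ axis mixed +0 +0 ch = inj₂ (refl , refl)
  same-sign W E₁ E₂ axis mixed +0 l@(+[1+ _ ]) ch = ⊥-elim (proj₂ (axis l λ ()) ch)
  same-sign W E₁ E₂ axis mixed +0 l@(-[1+ _ ]) ch = ⊥-elim (proj₂ (axis l λ ()) ch)
  same-sign W E₁ E₂ axis mixed k@(+[1+ _ ]) +0 ch = ⊥-elim (proj₁ (axis k λ ()) ch)
  same-sign W E₁ E₂ axis mixed k@(-[1+ _ ]) +0 ch = ⊥-elim (proj₁ (axis k λ ()) ch)
  same-sign W E₁ E₂ axis mixed +[1+ a ] +[1+ b ] ch = inj₁ (+<+ (ℕ.s≤s ℕ.z≤n))
  same-sign W E₁ E₂ axis mixed -[1+ a ] -[1+ b ] ch = inj₁ (+<+ (ℕ.s≤s ℕ.z≤n))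
  same-sign W E₁ E₂ axis mixed +[1+ a ] -[1+ b ] ch = ⊥-elim (mixed (a , b , ch))
  same-sign W E₁ E₂ axis mixed -[1+ a ] +[1+ b ] ch = ⊥-elim (mixed (a , b , chord-reverse W E₁ E₂ -[1+ a ] +[1+ b ] ch))

  -- Integrality matters: for k ≥ 1, r < 0 already gives r k ≤ -1, so r and 1 + r k never have
  -- opposite signs.
  0≤r[1+rk] : ∀ r a → 0ℤ ≤ r * (1ℤ + r * +[1+ a ])
  0≤r[1+rk] (+ n) a = _⊛_ {+ n} {1ℤ + + n * +[1+ a ]} (+≤+ ℕ.z≤n) (_⊹_ {1ℤ} (+≤+ ℕ.z≤n) (_⊛_ {+ n} {+[1+ a ]} (+≤+ ℕ.z≤n) (+≤+ ℕ.z≤n)))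
  0≤r[1+rk] -[1+ n ] a = subst (0ℤ ≤_) (eq (+ n) (+ a))
    (_⊛_ {+ suc n} {+ n + + a + + n * + a} (+≤+ ℕ.z≤n) (_⊹_ {+ n + + a} (+≤+ ℕ.z≤n) (_⊛_ {+ n} {+ a} (+≤+ ℕ.z≤n) (+≤+ ℕ.z≤n))))
    where eq : ∀ n a → (1ℤ + n) * (n + a + n * a) ≡ - (1ℤ + n) * (1ℤ + - (1ℤ + n) * (1ℤ + a))
          eq = solve-∀

  -- If δ = k E₁ + l E₂ with k > 0 > l, then the coefficients of E₁ + r δ, and of E₂ + r δ, never have the same sign.
  not-same-sign₁ : ∀ r a b → ¬ (0ℤ < (1ℤ + r * +[1+ a ]) * (r * -[1+ b ]) ⊎ (1ℤ + r * +[1+ a ] ≡ 0ℤ × r * -[1+ b ] ≡ 0ℤ))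
  not-same-sign₁ r a b (inj₁ pos) = ≤⇒≯ (≤-by (_⊛_ {+[1+ b ]} (+≤+ ℕ.z≤n) (0≤r[1+rk] r a)) (eq r (+ a) (+ b))) pos
    where eq : ∀ r a b → 0ℤ - (1ℤ + r * (1ℤ + a)) * (r * - (1ℤ + b)) ≡ (1ℤ + b) * (r * (1ℤ + r * (1ℤ + a)))
          eq = solve-∀
  not-same-sign₁ r a b (inj₂ (eq₁ , eq₂)) with i*j≡0⇒i≡0∨j≡0 r eq₂
  ... | inj₁ refl = case eq₁ of λ ()

  not-same-sign₂ : ∀ r a b → ¬ (0ℤ < (r * +[1+ a ]) * (1ℤ + r * -[1+ b ]) ⊎ (r * +[1+ a ] ≡ 0ℤ × 1ℤ + r * -[1+ b ] ≡ 0ℤ))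
  not-same-sign₂ r a b (inj₁ pos) = ≤⇒≯ (≤-by (_⊛_ {+[1+ a ]} (+≤+ ℕ.z≤n) (0≤r[1+rk] (- r) b)) (eq r (+ a) (+ b))) pos
    where eq : ∀ r a b → 0ℤ - (r * (1ℤ + a)) * (1ℤ + r * - (1ℤ + b)) ≡ (1ℤ + a) * (- r * (1ℤ + - r * (1ℤ + b)))
          eq = solve-∀
  not-same-sign₂ r a b (inj₂ (eq₁ , eq₂)) with i*j≡0⇒i≡0∨j≡0 r eq₁
  ... | inj₁ refl = case eq₂ of λ ()

  module _ {E₁ E₂ : Pt} (0<D : 0ℤ < det E₁ E₂) where

    private
      D = det E₁ E₂
      0≤D = <⇒≤ 0<D

    module _ (a b : ℕ) where

      private
        δ = comb E₁ E₂ +[1+ a ] -[1+ b ]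

      -- With the next identity: `E₁` and `E₂` lie on the same side of every mixed chord, so that
      -- disjointness from their translates can be added up.
      det-δ-E₁ : det δ E₁ ≡ +[1+ b ] * D
      det-δ-E₁ = eq (proj₁ E₁) (proj₂ E₁) (proj₁ E₂) (proj₂ E₂) +[1+ a ] +[1+ b ]
        where eq : ∀ e f g h k l → (k * e + - l * g) * f - (k * f + - l * h) * e ≡ l * (e * h - f * g)
              eq = solve-∀

      det-δ-E₂ : det δ E₂ ≡ +[1+ a ] * D
      det-δ-E₂ = eq (proj₁ E₁) (proj₂ E₁) (proj₁ E₂) (proj₂ E₂) +[1+ a ] +[1+ b ]
        where eq : ∀ e f g h k l → (k * e + - l * g) * h - (k * f + - l * h) * g ≡ k * (e * h - f * g)
              eq = solve-∀

      δ≢0 : δ ≢ 𝟎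
      δ≢0 δ≡0 = [ (λ ()) , (λ D≡0 → <-irrefl (sym D≡0) 0<D) ]′
        (i*j≡0⇒i≡0∨j≡0 +[1+ a ] (trans (sym det-δ-E₂) (cong (λ P → det P E₂) δ≡0)))

    module _ {n} (W : Fin (suc (suc n)) → Pt) (walk : IsWalk W) (axis : AxisFree W E₁ E₂)
             (pure : ¬ Mixed-chord (W ∘ suc) E₁ E₂) (a b : ℕ) where

      private
        V = W ∘ suc
        δ = comb E₁ E₂ +[1+ a ] -[1+ b ]

      -- `ε` is 1 or -1 according to whether the chord leaves or reaches the first point. The band
      -- is built along `ε • δ` and then regarded, through `turn`, as a band along `δ`, so that `E₁`
      -- and `E₂` are on its positive side in both cases.
      new-mixed-excludes-positive : ∀ ε → (∀ {Δ} → Band Δ (ε • δ) → Band Δ δ) → ∀ j → V j ≡ W zero ⊕ ε • δ →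
        ¬ Positive-chord W E₁ E₂
      new-mixed-excludes-positive ε turn j eq (c , d , x , y , eq′) =
        avoids-⊕ B (δ≢0 a b) {+ suc c • E₁} {+ suc d • E₂}
          (subst (0ℤ ≤_) (sym (det-• δ (+ suc c) E₁)) (_⊛_ {+ suc c} (+≤+ ℕ.z≤n) 0≤E₁))
          (subst (0ℤ ≤_) (sym (det-• δ (+ suc d) E₂)) (_⊛_ {+ suc d} (+≤+ ℕ.z≤n) 0≤E₂))
          (avoids-• B (δ≢0 a b) 0≤E₁ avoids₁ c) (avoids-• B (δ≢0 a b) 0≤E₂ avoids₂ d)
          (W∈ x) (subst Δ eq′ (W∈ y))
        where
        Δ = Translates V (ε • δ)
        B = turn (translates-band {W = V} (walk ∘ suc) (ε • δ) j (link {W = W} walk j (ε • δ) eq))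
        0≤E₁ : 0ℤ ≤ det δ E₁
        0≤E₁ = subst (0ℤ ≤_) (sym (det-δ-E₁ a b)) (_⊛_ {+[1+ b ]} (+≤+ ℕ.z≤n) 0≤D)
        0≤E₂ : 0ℤ ≤ det δ E₂
        0≤E₂ = subst (0ℤ ≤_) (sym (det-δ-E₂ a b)) (_⊛_ {+[1+ a ]} (+≤+ ℕ.z≤n) 0≤D)
        -- The removed first point lies in the band too, since `V j` is a translate of it. So
        -- positive chords of the whole walk are excluded, and not only those of `V`.
        W∈ : ∀ i → Δ (W i)
        W∈ (suc i) = i , 0ℤ , sym (⊕-identityʳ (V i))
        W∈ zero = j , -1ℤ , back (W zero) (V j) (ε • δ) eq
          where
          back : ∀ P Q R → Q ≡ P ⊕ R → P ≡ Q ⊕ -1ℤ • R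
          back (a , b) (c , d) (e , f) refl = cong₂ _,_ (i a e) (i b f)
            where i : ∀ a e → a ≡ a + e + -1ℤ * e
                  i = solve-∀
        signs : ∀ k l → Chord V E₁ E₂ k l → 0ℤ < k * l ⊎ k ≡ 0ℤ × l ≡ 0ℤ
        signs = same-sign V E₁ E₂ (λ k k≢0 → (λ (i , j , e) → proj₁ (axis k k≢0) (suc i , suc j , e)) ,
                                     (λ (i , j , e) → proj₂ (axis k k≢0) (suc i , suc j , e))) pure
        collect : ∀ u v s t P Q E F → P ⊕ s • (ε • comb E F +[1+ a ] -[1+ b ]) ⊕ comb E F u v ≡ Q ⊕ t • (ε • comb E F +[1+ a ] -[1+ b ]) →
          Q ≡ P ⊕ comb E F (u + ((s - t) * ε) * +[1+ a ]) (v + ((s - t) * ε) * -[1+ b ])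
        collect u v s t (a₁ , a₂) (c₁ , c₂) (e₁ , e₂) (f₁ , f₂) eq =
          cong₂ _,_ (one a₁ c₁ e₁ f₁ +[1+ a ] -[1+ b ] (cong proj₁ eq)) (one a₂ c₂ e₂ f₂ +[1+ a ] -[1+ b ] (cong proj₂ eq))
          where
          one : ∀ p q e f k l → p + s * (ε * (k * e + l * f)) + (u * e + v * f) ≡ q + t * (ε * (k * e + l * f)) →
            q ≡ p + ((u + ((s - t) * ε) * k) * e + (v + ((s - t) * ε) * l) * f)
          one p q e f k l eq = trans (i₁ q (t * (ε * (k * e + l * f)))) (trans (cong (_- t * (ε * (k * e + l * f))) (sym eq)) (i₂ p s t ε e f k l u v))
            where
            i₁ : ∀ q x → q ≡ q + x - x
            i₁ = solve-∀
            i₂ : ∀ p s t ε e f k l u v → p + s * (ε * (k * e + l * f)) + (u * e + v * f) - t * (ε * (k * e + l * f))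
              ≡ p + ((u + ((s - t) * ε) * k) * e + (v + ((s - t) * ε) * l) * f)
            i₂ = solve-∀
        comb-10 : ∀ E F → comb E F 1ℤ 0ℤ ≡ E
        comb-10 (e , f) (g , h) = cong₂ _,_ (i e g) (i f h)
          where i : ∀ e g → 1ℤ * e + 0ℤ * g ≡ e
                i = solve-∀
        comb-01 : ∀ E F → comb E F 0ℤ 1ℤ ≡ F
        comb-01 (e , f) (g , h) = cong₂ _,_ (i e g) (i f h)
          where i : ∀ e g → 0ℤ * e + 1ℤ * g ≡ g
                i = solve-∀
        avoids₁ : Avoids Δ E₁
        avoids₁ (x , s , refl) (y , t , eq) = not-same-sign₁ r a b
          (subst (λ l → 0ℤ < k * l ⊎ k ≡ 0ℤ × l ≡ 0ℤ) (+-identityˡ _) (signs k (0ℤ + r * -[1+ b ])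
            (x , y , collect 1ℤ 0ℤ s t (V x) (V y) E₁ E₂ (trans (cong (V x ⊕ s • (ε • δ) ⊕_) (comb-10 E₁ E₂)) eq))))
          where r = (s - t) * ε
                k = 1ℤ + r * +[1+ a ]
        avoids₂ : Avoids Δ E₂
        avoids₂ (x , s , refl) (y , t , eq) = not-same-sign₂ r a b
          (subst (λ k → 0ℤ < k * l ⊎ k ≡ 0ℤ × l ≡ 0ℤ) (+-identityˡ _) (signs (0ℤ + r * +[1+ a ]) l
            (x , y , collect 0ℤ 1ℤ s t (V x) (V y) E₁ E₂ (trans (cong (V x ⊕ s • (ε • δ) ⊕_) (comb-01 E₁ E₂)) eq))))
          where r = (s - t) * ε
                l = 1ℤ + r * -[1+ b ]

      chord-at-start : ∀ i j → W j ≡ W i ⊕ δ → ¬ Positive-chord W E₁ E₂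
      chord-at-start zero zero eq = ⊥-elim (δ≢0 a b (⊕-cancel-𝟎 (W zero) eq))
      chord-at-start (suc i) (suc j) eq = ⊥-elim (pure (a , b , i , j , eq))
      chord-at-start zero (suc j) eq = new-mixed-excludes-positive 1ℤ (λ {Δ} → subst (Band Δ) 1•δ) j
        (trans eq (cong (W zero ⊕_) (sym 1•δ)))
        where 1•δ : 1ℤ • δ ≡ δ
              1•δ = cong₂ _,_ (*-identityˡ (proj₁ δ)) (*-identityˡ (proj₂ δ))
      chord-at-start (suc i) zero eq = new-mixed-excludes-positive -1ℤ (λ {Δ} B → subst (Band Δ) (negated δ) (band-neg B)) i
        (back (W zero) (V i) δ eq)
        where
        negated : ∀ P → 𝟎 ⊖ -1ℤ • P ≡ P
        negated (a , b) = cong₂ _,_ (i′ a) (i′ b)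
          where i′ : ∀ a → 0ℤ - -1ℤ * a ≡ a
                i′ = solve-∀
        back : ∀ P Q R → P ≡ Q ⊕ R → Q ≡ P ⊕ -1ℤ • R
        back (a , b) (c , d) (e , f) refl = cong₂ _,_ (i′ c e) (i′ d f)
          where i′ : ∀ a e → a ≡ a + e + -1ℤ * e
                i′ = solve-∀

  -- Reflecting E₂ exchanges the two kinds of chords.
  reflect : ∀ {n} (W : Fin n → Pt) E₁ E₂ k l → Chord W E₁ E₂ k l → Chord W (𝟎 ⊖ E₂) E₁ (- l) k
  reflect W E₁ E₂ k l (i , j , eq) = i , j , trans eq (cong (W i ⊕_) (move E₁ E₂))
    where
    move : ∀ E F → comb E F k l ≡ comb (𝟎 ⊖ F) E (- l) k
    move (e , f) (g , h) = cong₂ _,_ (i′ e g k l) (i′ f h k l)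
      where i′ : ∀ e g k l → k * e + l * g ≡ - l * (0ℤ - g) + k * e
            i′ = solve-∀

  reflect-positive : ∀ {n} (W : Fin n → Pt) E₁ E₂ → Positive-chord W E₁ E₂ → Mixed-chord W (𝟎 ⊖ E₂) E₁
  reflect-positive W E₁ E₂ (a , b , ch) = b , a , chord-reverse W (𝟎 ⊖ E₂) E₁ -[1+ b ] +[1+ a ] (reflect W E₁ E₂ +[1+ a ] +[1+ b ] ch)

  reflect-mixed : ∀ {n} (W : Fin n → Pt) E₁ E₂ → Mixed-chord W E₁ E₂ → Positive-chord W (𝟎 ⊖ E₂) E₁
  reflect-mixed W E₁ E₂ (a , b , ch) = b , a , reflect W E₁ E₂ +[1+ a ] -[1+ b ] ch

  unreflect : ∀ {n} (W : Fin n → Pt) E₁ E₂ k l → Chord W (𝟎 ⊖ E₂) E₁ k l → Chord W E₁ E₂ l (- k)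
  unreflect W E₁ E₂ k l (i , j , eq) = i , j , trans eq (cong (W i ⊕_) (move E₁ E₂))
    where
    move : ∀ E F → comb (𝟎 ⊖ F) E k l ≡ comb E F l (- k)
    move (e , f) (g , h) = cong₂ _,_ (i′ e g k l) (i′ f h k l)
      where i′ : ∀ e g k l → k * (0ℤ - g) + l * e ≡ l * e + - k * g
            i′ = solve-∀

  unreflect-mixed : ∀ {n} (W : Fin n → Pt) E₁ E₂ → Mixed-chord W (𝟎 ⊖ E₂) E₁ → Positive-chord W E₁ E₂
  unreflect-mixed W E₁ E₂ (a , b , ch) = b , a , chord-reverse W E₁ E₂ -[1+ b ] -[1+ a ] (unreflect W E₁ E₂ +[1+ a ] -[1+ b ] ch)

  reflect-axis : ∀ {n} (W : Fin n → Pt) E₁ E₂ → AxisFree W E₁ E₂ → AxisFree W (𝟎 ⊖ E₂) E₁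
  reflect-axis W E₁ E₂ axis k k≢0 =
    (λ ch → proj₂ (axis (- k) (k≢0 ∘ neg-injective)) (unreflect W E₁ E₂ k 0ℤ ch)) ,
    (λ ch → proj₁ (axis k k≢0) (unreflect W E₁ E₂ 0ℤ k ch))

  -- Besides the change of sign the two vectors are exchanged, which keeps the pair positively
  -- oriented.
  det-reflect : ∀ E F → det (𝟎 ⊖ F) E ≡ det E F
  det-reflect (e , f) (g , h) = i e f g h
    where i : ∀ e f g h → (0ℤ - g) * f - (0ℤ - h) * e ≡ e * h - f * g
          i = solve-∀

  -- Consider the longest suffix of the walk without chords of one of the two kinds, and a chord δ of that kind
  -- from the point before it.  The band of the suffix along δ is disjoint from its translates by E₁ and by E₂,
  -- which lie on the same side of it, so it is also disjoint from its translates by chords of the other kind.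
  one-quadrant : ∀ {n} (W : Fin (suc n) → Pt) → IsWalk W → ∀ {E₁ E₂} → 0ℤ < det E₁ E₂ → AxisFree W E₁ E₂ →
    Mixed-chord W E₁ E₂ → ¬ Positive-chord W E₁ E₂
  one-quadrant {zero} W walk {E₁} {E₂} 0<D axis (a , b , zero , zero , eq) _ = δ≢0 {E₁} {E₂} 0<D a b (⊕-cancel-𝟎 (W zero) eq)
  one-quadrant {suc n} W walk {E₁} {E₂} 0<D axis mixed@(a , b , i , j , eq) positive =
    chord-at-start 0<D W walk axis no-mixed a b i j eq positive
    where
    V = W ∘ suc
    -- A mixed chord of `V` excludes positive chords of `V` by induction. Then the argument applies
    -- to the reflected pair: the positive chord of `W` excludes the given mixed one.
    no-mixed : ¬ Mixed-chord V E₁ E₂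
    no-mixed mixed′ = let a′ , b′ , i′ , j′ , eq′ = reflect-positive W E₁ E₂ positive in
      chord-at-start 0<D′ W walk (reflect-axis W E₁ E₂ axis) no-positive a′ b′ i′ j′ eq′ (reflect-mixed W E₁ E₂ mixed)
      where
      0<D′ = subst (0ℤ <_) (sym (det-reflect E₁ E₂)) 0<D
      no-positive : ¬ Mixed-chord V (𝟎 ⊖ E₂) E₁
      no-positive mixed″ = one-quadrant V (walk ∘ suc) 0<D
        (λ k k≢0 → (λ (i , j , e) → proj₁ (axis k k≢0) (suc i , suc j , e)) ,
                   (λ (i , j , e) → proj₂ (axis k k≢0) (suc i , suc j , e)))
        mixed′ (unreflect-mixed V E₁ E₂ mixed″)

-- Pigeonhole bounds for the span of a walk.

module Counting where

  open import Data.Integer.Base hiding (_⊖_; suc; NonZero)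
  open import Data.Integer.Properties
  open import Data.Integer.Tactic.RingSolver using (solve-∀)
  open import Data.Integer.DivMod using (a≡a%ℕn+[a/ℕn]*n; n%ℕd<d)
  open GridPaths
  open Bands
  open Walks
  open Chords

  same-quotient : ∀ d .{{_ : NonZero d}} m n → m ℕ./ d ≡ n ℕ./ d → m ℕ.< d ℕ.+ n
  same-quotient d m n eq = begin-strict
    m                             ≡⟨ ℕ.m≡m%n+[m/n]*n m d ⟩
    m ℕ.% d ℕ.+ m ℕ./ d ℕ.* d     <⟨ ℕ.+-monoˡ-< _ (ℕ.m%n<n m d) ⟩
    d ℕ.+ m ℕ./ d ℕ.* d           ≡⟨ cong (λ q → d ℕ.+ q ℕ.* d) eq ⟩
    d ℕ.+ n ℕ./ d ℕ.* d           ≤⟨ ℕ.+-monoʳ-≤ d (ℕ.m/n*n≤m n d) ⟩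
    d ℕ.+ n ∎
    where open ℕ.≤-Reasoning

  -- This is the span to be expected of `n` points in `N` classes if within each class the values of
  -- `ℓ` are at least 2N apart; the summand 2N absorbs the rounding.
  Wide : ∀ {n} → ℕ → (Fin n → ℤ) → Set
  Wide {n} N ℓ = ∃₂ λ i j → + (2 ℕ.* n) ≤ ℓ i - ℓ j + + (2 ℕ.* N)

  -- The pair of the class and of the quotient of ℓ by 2N determines the index.
  wide : ∀ {n} N .{{_ : NonZero N}} (χ : Fin (suc n) → Fin N) (ℓ : Fin (suc n) → ℤ) →
    (∀ i j → χ i ≡ χ j → ℓ i - ℓ j < + (2 ℕ.* N) → ℓ j - ℓ i < + (2 ℕ.* N) → i ≡ j) → Wide N ℓ
  wide {n} N χ ℓ separated = t , b , (begin
    + (2 ℕ.* suc n)                        ≤⟨ +≤+ (ℕ.*-monoʳ-≤ 2 (Fin.injective⇒≤ code-injective)) ⟩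
    + (2 ℕ.* (suc q ℕ.* N))                ≡⟨ cong +_ (regroup q N) ⟩
    + (q ℕ.* (2 ℕ.* N) ℕ.+ 2 ℕ.* N)        ≤⟨ +≤+ (ℕ.+-monoˡ-≤ (2 ℕ.* N) (ℕ.m/n*n≤m (z t) (2 ℕ.* N))) ⟩
    + (z t ℕ.+ 2 ℕ.* N)                    ≡⟨ cong (λ w → w + + (2 ℕ.* N)) (+z t) ⟩
    ℓ t - ℓ b + + (2 ℕ.* N)                ∎)
    where
    open ≤-Reasoning
    instance
      2N≢0 : NonZero (2 ℕ.* N)
      2N≢0 = ℕ.m*n≢0 2 N
    t = proj₁ (argmax ℓ)
    b = proj₁ (argmin ℓ)
    z : Fin (suc n) → ℕ
    z i = ∣ ℓ i - ℓ b ∣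
    +z : ∀ i → + z i ≡ ℓ i - ℓ b
    +z i = 0≤i⇒+∣i∣≡i (diff (proj₂ (argmin ℓ) i))
    q = z t ℕ./ (2 ℕ.* N)
    z≤zt : ∀ i → z i ℕ.≤ z t
    z≤zt i = drop‿+≤+ (subst₂ _≤_ (sym (+z i)) (sym (+z t)) (+-monoˡ-≤ (- ℓ b) (proj₂ (argmax ℓ) i)))
    code : Fin (suc n) → Fin (suc q ℕ.* N)
    code i = combine (fromℕ< (ℕ.s≤s (ℕ./-monoˡ-≤ (2 ℕ.* N) (z≤zt i)))) (χ i)
    regroup : ∀ q N → 2 ℕ.* (suc q ℕ.* N) ≡ q ℕ.* (2 ℕ.* N) ℕ.+ 2 ℕ.* N
    regroup = ℕ-Solver.solve-∀
    close : ∀ i j → z i ℕ./ (2 ℕ.* N) ≡ z j ℕ./ (2 ℕ.* N) → ℓ i - ℓ j < + (2 ℕ.* N)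
    close i j eq = begin-strict
      ℓ i - ℓ j                        ≡⟨ shuffle (ℓ i) (ℓ j) (ℓ b) ⟩
      (ℓ i - ℓ b) - (ℓ j - ℓ b)        ≡⟨ cong₂ _-_ (+z i) (+z j) ⟨
      + z i - + z j                    <⟨ +-monoˡ-< (- + z j) (+<+ (same-quotient (2 ℕ.* N) (z i) (z j) eq)) ⟩
      + (2 ℕ.* N ℕ.+ z j) - + z j      ≡⟨ cancel (+ (2 ℕ.* N)) (+ z j) ⟩
      + (2 ℕ.* N) ∎
      where
      shuffle : ∀ a b c → a - b ≡ (a - c) - (b - c)
      shuffle = solve-∀
      cancel : ∀ a b → a + b - b ≡ a
      cancel = solve-∀
    code-injective : ∀ {i j} → code i ≡ code j → i ≡ j
    code-injective {i} {j} eq with Fin.combine-injective _ (χ i) _ (χ j) eq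
    ... | eq₁ , eq₂ = separated i j eq₂ (close i j eq′) (close j i (sym eq′))
      where eq′ = Fin.fromℕ<-injective _ _ _ _ eq₁

  place : Pt → Pt → Pt → Pt
  place u₁ u₂ (α , β) = α • u₁ ⊕ β • u₂

  -- Grid coordinates along u₁ and u₂ of the lattice of vectors (N k , N l) with k ≡ l (mod 2),
  -- together with a linear form c α + d β modulo N that vanishes only on this lattice.
  record Side (u₁ u₂ : Pt) (N : ℕ) : Set where
    field
      E₁ E₂ : Pt
      place-E₁ : place u₁ u₂ E₁ ≡ (+ N , + N)
      place-E₂ : place u₁ u₂ E₂ ≡ (+ N , - + N)
      orientation : 0ℤ < det E₁ E₂
      c d : ℤ
      class : ∀ α β z → c * α + d * β ≡ z * + N → ∃₂ λ k l → (α , β) ≡ comb E₁ E₂ k l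

  <2⇒ : ∀ N .{{_ : NonZero N}} t → t * + N < + (2 ℕ.* N) → t < + 2
  <2⇒ N t lt = *-cancelʳ-<-nonNeg (+ N) (subst (t * + N <_) (pos-* 2 N) lt)

  small-double : ∀ l → l + l < + 2 → - (l + l) < + 2 → l ≡ 0ℤ
  small-double (+ zero) _ _ = refl
  small-double +[1+ n ] (+<+ lt) _ = ⊥-elim (ℕ.<⇒≱ lt (ℕ.s≤s (ℕ.≤-trans (ℕ.s≤s ℕ.z≤n) (ℕ.m≤n+m (suc n) n))))
  small-double -[1+ n ] _ (+<+ (ℕ.s≤s (ℕ.s≤s ())))

  -- Nonzero integers of equal sign have a sum of absolute value at least 2; this turns the sign
  -- condition on chords into steps of at least 2N.
  small-sum : ∀ k l → 0ℤ < k * l ⊎ k ≡ 0ℤ × l ≡ 0ℤ → k + l < + 2 → - (k + l) < + 2 → k ≡ 0ℤ × l ≡ 0ℤ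
  small-sum k l (inj₂ both) _ _ = both
  small-sum +[1+ a ] +[1+ b ] _ (+<+ lt) _ = ⊥-elim (ℕ.<⇒≱ lt (ℕ.s≤s (ℕ.≤-trans (ℕ.s≤s ℕ.z≤n) (ℕ.m≤n+m (suc b) a))))
  small-sum -[1+ a ] -[1+ b ] _ _ (+<+ (ℕ.s≤s (ℕ.s≤s ())))
  small-sum +0 l (inj₁ (+<+ ())) _ _
  small-sum +[1+ a ] +0 (inj₁ lt) _ _ = ⊥-elim (<-irrefl (sym (*-zeroʳ +[1+ a ])) lt)
  small-sum -[1+ a ] +0 (inj₁ lt) _ _ = ⊥-elim (<-irrefl (sym (*-zeroʳ -[1+ a ])) lt)

  module _ {u₁ u₂ N} .{{_ : NonZero N}} (side : Side u₁ u₂ N) where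
    open Side side

    place-comb : ∀ P k l → place u₁ u₂ (P ⊕ comb E₁ E₂ k l) ≡
      (proj₁ (place u₁ u₂ P) + (k + l) * + N , proj₂ (place u₁ u₂ P) + (k - l) * + N)
    place-comb P k l = cong₂ _,_
      (trans (eq (proj₁ P) (proj₂ P) k l (proj₁ E₁) (proj₂ E₁) (proj₁ E₂) (proj₂ E₂) (proj₁ u₁) (proj₁ u₂))
        (trans (cong₂ (λ a b → proj₁ (place u₁ u₂ P) + (k * a + l * b)) (cong proj₁ place-E₁) (cong proj₁ place-E₂))
          (cong (λ z → proj₁ (place u₁ u₂ P) + z) (eq₁ k l (+ N)))))
      (trans (eq (proj₁ P) (proj₂ P) k l (proj₁ E₁) (proj₂ E₁) (proj₁ E₂) (proj₂ E₂) (proj₂ u₁) (proj₂ u₂))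
        (trans (cong₂ (λ a b → proj₂ (place u₁ u₂ P) + (k * a + l * b)) (cong proj₂ place-E₁) (cong proj₂ place-E₂))
          (cong (λ z → proj₂ (place u₁ u₂ P) + z) (eq₂ k l (+ N)))))
      where
      eq : ∀ a b k l e f g h u v → (a + (k * e + l * g)) * u + (b + (k * f + l * h)) * v
        ≡ (a * u + b * v) + (k * (e * u + f * v) + l * (g * u + h * v))
      eq = solve-∀
      eq₁ : ∀ k l N → k * N + l * N ≡ (k + l) * N
      eq₁ = solve-∀
      eq₂ : ∀ k l N → k * N + l * - N ≡ (k - l) * N
      eq₂ = solve-∀

    module _ {n} (W : Fin (suc n) → Pt) (walk : IsWalk W) (W-injective : ∀ {i j} → W i ≡ W j → i ≡ j) where

      form : Fin (suc n) → ℤ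
      form i = c * proj₁ (W i) + d * proj₂ (W i)

      χ : Fin (suc n) → Fin N
      χ i = fromℕ< (n%ℕd<d (form i) N)

      X Y : Fin (suc n) → ℤ
      X i = proj₁ (place u₁ u₂ (W i))
      Y i = proj₂ (place u₁ u₂ (W i))

      same-class : ∀ i j → χ i ≡ χ j → ∃₂ λ k l → W j ≡ W i ⊕ comb E₁ E₂ k l
      same-class i j eq = let k , l , eq′ = class (αj - αi) (βj - βi) (qj - qi) multiple in
        k , l , cong₂ _,_ (trans (add αi αj) (cong (λ z → αi + proj₁ z) eq′)) (trans (add βi βj) (cong (λ z → βi + proj₂ z) eq′))
        where
        open import Data.Integer.Base using (_/ℕ_; _%ℕ_)
        αi = proj₁ (W i)
        βi = proj₂ (W i)
        αj = proj₁ (W j)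
        βj = proj₂ (W j)
        qi = form i /ℕ N
        qj = form j /ℕ N
        add : ∀ a b → b ≡ a + (b - a)
        add = solve-∀
        multiple : c * (αj - αi) + d * (βj - βi) ≡ (qj - qi) * + N
        multiple = begin
          c * (αj - αi) + d * (βj - βi)                            ≡⟨ e₁ c d αi βi αj βj ⟩
          form j - form i                                          ≡⟨ cong₂ _-_ (a≡a%ℕn+[a/ℕn]*n (form j) N) (a≡a%ℕn+[a/ℕn]*n (form i) N) ⟩
          (+ rj + qj * + N) - (+ ri + qi * + N)                    ≡⟨ cong (λ r → (+ rj + qj * + N) - (+ r + qi * + N)) (Fin.fromℕ<-injective _ _ _ _ eq) ⟩
          (+ rj + qj * + N) - (+ rj + qi * + N)                    ≡⟨ e₂ (+ rj) qi qj (+ N) ⟩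
          (qj - qi) * + N                                          ∎
          where
          open ≡-Reasoning
          ri = form i %ℕ N
          rj = form j %ℕ N
          e₁ : ∀ c d a b a′ b′ → c * (a′ - a) + d * (b′ - b) ≡ (c * a′ + d * b′) - (c * a + d * b)
          e₁ = solve-∀
          e₂ : ∀ r q q′ N → (r + q′ * N) - (r + q * N) ≡ (q′ - q) * N
          e₂ = solve-∀

      -- `t k l` is the change of `ℓ` along k E₁ + l E₂ in units of `N`. Points of one class differ
      -- by such a vector, so `vanish` says that distinct ones are at least 2N apart.
      wide-by : (ℓ : Fin (suc n) → ℤ) (t : ℤ → ℤ → ℤ) →
        (∀ i j k l → W j ≡ W i ⊕ comb E₁ E₂ k l → ℓ j - ℓ i ≡ t k l * + N) →
        (∀ i j k l → W j ≡ W i ⊕ comb E₁ E₂ k l → t k l < + 2 → - t k l < + 2 → k ≡ 0ℤ × l ≡ 0ℤ) →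
        Wide N ℓ
      wide-by ℓ t growth vanish = wide N χ ℓ separated
        where
        separated : ∀ i j → χ i ≡ χ j → ℓ i - ℓ j < + (2 ℕ.* N) → ℓ j - ℓ i < + (2 ℕ.* N) → i ≡ j
        separated i j eq lt gt =
          W-injective {i} {j} (sym (trans (trans chord (cong₂ (λ k l → W i ⊕ comb E₁ E₂ k l) (proj₁ both) (proj₂ both))) (⊕-identityʳ (W i))))
          where
          k = proj₁ (same-class i j eq)
          l = proj₁ (proj₂ (same-class i j eq))
          chord : W j ≡ W i ⊕ comb E₁ E₂ k l
          chord = proj₂ (proj₂ (same-class i j eq))
          g : ℓ j - ℓ i ≡ t k l * + N
          g = growth i j k l chord
          negate : ∀ a b → a - b ≡ - (b - a)
          negate = solve-∀
          g′ : ℓ i - ℓ j ≡ - t k l * + N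
          g′ = trans (negate (ℓ i) (ℓ j)) (trans (cong -_ g) (neg-distribˡ-* (t k l) (+ N)))
          both : k ≡ 0ℤ × l ≡ 0ℤ
          both = vanish i j k l chord (<2⇒ N (t k l) (subst (_< + (2 ℕ.* N)) g gt))
                                      (<2⇒ N (- t k l) (subst (_< + (2 ℕ.* N)) g′ lt))

      X-growth : ∀ i j k l → W j ≡ W i ⊕ comb E₁ E₂ k l → X j - X i ≡ (k + l) * + N
      X-growth i j k l eq = trans (cong (λ P → proj₁ P - X i) (trans (cong (place u₁ u₂) eq) (place-comb (W i) k l))) (cancel (X i) _)
        where cancel : ∀ a b → a + b - a ≡ b
              cancel = solve-∀

      Y-growth : ∀ i j k l → W j ≡ W i ⊕ comb E₁ E₂ k l → Y j - Y i ≡ (k - l) * + N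
      Y-growth i j k l eq = trans (cong (λ P → proj₂ P - Y i) (trans (cong (place u₁ u₂) eq) (place-comb (W i) k l))) (cancel (Y i) _)
        where cancel : ∀ a b → a + b - a ≡ b
              cancel = solve-∀

      E₁≢0 : E₁ ≢ 𝟎
      E₁≢0 eq = <-irrefl (sym (cong (λ P → det P E₂) eq)) orientation

      E₂≢0 : E₂ ≢ 𝟎
      E₂≢0 eq = <-irrefl (sym (trans (cong (det E₁) eq) (z (proj₁ E₁) (proj₂ E₁)))) orientation
        where z : ∀ a b → a * 0ℤ - b * 0ℤ ≡ 0ℤ
              z = solve-∀

      comb-k0 : ∀ E F k → comb E F k 0ℤ ≡ k • E
      comb-k0 (a , b) (c , d) k = cong₂ _,_ (+-identityʳ _) (+-identityʳ _)

      comb-0k : ∀ E F k → comb E F 0ℤ k ≡ k • F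
      comb-0k (a , b) (c , d) k = cong₂ _,_ (+-identityˡ _) (+-identityˡ _)

      No-E₁ No-E₂ : Set
      No-E₁ = ∀ i j → W j ≢ W i ⊕ E₁
      No-E₂ = ∀ i j → W j ≢ W i ⊕ E₂

      -- The form x - y is blind to `E₁` and changes by 2N along `E₂`. Two points of a class that
      -- are close in it differ by a multiple of `E₁`, which the chord theorem excludes.
      wide-antidiagonal : No-E₁ → Wide N (λ i → X i - Y i)
      wide-antidiagonal no-E₁ = wide-by (λ i → X i - Y i) (λ k l → l + l)
        (λ i j k l eq → trans (e₁ (X j) (Y j) (X i) (Y i)) (trans (cong₂ _-_ (X-growth i j k l eq) (Y-growth i j k l eq)) (e₂ k l (+ N))))
        vanish
        where
        e₁ : ∀ a b c d → (a - b) - (c - d) ≡ (a - c) - (b - d)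
        e₁ = solve-∀
        e₂ : ∀ k l N → (k + l) * N - (k - l) * N ≡ (l + l) * N
        e₂ = solve-∀
        vanish : ∀ i j k l → W j ≡ W i ⊕ comb E₁ E₂ k l → l + l < + 2 → - (l + l) < + 2 → k ≡ 0ℤ × l ≡ 0ℤ
        vanish i j k l eq lt gt with small-double l lt gt | k ≟ 0ℤ
        ... | refl | yes k≡0 = k≡0 , refl
        ... | refl | no k≢0 = ⊥-elim (no-multiples W walk E₁≢0 no-E₁ k k≢0 i j (trans eq (cong (W i ⊕_) (comb-k0 E₁ E₂ k))))

      wide-diagonal : No-E₂ → Wide N (λ i → X i + Y i)
      wide-diagonal no-E₂ = wide-by (λ i → X i + Y i) (λ k l → k + k)
        (λ i j k l eq → trans (e₁ (X j) (Y j) (X i) (Y i)) (trans (cong₂ _+_ (X-growth i j k l eq) (Y-growth i j k l eq)) (e₂ k l (+ N))))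
        vanish
        where
        e₁ : ∀ a b c d → (a + b) - (c + d) ≡ (a - c) + (b - d)
        e₁ = solve-∀
        e₂ : ∀ k l N → (k + l) * N + (k - l) * N ≡ (k + k) * N
        e₂ = solve-∀
        vanish : ∀ i j k l → W j ≡ W i ⊕ comb E₁ E₂ k l → k + k < + 2 → - (k + k) < + 2 → k ≡ 0ℤ × l ≡ 0ℤ
        vanish i j k l eq lt gt with small-double k lt gt | l ≟ 0ℤ
        ... | refl | yes l≡0 = refl , l≡0
        ... | refl | no l≢0 = ⊥-elim (no-multiples W walk E₂≢0 no-E₂ l l≢0 i j (trans eq (cong (W i ⊕_) (comb-0k E₁ E₂ l))))

      module _ (no-E₁ : No-E₁) (no-E₂ : No-E₂) where

        axis-free : AxisFree W E₁ E₂
        axis-free k k≢0 =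
          (λ (i , j , eq) → no-multiples W walk E₁≢0 no-E₁ k k≢0 i j (trans eq (cong (W i ⊕_) (comb-k0 E₁ E₂ k)))) ,
          (λ (i , j , eq) → no-multiples W walk E₂≢0 no-E₂ k k≢0 i j (trans eq (cong (W i ⊕_) (comb-0k E₁ E₂ k))))

        wide-horizontal : ¬ Mixed-chord W E₁ E₂ → Wide N X
        wide-horizontal pure = wide-by X _+_ X-growth λ i j k l eq →
          small-sum k l (same-sign W E₁ E₂ axis-free pure k l (i , j , eq))

        wide-vertical : ¬ Positive-chord W E₁ E₂ → Wide N Y
        wide-vertical pure = wide-by Y _-_ Y-growth vanish
          where
          vanish : ∀ i j k l → W j ≡ W i ⊕ comb E₁ E₂ k l → k - l < + 2 → - (k - l) < + 2 → k ≡ 0ℤ × l ≡ 0ℤ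
          vanish i j k l eq lt gt with small-sum (- l) k
            (same-sign W (𝟎 ⊖ E₂) E₁ (reflect-axis W E₁ E₂ axis-free) (pure ∘ unreflect-mixed W E₁ E₂) (- l) k (reflect W E₁ E₂ k l (i , j , eq)))
            (subst (_< + 2) (+-comm k (- l)) lt) (subst (λ z → - z < + 2) (+-comm k (- l)) gt)
          ... | -l≡0 , k≡0 = k≡0 , neg-injective -l≡0

        -- The double negation avoids deciding whether a mixed chord exists; it suffices for
        -- deriving a decidable inequality.
        wide-axis : ¬ ¬ (Wide N X ⊎ Wide N Y)
        wide-axis neither = neither (inj₁ (wide-horizontal λ mixed →
          neither (inj₂ (wide-vertical (one-quadrant W walk orientation axis-free mixed)))))

-- Sums of two walks on a bounded board.

module Frames where

  open import Data.Integer.Base hiding (_⊖_; suc; NonZero)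
  open import Data.Integer.Properties
  open import Data.Integer.Tactic.RingSolver using (solve-∀)
  open GridPaths
  open Bands
  open Walks
  open Chords
  open Counting

  record Frame {m} (n : ℕ) (A B : Fin m → Pt) : Set where
    field
      distinct : ∀ i j i′ j′ → A i ⊕ B j ≡ A i′ ⊕ B j′ → i ≡ i′ × j ≡ j′
      room₁ : ∀ i j i′ j′ → proj₁ (A i ⊕ B j) - proj₁ (A i′ ⊕ B j′) ≤ + n
      room₂ : ∀ i j i′ j′ → proj₂ (A i ⊕ B j) - proj₂ (A i′ ⊕ B j′) ≤ + n

  open Frame

  ⊕-comm : ∀ P Q → P ⊕ Q ≡ Q ⊕ P
  ⊕-comm (a , b) (c , d) = cong₂ _,_ (+-comm a c) (+-comm b d)

  frame-swap : ∀ {m n} {A B : Fin m → Pt} → Frame n A B → Frame n B A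
  frame-swap {A = A} {B} F = record
    { distinct = λ i j i′ j′ eq → swap (distinct F j i j′ i′ (trans (⊕-comm (A j) (B i)) (trans eq (⊕-comm (B i′) (A j′)))))
    ; room₁ = λ i j i′ j′ → subst₂ (λ P Q → proj₁ P - proj₁ Q ≤ _) (⊕-comm (A j) (B i)) (⊕-comm (A j′) (B i′)) (room₁ F j i j′ i′)
    ; room₂ = λ i j i′ j′ → subst₂ (λ P Q → proj₂ P - proj₂ Q ≤ _) (⊕-comm (A j) (B i)) (⊕-comm (A j′) (B i′)) (room₂ F j i j′ i′)
    }

  record Coordinates {k} (u₁ u₂ : Pt) (A : Fin (suc k) → Pt) : Set where
    field
      W : Fin (suc k) → Pt
      walk : IsWalk W
      origin : W zero ≡ 𝟎
      located : ∀ i → A i ≡ A zero ⊕ place u₁ u₂ (W i)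

  open Coordinates

  Step : Pt → Pt → Pt → Set
  Step u₁ u₂ u = ∃ λ s → 𝟎 ~ s × u ≡ place u₁ u₂ s

  coordinates : ∀ {k} u₁ u₂ (A : Fin (suc k) → Pt) → (∀ i → Step u₁ u₂ (A (suc i) ⊖ A (inject₁ i))) → Coordinates u₁ u₂ A
  coordinates {zero} u₁ u₂ A steps = record
    { W = λ _ → 𝟎 ; walk = λ () ; origin = refl ; located = λ { zero → sym (⊕-identityʳ (A zero)) } }
  coordinates {suc k} u₁ u₂ A steps = record { W = W′ ; walk = walk′ ; origin = refl ; located = located′ }
    where
    rest = coordinates u₁ u₂ (A ∘ suc) (steps ∘ suc)
    s = proj₁ (steps zero)
    W′ : Fin (suc (suc k)) → Pt
    W′ zero = 𝟎
    W′ (suc i) = W rest i ⊕ s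
    ⊕-identityˡ : ∀ P → 𝟎 ⊕ P ≡ P
    ⊕-identityˡ (a , b) = cong₂ _,_ (+-identityˡ a) (+-identityˡ b)
    walk′ : IsWalk W′
    walk′ zero = subst (𝟎 ~_) (sym (trans (cong (_⊕ s) (origin rest)) (⊕-identityˡ s))) (proj₁ (proj₂ (steps zero)))
    walk′ (suc i) = ~-shift s (walk rest i)
    located′ : ∀ i → A i ≡ A zero ⊕ place u₁ u₂ (W′ i)
    located′ zero = sym (⊕-identityʳ (A zero))
    located′ (suc i) = trans (located rest i) (move (A zero) (A (suc zero)) u₁ u₂ (W rest i) s (proj₂ (proj₂ (steps zero))))
      where
      move : ∀ P Q u v w s → Q ⊖ P ≡ place u v s → Q ⊕ place u v w ≡ P ⊕ place u v (w ⊕ s)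
      move (a , b) (c , d) (e , f) (g , h) (i , j) (k , l) eq = cong₂ _,_ (one a c e g i j k l (cong proj₁ eq)) (one b d f h i j k l (cong proj₂ eq))
        where
        one : ∀ a c e g i j k l → c - a ≡ k * e + l * g → c + (i * e + j * g) ≡ a + ((i + k) * e + (j + l) * g)
        one a c e g i j k l eq = trans (i₁ a c (i * e + j * g)) (trans (cong (λ z → a + z + (i * e + j * g)) eq) (i₂ a e g i j k l))
          where
          i₁ : ∀ a c x → c + x ≡ a + (c - a) + x
          i₁ = solve-∀
          i₂ : ∀ a e g i j k l → a + (k * e + l * g) + (i * e + j * g) ≡ a + ((i + k) * e + (j + l) * g)
          i₂ = solve-∀

  module _ {k n N} .{{_ : NonZero N}} {u₁ u₂ : Pt} {A B : Fin (suc k) → Pt} (F : Frame n A B)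
           (side : Side u₁ u₂ N) (co : Coordinates u₁ u₂ A) where

    W-injective : ∀ {i j} → W co i ≡ W co j → i ≡ j
    W-injective {i} {j} eq = proj₁ (distinct F i zero j zero (cong (_⊕ B zero)
      (trans (located co i) (trans (cong (λ w → A zero ⊕ place u₁ u₂ w) eq) (sym (located co j))))))

    no-axis-chords : Set
    no-axis-chords = No-E₁ side (W co) (walk co) W-injective × No-E₂ side (W co) (walk co) W-injective

    private
      X′ Y′ : Fin (suc k) → ℤ
      X′ = X side (W co) (walk co) W-injective
      Y′ = Y side (W co) (walk co) W-injective

    narrow : ∀ a b₀ x y {w z} → w ≡ a + x → z ≡ a + y → w + b₀ - (z + b₀) ≤ + n → x - y ≤ + n
    narrow a b₀ x y refl refl = subst (_≤ + n) (eq a b₀ x y)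
      where eq : ∀ a b x y → a + x + b - (a + y + b) ≡ x - y
            eq = solve-∀

    room-X : ∀ i j → X′ i - X′ j ≤ + n
    room-X i j = narrow (proj₁ (A zero)) (proj₁ (B zero)) (X′ i) (X′ j)
      (cong proj₁ (located co i)) (cong proj₁ (located co j)) (room₁ F i zero j zero)

    room-Y : ∀ i j → Y′ i - Y′ j ≤ + n
    room-Y i j = narrow (proj₂ (A zero)) (proj₂ (B zero)) (Y′ i) (Y′ j)
      (cong proj₂ (located co i)) (cong proj₂ (located co j)) (room₂ F i zero j zero)

    axis-bound : no-axis-chords → ¬ ¬ (+ (2 ℕ.* suc k) ≤ + n + + (2 ℕ.* N))
    axis-bound (no-E₁ , no-E₂) fail = wide-axis side (W co) (walk co) W-injective no-E₁ no-E₂ λ where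
      (inj₁ (i , j , le)) → fail (≤-trans le (+-monoˡ-≤ (+ (2 ℕ.* N)) (room-X i j)))
      (inj₂ (i , j , le)) → fail (≤-trans le (+-monoˡ-≤ (+ (2 ℕ.* N)) (room-Y i j)))

  module _ {k n N} .{{_ : NonZero N}} {u₁ u₂ v₁ v₂ : Pt} {A B : Fin (suc k) → Pt} (F : Frame n A B)
           (side : Side u₁ u₂ N) (co : Coordinates u₁ u₂ A) (side′ : Side v₁ v₂ N) (co′ : Coordinates v₁ v₂ B) where

    private
      F′ = frame-swap F
      W₁ = W co
      W₂ = W co′

    -- A chord common to both walks would give two coinciding points.
    no-common-chord : ∀ {E E′} → E ≢ 𝟎 → place u₁ u₂ E ≡ place v₁ v₂ E′ → ∀ i j i′ j′ → W₁ j ≡ W₁ i ⊕ E → W₂ j′ ≢ W₂ i′ ⊕ E′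
    no-common-chord {E} {E′} E≢0 same i j i′ j′ eq eq′ =
      E≢0 (⊕-cancel-𝟎 (W₁ i) (trans (cong W₁ (sym j≡i)) eq))
      where
      j≡i : j ≡ i
      j≡i = proj₁ (distinct F j i′ i j′ (begin
        A j ⊕ B i′                                                     ≡⟨ cong₂ _⊕_ (trans (located co j) (cong (λ w → A zero ⊕ place u₁ u₂ w) eq)) (located co′ i′) ⟩
        (A zero ⊕ place u₁ u₂ (W₁ i ⊕ E)) ⊕ (B zero ⊕ place v₁ v₂ (W₂ i′))    ≡⟨ cong (λ P → (A zero ⊕ P) ⊕ (B zero ⊕ place v₁ v₂ (W₂ i′))) (place-⊕ u₁ u₂ (W₁ i) E) ⟩
        (A zero ⊕ (place u₁ u₂ (W₁ i) ⊕ place u₁ u₂ E)) ⊕ (B zero ⊕ place v₁ v₂ (W₂ i′))  ≡⟨ cong (λ P → (A zero ⊕ (place u₁ u₂ (W₁ i) ⊕ P)) ⊕ (B zero ⊕ place v₁ v₂ (W₂ i′))) same ⟩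
        (A zero ⊕ (place u₁ u₂ (W₁ i) ⊕ place v₁ v₂ E′)) ⊕ (B zero ⊕ place v₁ v₂ (W₂ i′)) ≡⟨ exchange (A zero) _ (place v₁ v₂ E′) (B zero) _ ⟩
        (A zero ⊕ place u₁ u₂ (W₁ i)) ⊕ (B zero ⊕ (place v₁ v₂ (W₂ i′) ⊕ place v₁ v₂ E′)) ≡⟨ cong (λ P → (A zero ⊕ place u₁ u₂ (W₁ i)) ⊕ (B zero ⊕ P)) (place-⊕ v₁ v₂ (W₂ i′) E′) ⟨
        (A zero ⊕ place u₁ u₂ (W₁ i)) ⊕ (B zero ⊕ place v₁ v₂ (W₂ i′ ⊕ E′))   ≡⟨ cong₂ _⊕_ (located co i) (trans (located co′ j′) (cong (λ w → B zero ⊕ place v₁ v₂ w) eq′)) ⟨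
        A i ⊕ B j′ ∎))
        where
        open ≡-Reasoning
        place-⊕ : ∀ u v P Q → place u v (P ⊕ Q) ≡ place u v P ⊕ place u v Q
        place-⊕ (a , b) (c , d) (x , y) (z , w) = cong₂ _,_ (i₁ a c x y z w) (i₁ b d x y z w)
          where i₁ : ∀ a c x y z w → (x + z) * a + (y + w) * c ≡ (x * a + y * c) + (z * a + w * c)
                i₁ = solve-∀
        exchange : ∀ A P E B Q → (A ⊕ (P ⊕ E)) ⊕ (B ⊕ Q) ≡ (A ⊕ P) ⊕ (B ⊕ (Q ⊕ E))
        exchange (a , a′) (p , p′) (e , e′) (b , b′) (q , q′) = cong₂ _,_ (i₁ a p e b q) (i₁ a′ p′ e′ b′ q′)
          where i₁ : ∀ a p e b q → (a + (p + e)) + (b + q) ≡ (a + p) + (b + (q + e))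
                i₁ = solve-∀

    private
      X₁ = X side W₁ (walk co) (W-injective F side co)
      Y₁ = Y side W₁ (walk co) (W-injective F side co)
      X₂ = X side′ W₂ (walk co′) (W-injective F′ side′ co′)
      Y₂ = Y side′ W₂ (walk co′) (W-injective F′ side′ co′)

    -- Let i, i′ be the extremes of x - y on the first walk and j, j′ those of x + y on the second.
    -- The x-difference of the points (i , j) and (i′ , j′) plus the y-difference of (i′ , j) and (i
    -- , j′) is the sum of both spans. This gives 4m ≤ 2n + 4N for walks of m points.
    mixed-bound : Wide N (λ i → X₁ i - Y₁ i) → Wide N (λ j → X₂ j + Y₂ j) → + (2 ℕ.* suc k) ≤ + n + + (2 ℕ.* N)
    mixed-bound (i , i′ , le) (j , j′ , le′) = *-cancelˡ-≤-pos (+ (2 ℕ.* suc k)) (+ n + + (2 ℕ.* N)) (+ 2)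
      (add-up {proj₁ (A zero)} {proj₂ (A zero)} {proj₁ (B zero)} {proj₂ (B zero)} {X₁ i} {X₁ i′} {Y₁ i} {Y₁ i′} {X₂ j} {X₂ j′} {Y₂ j} {Y₂ j′} {+ (2 ℕ.* suc k)} {+ n} {+ (2 ℕ.* N)} le le′
        (subst₂ (λ P Q → P - Q ≤ + n) (cong₂ _+_ (cong proj₁ (located co i)) (cong proj₁ (located co′ j)))
                                      (cong₂ _+_ (cong proj₁ (located co i′)) (cong proj₁ (located co′ j′))) (room₁ F i j i′ j′))
        (subst₂ (λ P Q → P - Q ≤ + n) (cong₂ _+_ (cong proj₂ (located co i′)) (cong proj₂ (located co′ j)))
                                      (cong₂ _+_ (cong proj₂ (located co i)) (cong proj₂ (located co′ j′))) (room₂ F i′ j i j′)))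
      where
      add-up : ∀ {a c b d x x′ y y′ u u′ w w′ M n N} → M ≤ (x - y) - (x′ - y′) + N → M ≤ (u + w) - (u′ + w′) + N →
        (a + x + (b + u)) - (a + x′ + (b + u′)) ≤ n → (c + y′ + (d + w)) - (c + y + (d + w′)) ≤ n → + 2 * M ≤ + 2 * (n + N)
      add-up {a} {c} {b} {d} {x} {x′} {y} {y′} {u} {u′} {w} {w′} {M} {n} {N} le le′ r r′ =
        ≤-by (diff le ⊹ diff le′ ⊹ diff r ⊹ diff r′) (eq a c b d x x′ y y′ u u′ w w′ M n N)
        where
        eq : ∀ a c b d x x′ y y′ u u′ w w′ M n N → + 2 * (n + N) - + 2 * M ≡
          ((x - y) - (x′ - y′) + N - M) + ((u + w) - (u′ + w′) + N - M) +
          (n - ((a + x + (b + u)) - (a + x′ + (b + u′)))) + (n - ((c + y′ + (d + w)) - (c + y + (d + w′))))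
        eq = solve-∀

    no-shared-E₁ : (No-E₁ side W₁ (walk co) (W-injective F side co) → ⊥) → (No-E₁ side′ W₂ (walk co′) (W-injective F′ side′ co′) → ⊥) → ⊥
    no-shared-E₁ h h′ = h λ i j eq → h′ λ i′ j′ eq′ → no-common-chord (E₁≢0 side W₁ (walk co) (W-injective F side co))
      (trans (Side.place-E₁ side) (sym (Side.place-E₁ side′))) i j i′ j′ eq eq′

    no-shared-E₂ : (No-E₂ side W₁ (walk co) (W-injective F side co) → ⊥) → (No-E₂ side′ W₂ (walk co′) (W-injective F′ side′ co′) → ⊥) → ⊥
    no-shared-E₂ h h′ = h λ i j eq → h′ λ i′ j′ eq′ → no-common-chord (E₂≢0 side W₁ (walk co) (W-injective F side co))
      (trans (Side.place-E₂ side) (sym (Side.place-E₂ side′))) i j i′ j′ eq eq′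

  -- The goal is decidable, so for each of the two common vectors one may assume a walk that lacks
  -- it as a chord. If it is the same walk for both, `axis-bound` applies, otherwise `mixed-bound`.
  frame-bound : ∀ {k n N} .{{_ : NonZero N}} {u₁ u₂ v₁ v₂ : Pt} {A B : Fin (suc k) → Pt} → Frame n A B →
    Side u₁ u₂ N → Coordinates u₁ u₂ A → Side v₁ v₂ N → Coordinates v₁ v₂ B → + (2 ℕ.* suc k) ≤ + n + + (2 ℕ.* N)
  frame-bound {k} {n} {N} {u₁} {u₂} {v₁} {v₂} F side co side′ co′ = decidable-stable (+ (2 ℕ.* suc k) ≤? + n + + (2 ℕ.* N)) λ fail →
    no-shared-E₁ F side co side′ co′
      (λ no-E₁ → no-shared-E₂ F side co side′ co′
        (λ no-E₂ → axis-bound F side co (no-E₁ , no-E₂) fail)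
        (λ no-E₂′ → fail (mixed-bound F side co side′ co′
          (wide-antidiagonal side (W co) (walk co) (W-injective F side co) no-E₁)
          (wide-diagonal side′ (W co′) (walk co′) (W-injective F′ side′ co′) no-E₂′))))
      (λ no-E₁′ → no-shared-E₂ F side co side′ co′
        (λ no-E₂ → fail (mixed-bound F′ side′ co′ side co
          (wide-antidiagonal side′ (W co′) (walk co′) (W-injective F′ side′ co′) no-E₁′)
          (wide-diagonal side (W co) (walk co) (W-injective (frame-swap F′) side co) no-E₂)))
        (λ no-E₂′ → axis-bound F′ side′ co′ (no-E₁′ , no-E₂′) fail))
    where F′ = frame-swap F

-- The common lattice for each way of splitting the four directions.

module Lattices where

  open import Data.Integer.Base hiding (_⊖_; suc; NonZero)
  open import Data.Integer.Properties
  open import Data.Integer.Tactic.RingSolver using (solve-∀)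
  open GridPaths
  open Bands
  open Chords
  open Counting

  open ≡-Reasoning

  -- The Bézout relation provides the common factor explicitly, without division.
  coprime-multiple : ∀ P Q x y α β → x * P + y * Q ≡ 1ℤ → Q * α ≡ P * β →
    α ≡ (x * α + y * β) * P × β ≡ (x * α + y * β) * Q
  coprime-multiple P Q x y α β bezout eq = α≡ , β≡
    where
    α≡ : α ≡ (x * α + y * β) * P
    α≡ = begin
      α                             ≡⟨ *-identityˡ α ⟨
      1ℤ * α                        ≡⟨ cong (_* α) bezout ⟨
      (x * P + y * Q) * α           ≡⟨ e₁ P Q x y α ⟩
      x * α * P + y * (Q * α)       ≡⟨ cong (λ z → x * α * P + y * z) eq ⟩
      x * α * P + y * (P * β)       ≡⟨ e₂ P x y α β ⟩
      (x * α + y * β) * P           ∎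
      where
      e₁ : ∀ P Q x y α → (x * P + y * Q) * α ≡ x * α * P + y * (Q * α)
      e₁ = solve-∀
      e₂ : ∀ P x y α β → x * α * P + y * (P * β) ≡ (x * α + y * β) * P
      e₂ = solve-∀
    β≡ : β ≡ (x * α + y * β) * Q
    β≡ = begin
      β                             ≡⟨ *-identityˡ β ⟨
      1ℤ * β                        ≡⟨ cong (_* β) bezout ⟨
      (x * P + y * Q) * β           ≡⟨ e₁ P Q x y β ⟩
      x * (P * β) + y * β * Q       ≡⟨ cong (λ z → x * z + y * β * Q) eq ⟨
      x * (Q * α) + y * β * Q       ≡⟨ e₂ Q x y α β ⟩
      (x * α + y * β) * Q           ∎
      where
      e₁ : ∀ P Q x y β → (x * P + y * Q) * β ≡ x * (P * β) + y * β * Q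
      e₁ = solve-∀
      e₂ : ∀ Q x y α β → x * (Q * α) + y * β * Q ≡ (x * α + y * β) * Q
      e₂ = solve-∀

  subtract : ∀ a b {c} → a + b ≡ c → a ≡ c - b
  subtract a b refl = e a b
    where e : ∀ a b → a ≡ a + b - b
          e = solve-∀

  add-back : ∀ a b {c} → a - b ≡ c → a ≡ c + b
  add-back a b refl = e a b
    where e : ∀ a b → a ≡ a - b + b
          e = solve-∀

  module _ {P Q x y : ℤ} (bezout : x * P + y * Q ≡ 1ℤ) {p q : ℤ} (p≡ : p ≡ P - Q) (q≡ : q ≡ P + Q) where

    -- The form Q α - P β vanishes on `E₁` and equals Q² - P² = -N on `E₂`. If its value at a vector
    -- is z N, adding z `E₂` brings the vector into the kernel, where coprimality makes it a
    -- multiple of `E₁`.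
    side-product : ∀ N → + N ≡ p * q → 0ℤ < + N → Side (p , q) (p , - q) N
    side-product N N≡ 0<N rewrite p≡ | q≡ = record
      { E₁ = P , Q
      ; E₂ = Q , P
      ; place-E₁ = cong₂ _,_ (trans (e₁ P Q) (sym N≡)) (trans (e₂ P Q) (sym N≡))
      ; place-E₂ = cong₂ _,_ (trans (e₃ P Q) (sym N≡)) (trans (e₄ P Q) (cong -_ (sym N≡)))
      ; orientation = subst (0ℤ <_) (trans N≡ (e₅ P Q)) 0<N
      ; c = Q
      ; d = - P
      ; class = class′
      }
      where
      e₁ : ∀ P Q → P * (P - Q) + Q * (P - Q) ≡ (P - Q) * (P + Q)
      e₁ = solve-∀
      e₂ : ∀ P Q → P * (P + Q) + Q * - (P + Q) ≡ (P - Q) * (P + Q)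
      e₂ = solve-∀
      e₃ : ∀ P Q → Q * (P - Q) + P * (P - Q) ≡ (P - Q) * (P + Q)
      e₃ = solve-∀
      e₄ : ∀ P Q → Q * (P + Q) + P * - (P + Q) ≡ - ((P - Q) * (P + Q))
      e₄ = solve-∀
      e₅ : ∀ P Q → (P - Q) * (P + Q) ≡ P * P - Q * Q
      e₅ = solve-∀
      class′ : ∀ α β z → Q * α + - P * β ≡ z * + N → ∃₂ λ k l → (α , β) ≡ comb (P , Q) (Q , P) k l
      class′ α β z eq = k , - z , cong₂ _,_ (trans (subtract α (z * Q) (proj₁ both)) (neg-term k P z Q)) (trans (subtract β (z * P) (proj₂ both)) (neg-term k Q z P))
        where
        k = x * (α + z * Q) + y * (β + z * P)
        both = coprime-multiple P Q x y (α + z * Q) (β + z * P) bezout (begin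
          Q * (α + z * Q)                                    ≡⟨ f₁ P Q α β z ⟩
          (Q * α + - P * β) + P * β + z * (Q * Q)            ≡⟨ cong (λ w → w + P * β + z * (Q * Q)) (trans eq (cong (z *_) N≡)) ⟩
          z * ((P - Q) * (P + Q)) + P * β + z * (Q * Q)      ≡⟨ f₂ P Q β z ⟩
          P * (β + z * P)                                    ∎)
          where
          f₁ : ∀ P Q α β z → Q * (α + z * Q) ≡ (Q * α + - P * β) + P * β + z * (Q * Q)
          f₁ = solve-∀
          f₂ : ∀ P Q β z → z * ((P - Q) * (P + Q)) + P * β + z * (Q * Q) ≡ P * (β + z * P)
          f₂ = solve-∀
        neg-term : ∀ k P z Q → k * P - z * Q ≡ k * P + - z * Q
        neg-term = solve-∀

    side-norm : ∀ N → + N ≡ P * P + Q * Q → 0ℤ < + N → Side (p , q) (q , - p) N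
    side-norm N N≡ 0<N rewrite p≡ | q≡ = record
      { E₁ = P , Q
      ; E₂ = - Q , P
      ; place-E₁ = cong₂ _,_ (trans (e₁ P Q) (sym N≡)) (trans (e₂ P Q) (sym N≡))
      ; place-E₂ = cong₂ _,_ (trans (e₃ P Q) (sym N≡)) (trans (e₄ P Q) (cong -_ (sym N≡)))
      ; orientation = subst (0ℤ <_) (trans N≡ (e₅ P Q)) 0<N
      ; c = Q
      ; d = - P
      ; class = class′
      }
      where
      e₁ : ∀ P Q → P * (P - Q) + Q * (P + Q) ≡ P * P + Q * Q
      e₁ = solve-∀
      e₂ : ∀ P Q → P * (P + Q) + Q * - (P - Q) ≡ P * P + Q * Q
      e₂ = solve-∀
      e₃ : ∀ P Q → - Q * (P - Q) + P * (P + Q) ≡ P * P + Q * Q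
      e₃ = solve-∀
      e₄ : ∀ P Q → - Q * (P + Q) + P * - (P - Q) ≡ - (P * P + Q * Q)
      e₄ = solve-∀
      e₅ : ∀ P Q → P * P + Q * Q ≡ P * P - Q * - Q
      e₅ = solve-∀
      class′ : ∀ α β z → Q * α + - P * β ≡ z * + N → ∃₂ λ k l → (α , β) ≡ comb (P , Q) (- Q , P) k l
      class′ α β z eq = k , - z , cong₂ _,_ (trans (add-back α (z * Q) (proj₁ both)) (neg-term k P z Q)) (trans (subtract β (z * P) (proj₂ both)) (neg-term′ k Q z P))
        where
        k = x * (α - z * Q) + y * (β + z * P)
        both = coprime-multiple P Q x y (α - z * Q) (β + z * P) bezout (begin
          Q * (α - z * Q)                                    ≡⟨ f₁ P Q α β z ⟩
          (Q * α + - P * β) + P * β - z * (Q * Q)            ≡⟨ cong (λ w → w + P * β - z * (Q * Q)) (trans eq (cong (z *_) N≡)) ⟩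
          z * (P * P + Q * Q) + P * β - z * (Q * Q)          ≡⟨ f₂ P Q β z ⟩
          P * (β + z * P)                                    ∎)
          where
          f₁ : ∀ P Q α β z → Q * (α - z * Q) ≡ (Q * α + - P * β) + P * β - z * (Q * Q)
          f₁ = solve-∀
          f₂ : ∀ P Q β z → z * (P * P + Q * Q) + P * β - z * (Q * Q) ≡ P * (β + z * P)
          f₂ = solve-∀
        neg-term : ∀ k P z Q → k * P + z * Q ≡ k * P + - z * - Q
        neg-term = solve-∀
        neg-term′ : ∀ k P z Q → k * P - z * Q ≡ k * P + - z * Q
        neg-term′ = solve-∀

    -- 2xP - 1 is 1 modulo 2Q and -1 modulo 2P, so α + (2xP - 1) β determines α + β modulo 2Q and α - β modulo 2P.
    private
      class-even : ∀ N → + N ≡ + 2 * (P * Q) → ∀ α β z → 1ℤ * α + (+ 2 * (x * P) - 1ℤ) * β ≡ z * + N →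
        α ≡ (P * z + y * β) * Q + (Q * z - x * β) * P × β ≡ (P * z + y * β) * Q - (Q * z - x * β) * P
      class-even N N≡ α β z eq = α≡ , β≡
        where
        α≡ : α ≡ (P * z + y * β) * Q + (Q * z - x * β) * P
        α≡ = begin
          α                                                                              ≡⟨ f₁ P x α β ⟩
          (1ℤ * α + (+ 2 * (x * P) - 1ℤ) * β) - + 2 * (x * P) * β + 1ℤ * β              ≡⟨ cong₂ (λ u v → u - + 2 * (x * P) * β + v * β) (trans eq (cong (z *_) N≡)) (sym bezout) ⟩
          z * (+ 2 * (P * Q)) - + 2 * (x * P) * β + (x * P + y * Q) * β                 ≡⟨ f₂ P Q x y β z ⟩
          (P * z + y * β) * Q + (Q * z - x * β) * P                                      ∎
          where
          f₁ : ∀ P x α β → α ≡ (1ℤ * α + (+ 2 * (x * P) - 1ℤ) * β) - + 2 * (x * P) * β + 1ℤ * β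
          f₁ = solve-∀
          f₂ : ∀ P Q x y β z → z * (+ 2 * (P * Q)) - + 2 * (x * P) * β + (x * P + y * Q) * β ≡ (P * z + y * β) * Q + (Q * z - x * β) * P
          f₂ = solve-∀
        β≡ : β ≡ (P * z + y * β) * Q - (Q * z - x * β) * P
        β≡ = begin
          β                                                  ≡⟨ *-identityˡ β ⟨
          1ℤ * β                                             ≡⟨ cong (_* β) bezout ⟨
          (x * P + y * Q) * β                                ≡⟨ f P Q x y β z ⟩
          (P * z + y * β) * Q - (Q * z - x * β) * P          ∎
          where
          f : ∀ P Q x y β z → (x * P + y * Q) * β ≡ (P * z + y * β) * Q - (Q * z - x * β) * P
          f = solve-∀

    side-even : ∀ N → + N ≡ + 2 * (P * Q) → 0ℤ < + N → Side (p , q) (q , p) N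
    side-even N N≡ 0<N rewrite p≡ | q≡ = record
      { E₁ = Q , Q
      ; E₂ = - P , P
      ; place-E₁ = cong₂ _,_ (trans (e₁ P Q) (sym N≡)) (trans (e₂ P Q) (sym N≡))
      ; place-E₂ = cong₂ _,_ (trans (e₃ P Q) (sym N≡)) (trans (e₄ P Q) (cong -_ (sym N≡)))
      ; orientation = subst (0ℤ <_) (trans N≡ (e₅ P Q)) 0<N
      ; c = 1ℤ
      ; d = + 2 * (x * P) - 1ℤ
      ; class = λ α β z eq → let α≡ , β≡ = class-even N N≡ α β z eq in P * z + y * β , - (Q * z - x * β) ,
          cong₂ _,_ (trans α≡ (e₆ (P * z + y * β) (Q * z - x * β) P Q)) (trans β≡ (e₇ (P * z + y * β) (Q * z - x * β) P Q))
      }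
      where
      e₁ : ∀ P Q → Q * (P - Q) + Q * (P + Q) ≡ + 2 * (P * Q)
      e₁ = solve-∀
      e₂ : ∀ P Q → Q * (P + Q) + Q * (P - Q) ≡ + 2 * (P * Q)
      e₂ = solve-∀
      e₃ : ∀ P Q → - P * (P - Q) + P * (P + Q) ≡ + 2 * (P * Q)
      e₃ = solve-∀
      e₄ : ∀ P Q → - P * (P + Q) + P * (P - Q) ≡ - (+ 2 * (P * Q))
      e₄ = solve-∀
      e₅ : ∀ P Q → + 2 * (P * Q) ≡ Q * P - Q * - P
      e₅ = solve-∀
      e₆ : ∀ k l P Q → k * Q + l * P ≡ k * Q + - l * - P
      e₆ = solve-∀
      e₇ : ∀ k l P Q → k * Q - l * P ≡ k * Q + - l * P
      e₇ = solve-∀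

    -- The coordinate lattice is that of `side-even`; only the generators that represent N (1 , 1)
    -- and N (1 , -1) trade places, up to sign.
    side-even′ : ∀ N → + N ≡ + 2 * (P * Q) → 0ℤ < + N → Side (q , - p) (p , - q) N
    side-even′ N N≡ 0<N rewrite p≡ | q≡ = record
      { E₁ = P , - P
      ; E₂ = Q , Q
      ; place-E₁ = cong₂ _,_ (trans (e₁ P Q) (sym N≡)) (trans (e₂ P Q) (sym N≡))
      ; place-E₂ = cong₂ _,_ (trans (e₃ P Q) (sym N≡)) (trans (e₄ P Q) (cong -_ (sym N≡)))
      ; orientation = subst (0ℤ <_) (trans N≡ (e₅ P Q)) 0<N
      ; c = 1ℤ
      ; d = + 2 * (x * P) - 1ℤ
      ; class = λ α β z eq → let α≡ , β≡ = class-even N N≡ α β z eq in Q * z - x * β , P * z + y * β ,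
          cong₂ _,_ (trans α≡ (e₆ (P * z + y * β) (Q * z - x * β) P Q)) (trans β≡ (e₇ (P * z + y * β) (Q * z - x * β) P Q))
      }
      where
      e₁ : ∀ P Q → P * (P + Q) + - P * (P - Q) ≡ + 2 * (P * Q)
      e₁ = solve-∀
      e₂ : ∀ P Q → P * - (P - Q) + - P * - (P + Q) ≡ + 2 * (P * Q)
      e₂ = solve-∀
      e₃ : ∀ P Q → Q * (P + Q) + Q * (P - Q) ≡ + 2 * (P * Q)
      e₃ = solve-∀
      e₄ : ∀ P Q → Q * - (P - Q) + Q * - (P + Q) ≡ - (+ 2 * (P * Q))
      e₄ = solve-∀
      e₅ : ∀ P Q → + 2 * (P * Q) ≡ P * Q - - P * Q
      e₅ = solve-∀
      e₆ : ∀ k l P Q → k * Q + l * P ≡ l * P + k * Q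
      e₆ = solve-∀
      e₇ : ∀ k l P Q → k * Q - l * P ≡ l * - P + k * Q
      e₇ = solve-∀

-- Rhombi, and the splitting of an embedding into two walks.

module Rhombi where

  open import Data.Integer.Base hiding (_⊖_; suc; NonZero)
  open import Data.Integer.Properties
  open import Data.Integer.Tactic.RingSolver using (solve-∀)
  open GridPaths
  open Bands
  open Frames

  data Dir : Set where
    d₁ d₂ d₃ d₄ : Dir

  vec : ℤ → ℤ → Dir → Pt
  vec p q d₁ = p , q
  vec p q d₂ = p , - q
  vec p q d₃ = q , p
  vec p q d₄ = q , - p

  Unit : ℤ → Set
  Unit ε = ε ≡ 1ℤ ⊎ ε ≡ -1ℤ

  data Move (p q : ℤ) : Pt → Set where
    move : ∀ ε d → Unit ε → Move p q (ε • vec p q d)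

  signed : ∀ a b c → ℕ.∣ a - b ∣ ≡ c → (+ b - + a ≡ + c) ⊎ (+ b - + a ≡ - + c)
  signed zero b c refl = inj₁ (+-identityʳ (+ b))
  signed (suc a) zero c refl = inj₂ refl
  signed (suc a) (suc b) c eq with signed a b c eq
  ... | inj₁ e = inj₁ (trans (cancel (+ a) (+ b)) e)
    where cancel : ∀ a b → (1ℤ + b) - (1ℤ + a) ≡ b - a
          cancel = solve-∀
  ... | inj₂ e = inj₂ (trans (cancel (+ a) (+ b)) e)
    where cancel : ∀ a b → (1ℤ + b) - (1ℤ + a) ≡ b - a
          cancel = solve-∀

  position : ∀ {n} → Cell n → Pt
  position (x , y) = + toℕ x , + toℕ y

  module _ {p q : ℕ} where

    signed-move : ∀ {x y} d d′ → vec (+ p) (+ q) d′ ≡ (proj₁ (vec (+ p) (+ q) d) , - proj₂ (vec (+ p) (+ q) d)) →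
      (x ≡ proj₁ (vec (+ p) (+ q) d) ⊎ x ≡ - proj₁ (vec (+ p) (+ q) d)) →
      (y ≡ proj₂ (vec (+ p) (+ q) d) ⊎ y ≡ - proj₂ (vec (+ p) (+ q) d)) → Move (+ p) (+ q) (x , y)
    signed-move {x} {y} d d′ flip = λ where
        (inj₁ refl) (inj₁ refl) → subst (Move _ _) (cong₂ _,_ (*-identityˡ _) (*-identityˡ _)) (move 1ℤ d (inj₁ refl))
        (inj₁ refl) (inj₂ refl) → subst (Move _ _) (cong₂ _,_ (trans (cong (λ v → 1ℤ * proj₁ v) flip) (*-identityˡ _)) (trans (cong (λ v → 1ℤ * proj₂ v) flip) (*-identityˡ _))) (move 1ℤ d′ (inj₁ refl))
        (inj₂ refl) (inj₁ refl) → subst (Move _ _) (cong₂ _,_ (trans (cong (λ v → -1ℤ * proj₁ v) flip) (-1*i≡-i _)) (trans (cong (λ v → -1ℤ * proj₂ v) flip) (trans (-1*i≡-i _) (neg-involutive _)))) (move -1ℤ d′ (inj₂ refl))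
        (inj₂ refl) (inj₂ refl) → subst (Move _ _) (cong₂ _,_ (-1*i≡-i _) (-1*i≡-i _)) (move -1ℤ d (inj₂ refl))

    leaper-move : ∀ {n} (u v : Cell n) → LeaperAdj p q n u v → Move (+ p) (+ q) (position v ⊖ position u)
    leaper-move (x , y) (x′ , y′) (inj₁ (dx≡ , dy≡)) = signed-move d₁ d₂ refl (signed (toℕ x) (toℕ x′) p dx≡) (signed (toℕ y) (toℕ y′) q dy≡)
    leaper-move (x , y) (x′ , y′) (inj₂ (dx≡ , dy≡)) = signed-move d₃ d₄ refl (signed (toℕ x) (toℕ x′) q dx≡) (signed (toℕ y) (toℕ y′) p dy≡)

  dot : Pt → Pt → ℤ
  dot (a , b) (c , d) = a * c + b * d

  square-nonneg : ∀ i → 0ℤ ≤ i * i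
  square-nonneg (+ n) = _⊛_ {+ n} {+ n} (+≤+ ℕ.z≤n) (+≤+ ℕ.z≤n)
  square-nonneg -[1+ n ] = +≤+ ℕ.z≤n

  squares-vanish : ∀ a b → a * a + b * b ≡ 0ℤ → a ≡ 0ℤ
  squares-vanish a b eq = [ (λ e → e) , (λ e → e) ]′ (i*j≡0⇒i≡0∨j≡0 a (≤-antisym (≤-by (square-nonneg b) (trans (e (a * a) (b * b)) (trans (cong (λ z → b * b - z) eq) (+-identityʳ _)))) (square-nonneg a)))
    where e : ∀ x y → 0ℤ - x ≡ y - (x + y)
          e = solve-∀

  dot-vanish : ∀ P → dot P P ≡ 0ℤ → P ≡ 𝟎
  dot-vanish (a , b) eq = cong₂ _,_ (squares-vanish a b eq) (squares-vanish b a (trans (+-comm (b * b) (a * a)) eq))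

  move-norm : ∀ {p q u} → Move p q u → dot u u ≡ p * p + q * q
  move-norm {p} {q} (move ε d unit) = trans (scale (vec p q d) ε) (trans (cong (_* dot (vec p q d) (vec p q d)) (unit² unit))
    (trans (*-identityˡ _) (norm d)))
    where
    unit² : ∀ {ε} → Unit ε → ε * ε ≡ 1ℤ
    unit² (inj₁ refl) = refl
    unit² (inj₂ refl) = refl
    scale : ∀ P ε → dot (ε • P) (ε • P) ≡ ε * ε * dot P P
    scale (a , b) ε = e ε a b
      where e : ∀ ε a b → ε * a * (ε * a) + ε * b * (ε * b) ≡ ε * ε * (a * a + b * b)
            e = solve-∀
    norm : ∀ d → dot (vec p q d) (vec p q d) ≡ p * p + q * q
    norm d₁ = refl
    norm d₂ = e p q
      where e : ∀ p q → p * p + - q * - q ≡ p * p + q * q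
            e = solve-∀
    norm d₃ = +-comm (q * q) (p * p)
    norm d₄ = e p q
      where e : ∀ p q → q * q + - p * - p ≡ p * p + q * q
            e = solve-∀

  -- Lagrange's identity makes the determinant of `w` and `d` nonzero, and its product with `z` is a
  -- combination of the two vanishing dot products.
  orthogonal-vanish : ∀ w d z → dot z w ≡ 0ℤ → dot z d ≡ 0ℤ → dot w d ≡ 0ℤ → w ≢ 𝟎 → d ≢ 𝟎 → z ≡ 𝟎
  orthogonal-vanish w@(w₁ , w₂) d@(e₁ , e₂) (z₁ , z₂) zw zd wd w≢0 d≢0 =
    cong₂ _,_ (kill z₁ (trans (c₁ w₁ w₂ e₁ e₂ z₁ z₂) (trans (cong₂ (λ s t → s * e₂ - t * w₂) zw zd) refl)))
              (kill z₂ (trans (c₂ w₁ w₂ e₁ e₂ z₁ z₂) (trans (cong₂ (λ s t → t * w₁ - s * e₁) zw zd) refl)))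
    where
    c₁ : ∀ w₁ w₂ e₁ e₂ z₁ z₂ → (w₁ * e₂ - w₂ * e₁) * z₁ ≡ (z₁ * w₁ + z₂ * w₂) * e₂ - (z₁ * e₁ + z₂ * e₂) * w₂
    c₁ = solve-∀
    c₂ : ∀ w₁ w₂ e₁ e₂ z₁ z₂ → (w₁ * e₂ - w₂ * e₁) * z₂ ≡ (z₁ * e₁ + z₂ * e₂) * w₁ - (z₁ * w₁ + z₂ * w₂) * e₁
    c₂ = solve-∀
    lagrange : ∀ w₁ w₂ e₁ e₂ → (w₁ * w₁ + w₂ * w₂) * (e₁ * e₁ + e₂ * e₂) ≡ (w₁ * e₂ - w₂ * e₁) * (w₁ * e₂ - w₂ * e₁) + (w₁ * e₁ + w₂ * e₂) * (w₁ * e₁ + w₂ * e₂)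
    lagrange = solve-∀
    D = w₁ * e₂ - w₂ * e₁
    D≢0 : D ≢ 0ℤ
    D≢0 D≡0 = [ w≢0 ∘ dot-vanish w , d≢0 ∘ dot-vanish d ]′ (i*j≡0⇒i≡0∨j≡0 (dot w w)
      (trans (lagrange w₁ w₂ e₁ e₂) (cong₂ (λ s t → s * s + t * t) D≡0 wd)))
    kill : ∀ z → D * z ≡ 0ℤ → z ≡ 0ℤ
    kill z eq = [ ⊥-elim ∘ D≢0 , (λ e → e) ]′ (i*j≡0⇒i≡0∨j≡0 D eq)

  -- d + a - (b + c) is orthogonal to both diagonals d - a and b - c, which are orthogonal to each other.
  rhombus : ∀ R a b c d → dot (b ⊖ a) (b ⊖ a) ≡ R → dot (c ⊖ a) (c ⊖ a) ≡ R → dot (d ⊖ b) (d ⊖ b) ≡ R → dot (d ⊖ c) (d ⊖ c) ≡ R →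
    b ≢ c → d ≢ a → d ⊕ a ≡ b ⊕ c
  rhombus R a@(a₁ , a₂) b@(b₁ , b₂) c@(c₁ , c₂) d@(x₁ , x₂) ba ca db dc b≢c d≢a =
    cong₂ _,_ (finish a₁ b₁ c₁ x₁ (cong proj₁ z≡0)) (finish a₂ b₂ c₂ x₂ (cong proj₂ z≡0))
    where
    z = (x₁ + a₁) - (b₁ + c₁) , (x₂ + a₂) - (b₂ + c₂)
    half : ∀ i → + 2 * i ≡ 0ℤ → i ≡ 0ℤ
    half i eq = [ (λ ()) , (λ e → e) ]′ (i*j≡0⇒i≡0∨j≡0 (+ 2) eq)
    finish : ∀ a b c d → (d + a) - (b + c) ≡ 0ℤ → d + a ≡ b + c
    finish a b c d eq = i-j≡0⇒i≡j (d + a) (b + c) eq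
    cancel : ∀ {u v s t} → u ≡ R → v ≡ R → s ≡ R → t ≡ R → (u + v) - (s + t) ≡ 0ℤ
    cancel refl refl refl refl = +-inverseʳ (R + R)
    zw : dot z (d ⊖ a) ≡ 0ℤ
    zw = half _ (trans (e a₁ a₂ b₁ b₂ c₁ c₂ x₁ x₂) (cancel db dc ba ca))
      where
      e : ∀ a₁ a₂ b₁ b₂ c₁ c₂ x₁ x₂ →
        + 2 * (((x₁ + a₁) - (b₁ + c₁)) * (x₁ - a₁) + ((x₂ + a₂) - (b₂ + c₂)) * (x₂ - a₂)) ≡
        (((x₁ - b₁) * (x₁ - b₁) + (x₂ - b₂) * (x₂ - b₂)) + ((x₁ - c₁) * (x₁ - c₁) + (x₂ - c₂) * (x₂ - c₂))) -
        (((b₁ - a₁) * (b₁ - a₁) + (b₂ - a₂) * (b₂ - a₂)) + ((c₁ - a₁) * (c₁ - a₁) + (c₂ - a₂) * (c₂ - a₂)))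
      e = solve-∀
    wd : dot (d ⊖ a) (b ⊖ c) ≡ 0ℤ
    wd = half _ (trans (e a₁ a₂ b₁ b₂ c₁ c₂ x₁ x₂) (cancel ba dc ca db))
      where
      e : ∀ a₁ a₂ b₁ b₂ c₁ c₂ x₁ x₂ → + 2 * ((x₁ - a₁) * (b₁ - c₁) + (x₂ - a₂) * (b₂ - c₂)) ≡
        (((b₁ - a₁) * (b₁ - a₁) + (b₂ - a₂) * (b₂ - a₂)) + ((x₁ - c₁) * (x₁ - c₁) + (x₂ - c₂) * (x₂ - c₂))) -
        (((c₁ - a₁) * (c₁ - a₁) + (c₂ - a₂) * (c₂ - a₂)) + ((x₁ - b₁) * (x₁ - b₁) + (x₂ - b₂) * (x₂ - b₂)))
      e = solve-∀
    zd : dot z (b ⊖ c) ≡ 0ℤ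
    zd = half _ (trans (e a₁ a₂ b₁ b₂ c₁ c₂ x₁ x₂) (cancel ca dc ba db))
      where
      e : ∀ a₁ a₂ b₁ b₂ c₁ c₂ x₁ x₂ → + 2 * (((x₁ + a₁) - (b₁ + c₁)) * (b₁ - c₁) + ((x₂ + a₂) - (b₂ + c₂)) * (b₂ - c₂)) ≡
        (((c₁ - a₁) * (c₁ - a₁) + (c₂ - a₂) * (c₂ - a₂)) + ((x₁ - c₁) * (x₁ - c₁) + (x₂ - c₂) * (x₂ - c₂))) -
        (((b₁ - a₁) * (b₁ - a₁) + (b₂ - a₂) * (b₂ - a₂)) + ((x₁ - b₁) * (x₁ - b₁) + (x₂ - b₂) * (x₂ - b₂)))
      e = solve-∀
    ⊖≡𝟎 : ∀ P Q → P ⊖ Q ≡ 𝟎 → P ≡ Q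
    ⊖≡𝟎 (s , t) (u , v) eq = cong₂ _,_ (i-j≡0⇒i≡j s u (cong proj₁ eq)) (i-j≡0⇒i≡j t v (cong proj₂ eq))
    z≡0 : z ≡ 𝟎
    z≡0 = orthogonal-vanish (d ⊖ a) (b ⊖ c) z zw zd wd (d≢a ∘ ⊖≡𝟎 d a) (b≢c ∘ ⊖≡𝟎 b c)

  glue : ∀ a b c d e f → a ⊕ b ≡ c ⊕ d → d ⊕ e ≡ b ⊕ f → a ⊕ e ≡ c ⊕ f
  glue (a , a′) (b , b′) (c , c′) (d , d′) (e , e′) (f , f′) eq eq′ =
    cong₂ _,_ (one a b c d e f (cong proj₁ eq) (cong proj₁ eq′)) (one a′ b′ c′ d′ e′ f′ (cong proj₂ eq) (cong proj₂ eq′))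
    where
    one : ∀ a b c d e f → a + b ≡ c + d → d + e ≡ b + f → a + e ≡ c + f
    one a b c d e f eq eq′ = trans (i₁ a b d e) (trans (cong₂ (λ s t → s + t - (b + d)) eq eq′) (i₂ b c d f))
      where
      i₁ : ∀ a b d e → a + e ≡ (a + b) + (d + e) - (b + d)
      i₁ = solve-∀
      i₂ : ∀ b c d f → (c + d) + (b + f) - (b + d) ≡ c + f
      i₂ = solve-∀

  additive-strip : ∀ {l} (g h : Fin (suc l) → Pt) → (∀ j → g (suc j) ⊕ h (inject₁ j) ≡ g (inject₁ j) ⊕ h (suc j)) →
    ∀ j → g j ⊕ h zero ≡ g zero ⊕ h j
  additive-strip g h eqs zero = refl
  additive-strip {suc l} g h eqs (suc j) = trans
    (glue (g (suc j)) (h (suc zero)) (h (suc j)) (g (suc zero)) (h zero) (g zero)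
      (trans (additive-strip (g ∘ suc) (h ∘ suc) (eqs ∘ suc) j) (⊕-comm (g (suc zero)) (h (suc j))))
      (trans (eqs zero) (⊕-comm (g zero) (h (suc zero)))))
    (⊕-comm (h (suc j)) (g zero))

  -- All mixed second differences of `G` vanish, so `G` is a function of `i` plus a function of `j`;
  -- `glue` joins neighbouring parallelograms.
  additive : ∀ {k l} (G : Fin (suc k) → Fin (suc l) → Pt) →
    (∀ i j → G (suc i) (suc j) ⊕ G (inject₁ i) (inject₁ j) ≡ G (suc i) (inject₁ j) ⊕ G (inject₁ i) (suc j)) →
    ∀ i j → G i j ⊕ G zero zero ≡ G i zero ⊕ G zero j
  additive G squares zero j = ⊕-comm (G zero j) (G zero zero)
  additive {suc k} {l} G squares (suc i) j = glue (G (suc i) j) (G (suc zero) zero) (G (suc i) zero) (G (suc zero) j) (G zero zero) (G zero j)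
    (additive (G ∘ suc) (squares ∘ suc) i j) (additive-strip (G (suc zero)) (G zero) (squares zero) j)

  suc≢inject₁ : ∀ {k} (i : Fin k) → suc i ≢ inject₁ i
  suc≢inject₁ i eq = ℕ.1+n≢n (trans (cong toℕ eq) (Fin.toℕ-inject₁ i))

  module _ {p q n k : ℕ} (f : Cell (suc k) → Cell n) (f-injective : Injective _≡_ _≡_ f)
           (f-adjacent : ∀ u v → GridAdj (suc k) u v → LeaperAdj p q n (f u) (f v)) where

    private
      G : Fin (suc k) → Fin (suc k) → Pt
      G i j = position (f (i , j))

    G-injective : ∀ i j i′ j′ → G i j ≡ G i′ j′ → i ≡ i′ × j ≡ j′
    G-injective i j i′ j′ eq = cong proj₁ same , cong proj₂ same
      where
      same : (i , j) ≡ (i′ , j′)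
      same = f-injective (cong₂ _,_ (Fin.toℕ-injective (+-injective (cong proj₁ eq))) (Fin.toℕ-injective (+-injective (cong proj₂ eq))))

    unit-step : ∀ (i : Fin k) → ℕ.∣ toℕ (inject₁ i) - suc (toℕ i) ∣ ≡ 1
    unit-step i = trans (cong (λ t → ℕ.∣ t - suc (toℕ i) ∣) (Fin.toℕ-inject₁ i)) (consecutive (toℕ i))
      where
      consecutive : ∀ t → ℕ.∣ t - suc t ∣ ≡ 1
      consecutive zero = refl
      consecutive (suc t) = consecutive t

    row-move : ∀ (i : Fin k) j → Move (+ p) (+ q) (G (suc i) j ⊖ G (inject₁ i) j)
    row-move i j = leaper-move (f (inject₁ i , j)) (f (suc i , j)) (f-adjacent _ _
      (cong₂ (λ a b → a ℕ.* a ℕ.+ b ℕ.* b) (unit-step i) (ℕ.∣n-n∣≡0 (toℕ j))))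

    column-move : ∀ i (j : Fin k) → Move (+ p) (+ q) (G i (suc j) ⊖ G i (inject₁ j))
    column-move i j = leaper-move (f (i , inject₁ j)) (f (i , suc j)) (f-adjacent _ _
      (cong₂ (λ a b → a ℕ.* a ℕ.+ b ℕ.* b) (ℕ.∣n-n∣≡0 (toℕ i)) (unit-step j)))

    squares : ∀ i j → G (suc i) (suc j) ⊕ G (inject₁ i) (inject₁ j) ≡ G (suc i) (inject₁ j) ⊕ G (inject₁ i) (suc j)
    squares i j = rhombus (+ p * + p + + q * + q) (G (inject₁ i) (inject₁ j)) (G (suc i) (inject₁ j)) (G (inject₁ i) (suc j)) (G (suc i) (suc j))
      (move-norm (row-move i (inject₁ j))) (move-norm (column-move (inject₁ i) j))
      (move-norm (column-move (suc i) j)) (move-norm (row-move i (suc j)))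
      -- Four equal sides do not force a parallelogram when opposite corners coincide; injectivity
      -- rules this out.
      (λ eq → suc≢inject₁ i (proj₁ (G-injective _ _ _ _ eq)))
      (λ eq → suc≢inject₁ i (proj₁ (G-injective _ _ _ _ eq)))

    rows columns : Fin (suc k) → Pt
    rows i = G i zero
    columns j = G zero j ⊖ G zero zero

    rows-columns : ∀ i j → rows i ⊕ columns j ≡ G i j
    rows-columns i j = solve-for (G i j) (G zero zero) (G i zero) (G zero j) (additive G squares i j)
      where
      solve-for : ∀ a b c d → a ⊕ b ≡ c ⊕ d → c ⊕ (d ⊖ b) ≡ a
      solve-for (a , a′) (b , b′) (c , c′) (d , d′) eq = cong₂ _,_ (one a b c d (cong proj₁ eq)) (one a′ b′ c′ d′ (cong proj₂ eq))
        where
        one : ∀ a b c d → a + b ≡ c + d → c + (d - b) ≡ a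
        one a b c d eq = trans (i₁ b c d) (trans (cong (_- b) (sym eq)) (i₂ a b))
          where
          i₁ : ∀ b c d → c + (d - b) ≡ c + d - b
          i₁ = solve-∀
          i₂ : ∀ a b → a + b - b ≡ a
          i₂ = solve-∀

    frame : Frame n rows columns
    frame = record
      { distinct = λ i j i′ j′ eq → G-injective i j i′ j′ (trans (sym (rows-columns i j)) (trans eq (rows-columns i′ j′)))
      ; room₁ = λ i j i′ j′ → subst₂ (λ P Q → proj₁ P - proj₁ Q ≤ + n) (sym (rows-columns i j)) (sym (rows-columns i′ j′))
          (in-board (proj₁ (f (i , j))) (proj₁ (f (i′ , j′))))
      ; room₂ = λ i j i′ j′ → subst₂ (λ P Q → proj₂ P - proj₂ Q ≤ + n) (sym (rows-columns i j)) (sym (rows-columns i′ j′))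
          (in-board (proj₂ (f (i , j))) (proj₂ (f (i′ , j′))))
      }
      where
      in-board : ∀ (x y : Fin n) → + toℕ x - + toℕ y ≤ + n
      in-board x y = ≤-trans (i-j≤i (+ toℕ x) (+ toℕ y)) (+≤+ (ℕ.<⇒≤ (Fin.toℕ<n x)))

    rows-move : ∀ i → Move (+ p) (+ q) (rows (suc i) ⊖ rows (inject₁ i))
    rows-move i = row-move i zero

    columns-move : ∀ j → Move (+ p) (+ q) (columns (suc j) ⊖ columns (inject₁ j))
    columns-move j = subst (Move (+ p) (+ q)) (shift-both (G zero (suc j)) (G zero (inject₁ j)) (G zero zero)) (column-move zero j)
      where
      shift-both : ∀ a b c → a ⊖ b ≡ (a ⊖ c) ⊖ (b ⊖ c)
      shift-both (a , a′) (b , b′) (c , c′) = cong₂ _,_ (e a b c) (e a′ b′ c′)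
        where e : ∀ a b c → a - b ≡ (a - c) - (b - c)
              e = solve-∀

-- The upper bound, by the directions that the two walks use.

module UpperBound where

  open import Data.Integer.Base hiding (_⊖_; suc; NonZero)
  open import Data.Integer.Properties
  open import Data.Integer.Tactic.RingSolver using (solve-∀)
  open GridPaths
  open Bands
  open Walks
  open Counting
  open Frames
  open Lattices
  open Rhombi

  open Frame

  _≟ᵈ_ : DecidableEquality Dir
  d₁ ≟ᵈ d₁ = yes refl
  d₁ ≟ᵈ d₂ = no λ ()
  d₁ ≟ᵈ d₃ = no λ ()
  d₁ ≟ᵈ d₄ = no λ ()
  d₂ ≟ᵈ d₁ = no λ ()
  d₂ ≟ᵈ d₂ = yes refl
  d₂ ≟ᵈ d₃ = no λ ()
  d₂ ≟ᵈ d₄ = no λ ()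
  d₃ ≟ᵈ d₁ = no λ ()
  d₃ ≟ᵈ d₂ = no λ ()
  d₃ ≟ᵈ d₃ = yes refl
  d₃ ≟ᵈ d₄ = no λ ()
  d₄ ≟ᵈ d₁ = no λ ()
  d₄ ≟ᵈ d₂ = no λ ()
  d₄ ≟ᵈ d₃ = no λ ()
  d₄ ≟ᵈ d₄ = yes refl

  -- The order within each pair is the one for which the pair E₁, E₂ of its Side is positively oriented.
  data Split : Dir → Dir → Dir → Dir → Set where
    s₁₂ : Split d₁ d₂ d₃ d₄
    s₃₄ : Split d₃ d₄ d₁ d₂
    s₁₄ : Split d₁ d₄ d₃ d₂
    s₃₂ : Split d₃ d₂ d₁ d₄
    s₁₃ : Split d₁ d₃ d₄ d₂
    s₄₂ : Split d₄ d₂ d₁ d₃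

  split : ∀ c c′ → c ≢ c′ → ∃₂ λ a b → ∃₂ λ e f → Split a b e f × (c ≡ a × c′ ≡ b ⊎ c ≡ b × c′ ≡ a)
  split d₁ d₁ c≢c = ⊥-elim (c≢c refl)
  split d₁ d₂ _ = _ , _ , _ , _ , s₁₂ , inj₁ (refl , refl)
  split d₁ d₃ _ = _ , _ , _ , _ , s₁₃ , inj₁ (refl , refl)
  split d₁ d₄ _ = _ , _ , _ , _ , s₁₄ , inj₁ (refl , refl)
  split d₂ d₁ _ = _ , _ , _ , _ , s₁₂ , inj₂ (refl , refl)
  split d₂ d₂ c≢c = ⊥-elim (c≢c refl)
  split d₂ d₃ _ = _ , _ , _ , _ , s₃₂ , inj₂ (refl , refl)
  split d₂ d₄ _ = _ , _ , _ , _ , s₄₂ , inj₂ (refl , refl)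
  split d₃ d₁ _ = _ , _ , _ , _ , s₁₃ , inj₂ (refl , refl)
  split d₃ d₂ _ = _ , _ , _ , _ , s₃₂ , inj₁ (refl , refl)
  split d₃ d₃ c≢c = ⊥-elim (c≢c refl)
  split d₃ d₄ _ = _ , _ , _ , _ , s₃₄ , inj₁ (refl , refl)
  split d₄ d₁ _ = _ , _ , _ , _ , s₁₄ , inj₂ (refl , refl)
  split d₄ d₂ _ = _ , _ , _ , _ , s₄₂ , inj₁ (refl , refl)
  split d₄ d₃ _ = _ , _ , _ , _ , s₃₄ , inj₂ (refl , refl)
  split d₄ d₄ c≢c = ⊥-elim (c≢c refl)

  split-covers : ∀ {a b e f} → Split a b e f → ∀ d → (d ≡ a ⊎ d ≡ b) ⊎ (d ≡ e ⊎ d ≡ f)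
  split-covers s₁₂ = λ { d₁ → inj₁ (inj₁ refl) ; d₂ → inj₁ (inj₂ refl) ; d₃ → inj₂ (inj₁ refl) ; d₄ → inj₂ (inj₂ refl) }
  split-covers s₃₄ = λ { d₁ → inj₂ (inj₁ refl) ; d₂ → inj₂ (inj₂ refl) ; d₃ → inj₁ (inj₁ refl) ; d₄ → inj₁ (inj₂ refl) }
  split-covers s₁₄ = λ { d₁ → inj₁ (inj₁ refl) ; d₂ → inj₂ (inj₂ refl) ; d₃ → inj₂ (inj₁ refl) ; d₄ → inj₁ (inj₂ refl) }
  split-covers s₃₂ = λ { d₁ → inj₂ (inj₁ refl) ; d₂ → inj₁ (inj₂ refl) ; d₃ → inj₁ (inj₁ refl) ; d₄ → inj₂ (inj₂ refl) }
  split-covers s₁₃ = λ { d₁ → inj₁ (inj₁ refl) ; d₂ → inj₂ (inj₂ refl) ; d₃ → inj₁ (inj₂ refl) ; d₄ → inj₂ (inj₁ refl) }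
  split-covers s₄₂ = λ { d₁ → inj₂ (inj₁ refl) ; d₂ → inj₁ (inj₂ refl) ; d₃ → inj₂ (inj₂ refl) ; d₄ → inj₁ (inj₁ refl) }

  direction : ∀ {p q u} → Move p q u → Dir
  direction (move _ d _) = d

  unit-axis₁ : ∀ {ε} → Unit ε → 𝟎 ~ (ε , 0ℤ)
  unit-axis₁ (inj₁ refl) = east
  unit-axis₁ (inj₂ refl) = west

  unit-axis₂ : ∀ {ε} → Unit ε → 𝟎 ~ (0ℤ , ε)
  unit-axis₂ (inj₁ refl) = north
  unit-axis₂ (inj₂ refl) = south

  step₁ : ∀ {p q u} (mv : Move p q u) {a} v → direction mv ≡ a → Step (vec p q a) v u
  step₁ {p} {q} (move ε d unit) v refl = (ε , 0ℤ) , unit-axis₁ unit , cong₂ _,_ (sym (+-identityʳ _)) (sym (+-identityʳ _))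

  step₂ : ∀ {p q u} (mv : Move p q u) {b} v → direction mv ≡ b → Step v (vec p q b) u
  step₂ {p} {q} (move ε d unit) v refl = (0ℤ , ε) , unit-axis₂ unit , cong₂ _,_ (sym (+-identityˡ _)) (sym (+-identityˡ _))

  step-of : ∀ {p q u a b} (mv : Move p q u) → direction mv ≡ a ⊎ direction mv ≡ b → Step (vec p q a) (vec p q b) u
  step-of mv (inj₁ eq) = step₁ mv _ eq
  step-of mv (inj₂ eq) = step₂ mv _ eq

  constant-or-not : ∀ {k} (g : Fin (suc k) → Dir) → (∀ i → g i ≡ g zero) ⊎ ∃ λ i → g i ≢ g zero
  constant-or-not g with Fin.any? (λ i → ¬? (g i ≟ᵈ g zero))
  ... | yes found = inj₂ found
  ... | no none = inj₁ λ i → decidable-stable (g i ≟ᵈ g zero) λ neq → none (i , neq)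

  module _ {k n} {A B : Fin (suc k) → Pt} (F : Frame n A B) where

    -- A straight walk has coordinates with second vector `𝟎`. Its distinct points are at least 2
    -- apart in `π`, so the pigeonhole count applies with a single class, N = 1.
    line-bound : ∀ {u} → Coordinates u 𝟎 A → (π : Pt → ℤ) → (∀ P Q → π (P ⊕ Q) ≡ π P + π Q) → (∀ t P → π (t • P) ≡ t * π P) →
      (∀ i j → π (A i) - π (A j) ≤ + n) → 2 ℕ.≤ ∣ π u ∣ → + (2 ℕ.* suc k) ≤ + n + + 2
    line-bound {u} co π π-⊕ π-• room 2≤ = conclude (wide 1 (λ _ → zero) (π ∘ A) λ i j _ → separated i j)
      where
      open Coordinates co
      conclude : Wide 1 (π ∘ A) → + (2 ℕ.* suc k) ≤ + n + + 2
      conclude (i , j , le) = ≤-trans le (+-monoˡ-≤ (+ 2) (room i j))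
      α : Fin (suc k) → ℤ
      α i = proj₁ (W i)
      located′ : ∀ i → A i ≡ A zero ⊕ α i • u
      located′ i = trans (located i) (cong (A zero ⊕_) (trans (cong (α i • u ⊕_) (•𝟎 (proj₂ (W i)))) (⊕-identityʳ (α i • u))))
        where
        •𝟎 : ∀ t → t • 𝟎 ≡ 𝟎
        •𝟎 t = cong₂ _,_ (*-zeroʳ t) (*-zeroʳ t)
      π-located : ∀ i → π (A i) ≡ π (A zero) + α i * π u
      π-located i = trans (cong π (located′ i)) (trans (π-⊕ (A zero) (α i • u)) (cong (λ z → π (A zero) + z) (π-• (α i) u)))
      growth : ∀ i j → π (A i) - π (A j) ≡ (α i - α j) * π u
      growth i j = trans (cong₂ _-_ (π-located i) (π-located j)) (e (π (A zero)) (α i) (α j) (π u))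
        where e : ∀ a x y s → a + x * s - (a + y * s) ≡ (x - y) * s
              e = solve-∀
      small : ∀ t s → 2 ℕ.≤ ∣ s ∣ → t * s < + 2 → - (t * s) < + 2 → t ≡ 0ℤ
      small t s 2≤s lt gt with t ≟ 0ℤ
      ... | yes t≡0 = t≡0
      ... | no t≢0 = ⊥-elim (ℕ.<⇒≱ (∣∣<2 (t * s) lt gt) (ℕ.≤-trans 2≤s (subst (∣ s ∣ ℕ.≤_) (sym (∣i*j∣≡∣i∣*∣j∣ t s))
              (ℕ.m≤n*m ∣ s ∣ ∣ t ∣ {{ℕ.≢-nonZero λ eq → t≢0 (∣i∣≡0⇒i≡0 eq)}}))))
        where
        ∣∣<2 : ∀ i → i < + 2 → - i < + 2 → ∣ i ∣ ℕ.< 2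
        ∣∣<2 (+ n) (+<+ lt) _ = lt
        ∣∣<2 -[1+ n ] _ (+<+ lt) = lt
      separated : ∀ i j → π (A i) - π (A j) < + 2 → π (A j) - π (A i) < + 2 → i ≡ j
      separated i j lt gt = proj₁ (distinct F i zero j zero (cong (_⊕ B zero) A≡))
        where
        flip : ∀ a b → b - a ≡ - (a - b)
        flip = solve-∀
        same : α i - α j ≡ 0ℤ
        same = small (α i - α j) (π u) 2≤ (subst (_< + 2) (growth i j) lt)
          (subst (_< + 2) (trans (flip (π (A i)) (π (A j))) (cong -_ (growth i j))) gt)
        A≡ : A i ≡ A j
        A≡ = trans (located′ i) (trans (cong (λ a → A zero ⊕ a • u) (i-j≡0⇒i≡j (α i) (α j) same)) (sym (located′ j)))

    -- The coordinate to project on is the one in which the direction has the entry `q` up to sign: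
    -- in the application `q` is the longer side, while `p` may be 1.
    straight-bound : ∀ {p q : ℕ} → 2 ℕ.≤ q → ∀ d → (∀ i → Step (vec (+ p) (+ q) d) 𝟎 (A (suc i) ⊖ A (inject₁ i))) → + (2 ℕ.* suc k) ≤ + n + + 2
    straight-bound {p} {q} 2≤q d steps = bound d (coordinates _ 𝟎 A steps)
      where
      cancel : ∀ a b c → a + c - (b + c) ≡ a - b
      cancel = solve-∀
      room₁′ : ∀ i j → proj₁ (A i) - proj₁ (A j) ≤ + n
      room₁′ i j = subst (_≤ + n) (cancel (proj₁ (A i)) (proj₁ (A j)) (proj₁ (B zero))) (room₁ F i zero j zero)
      room₂′ : ∀ i j → proj₂ (A i) - proj₂ (A j) ≤ + n
      room₂′ i j = subst (_≤ + n) (cancel (proj₂ (A i)) (proj₂ (A j)) (proj₂ (B zero))) (room₂ F i zero j zero)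
      bound : ∀ d → Coordinates (vec (+ p) (+ q) d) 𝟎 A → + (2 ℕ.* suc k) ≤ + n + + 2
      bound d₁ co = line-bound co proj₂ (λ _ _ → refl) (λ _ _ → refl) room₂′ 2≤q
      bound d₂ co = line-bound co proj₂ (λ _ _ → refl) (λ _ _ → refl) room₂′ (subst (2 ℕ.≤_) (sym (∣-i∣≡∣i∣ (+ q))) 2≤q)
      bound d₃ co = line-bound co proj₁ (λ _ _ → refl) (λ _ _ → refl) room₁′ 2≤q
      bound d₄ co = line-bound co proj₁ (λ _ _ → refl) (λ _ _ → refl) room₁′ 2≤q

    -- Otherwise the image of a unit square of the grid would be degenerate.
    directions-differ : ∀ {p q} i j (mv : Move p q (A (suc i) ⊖ A (inject₁ i))) (mv′ : Move p q (B (suc j) ⊖ B (inject₁ j))) →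
      direction mv ≢ direction mv′
    directions-differ {p} {q} i j mv mv′ same = [ parallel , antiparallel ]′ (compare mv mv′ same)
      where
      compare : ∀ {u v} (mv : Move p q u) (mv′ : Move p q v) → direction mv ≡ direction mv′ → u ≡ v ⊎ u ⊕ v ≡ 𝟎
      compare (move ε d (inj₁ refl)) (move ε′ d (inj₁ refl)) refl = inj₁ refl
      compare (move ε d (inj₂ refl)) (move ε′ d (inj₂ refl)) refl = inj₁ refl
      compare (move ε d (inj₁ refl)) (move ε′ d (inj₂ refl)) refl = inj₂ (cong₂ _,_ (e (proj₁ (vec p q d))) (e (proj₂ (vec p q d))))
        where e : ∀ a → 1ℤ * a + -1ℤ * a ≡ 0ℤ
              e = solve-∀
      compare (move ε d (inj₂ refl)) (move ε′ d (inj₁ refl)) refl = inj₂ (cong₂ _,_ (e (proj₁ (vec p q d))) (e (proj₂ (vec p q d))))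
        where e : ∀ a → -1ℤ * a + 1ℤ * a ≡ 0ℤ
              e = solve-∀
      parallel : A (suc i) ⊖ A (inject₁ i) ≢ B (suc j) ⊖ B (inject₁ j)
      parallel eq = suc≢inject₁ i (proj₁ (distinct F (suc i) (inject₁ j) (inject₁ i) (suc j) (cross (A (suc i)) (A (inject₁ i)) (B (suc j)) (B (inject₁ j)) eq)))
        where
        cross : ∀ a b c d → a ⊖ b ≡ c ⊖ d → a ⊕ d ≡ b ⊕ c
        cross (a , a′) (b , b′) (c , c′) (d , d′) eq = cong₂ _,_ (one a b c d (cong proj₁ eq)) (one a′ b′ c′ d′ (cong proj₂ eq))
          where
          one : ∀ a b c d → a - b ≡ c - d → a + d ≡ b + c
          one a b c d eq = trans (i₁ a b d) (trans (cong (λ z → z + b + d) eq) (i₂ b c d))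
            where
            i₁ : ∀ a b d → a + d ≡ a - b + b + d
            i₁ = solve-∀
            i₂ : ∀ b c d → c - d + b + d ≡ b + c
            i₂ = solve-∀
      antiparallel : (A (suc i) ⊖ A (inject₁ i)) ⊕ (B (suc j) ⊖ B (inject₁ j)) ≢ 𝟎
      antiparallel eq = suc≢inject₁ i (proj₁ (distinct F (suc i) (suc j) (inject₁ i) (inject₁ j) (cross (A (suc i)) (A (inject₁ i)) (B (suc j)) (B (inject₁ j)) eq)))
        where
        cross : ∀ a b c d → (a ⊖ b) ⊕ (c ⊖ d) ≡ 𝟎 → a ⊕ c ≡ b ⊕ d
        cross (a , a′) (b , b′) (c , c′) (d , d′) eq = cong₂ _,_ (one a b c d (cong proj₁ eq)) (one a′ b′ c′ d′ (cong proj₂ eq))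
          where
          one : ∀ a b c d → a - b + (c - d) ≡ 0ℤ → a + c ≡ b + d
          one a b c d eq = i-j≡0⇒i≡j (a + c) (b + d) (trans (i₁ a b c d) eq)
            where
            i₁ : ∀ a b c d → a + c - (b + d) ≡ a - b + (c - d)
            i₁ = solve-∀

  module _ {p Q : ℕ} .{{_ : NonZero p}} .{{_ : NonZero Q}} {x y : ℤ} where

    private
      P = p ℕ.+ Q
      q = P ℕ.+ Q

    -- A common bound for the three possible values of N, and for N = 1 of the straight case.
    -- Writing q = p + 2 Q and P = p + Q makes both half-sum and half-difference natural numbers.
    slack : ℕ
    slack = suc (p ℕ.* q ℕ.+ (P ℕ.* P ℕ.+ Q ℕ.* Q ℕ.+ 2 ℕ.* (P ℕ.* Q)))

    module _ (bezout : x * + P + y * + Q ≡ 1ℤ) where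

      private
        p≡ : + p ≡ + P - + Q
        p≡ = e (+ p) (+ Q)
          where e : ∀ p Q → p ≡ p + Q - Q
                e = solve-∀
        q≡ : + q ≡ + P + + Q
        q≡ = refl
        q≡′ : + q ≡ + P - - + Q
        q≡′ = cong (λ z → + P + z) (sym (neg-involutive (+ Q)))
        bezout′ : x * + P + - y * - + Q ≡ 1ℤ
        bezout′ = trans (e x (+ P) y (+ Q)) bezout
          where e : ∀ x P y Q → x * P + - y * - Q ≡ x * P + y * Q
                e = solve-∀
        P*P+Q*Q : + (P ℕ.* P ℕ.+ Q ℕ.* Q) ≡ + P * + P + + Q * + Q
        P*P+Q*Q = cong₂ _+_ (pos-* P P) (pos-* Q Q)
        2PQ : + (2 ℕ.* (P ℕ.* Q)) ≡ + 2 * (+ P * + Q)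
        2PQ = trans (pos-* 2 (P ℕ.* Q)) (cong (+ 2 *_) (pos-* P Q))
        instance
          P≢0 : NonZero P
          P≢0 = ℕ.≢-nonZero λ eq → ℕ.≢-nonZero⁻¹ p (ℕ.m+n≡0⇒m≡0 p eq)
          q≢0 : NonZero q
          q≢0 = ℕ.≢-nonZero λ eq → ℕ.≢-nonZero⁻¹ Q (ℕ.m+n≡0⇒n≡0 P eq)

      SidesFor : Dir → Dir → Dir → Dir → Set
      SidesFor a b e f = ∃ λ N → N ℕ.> 0 × N ℕ.≤ slack × Side (vec (+ p) (+ q) a) (vec (+ p) (+ q) b) N × Side (vec (+ p) (+ q) e) (vec (+ p) (+ q) f) N

      -- Exchanging p and q replaces Q by - Q.
      sides-product : SidesFor d₁ d₂ d₃ d₄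
      sides-product = p ℕ.* q , 0<pq , ℕ.m≤n⇒m≤1+n (ℕ.m≤m+n _ _) ,
        side-product {+ P} {+ Q} {x} {y} bezout p≡ q≡ (p ℕ.* q) (pos-* p q) (+<+ 0<pq) ,
        side-product {+ P} { - + Q} {x} { - y} bezout′ q≡′ p≡ (p ℕ.* q) (trans (pos-* p q) (*-comm (+ p) (+ q))) (+<+ 0<pq)
        where 0<pq = ℕ.>-nonZero⁻¹ (p ℕ.* q) {{ℕ.m*n≢0 p q}}

      sides-norm : SidesFor d₁ d₄ d₃ d₂
      sides-norm = N , 0<N , ℕ.m≤n⇒m≤1+n (ℕ.≤-trans (ℕ.m≤m+n N _) (ℕ.m≤n+m _ (p ℕ.* q))) ,
        side-norm {+ P} {+ Q} {x} {y} bezout p≡ q≡ N P*P+Q*Q (+<+ 0<N) ,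
        side-norm {+ P} { - + Q} {x} { - y} bezout′ q≡′ p≡ N (trans P*P+Q*Q (e (+ P) (+ Q))) (+<+ 0<N)
        where
        N = P ℕ.* P ℕ.+ Q ℕ.* Q
        0<N : 0 ℕ.< N
        0<N = ℕ.<-≤-trans (ℕ.>-nonZero⁻¹ (P ℕ.* P) {{ℕ.m*n≢0 P P}}) (ℕ.m≤m+n _ _)
        e : ∀ P Q → P * P + Q * Q ≡ P * P + - Q * - Q
        e = solve-∀

      sides-even : SidesFor d₁ d₃ d₄ d₂
      sides-even = N , 0<N , ℕ.m≤n⇒m≤1+n (ℕ.≤-trans (ℕ.m≤n+m N (P ℕ.* P ℕ.+ Q ℕ.* Q)) (ℕ.m≤n+m _ (p ℕ.* q))) ,
        side-even {+ P} {+ Q} {x} {y} bezout p≡ q≡ N 2PQ (+<+ 0<N) ,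
        side-even′ {+ P} {+ Q} {x} {y} bezout p≡ q≡ N 2PQ (+<+ 0<N)
        where
        N = 2 ℕ.* (P ℕ.* Q)
        0<N : 0 ℕ.< N
        0<N = ℕ.>-nonZero⁻¹ N {{ℕ.m*n≢0 2 (P ℕ.* Q) {{_}} {{ℕ.m*n≢0 P Q}}}}

      exchange : ∀ {a b e f} → SidesFor a b e f → SidesFor e f a b
      exchange (N , 0<N , N≤ , side , side′) = N , 0<N , N≤ , side′ , side

      sides : ∀ {a b e f} → Split a b e f → SidesFor a b e f
      sides s₁₂ = sides-product
      sides s₃₄ = exchange {d₁} {d₂} {d₃} {d₄} sides-product
      sides s₁₄ = sides-norm
      sides s₃₂ = exchange {d₁} {d₄} {d₃} {d₂} sides-norm
      sides s₁₃ = sides-even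
      sides s₄₂ = exchange {d₁} {d₃} {d₄} {d₂} sides-even

      2≤q : 2 ℕ.≤ q
      2≤q = ℕ.+-mono-≤ {1} {P} (ℕ.>-nonZero⁻¹ P) (ℕ.>-nonZero⁻¹ Q)

      relax : ∀ {m n N} → N ℕ.≤ slack → + m ≤ + n + + (2 ℕ.* N) → m ℕ.≤ n ℕ.+ 2 ℕ.* slack
      relax {n = n} N≤ (+≤+ le) = ℕ.≤-trans le (ℕ.+-monoʳ-≤ n (ℕ.*-monoʳ-≤ 2 N≤))

      module _ {k n} {A B : Fin (suc (suc k)) → Pt} (F : Frame n A B)
               (move-A : ∀ i → Move (+ p) (+ q) (A (suc i) ⊖ A (inject₁ i)))
               (move-B : ∀ j → Move (+ p) (+ q) (B (suc j) ⊖ B (inject₁ j))) where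

        private
          α β : Fin (suc k) → Dir
          α i = direction (move-A i)
          β j = direction (move-B j)

        -- Two directions of the first walk leave at most two for the second. As the second walk
        -- uses two, it uses both of them, and this in turn confines the first walk to its own two.
        two-directions-bound : ∀ i j → α i ≢ α zero → β j ≢ β zero → 2 ℕ.* suc (suc k) ℕ.≤ n ℕ.+ 2 ℕ.* slack
        two-directions-bound i j αi≢α0 βj≢β0 with split (α i) (α zero) αi≢α0
        ... | a , b , e , f , s , attained = bound (sides s)
          where
          disjoint′ : ∀ {d} → α i ≡ a × α zero ≡ b ⊎ α i ≡ b × α zero ≡ a → d ≡ a ⊎ d ≡ b → ∀ j → β j ≢ d
          disjoint′ (inj₁ (i≡a , _)) (inj₁ d≡a) j eq = directions-differ F i j (move-A i) (move-B j) (trans i≡a (trans (sym d≡a) (sym eq)))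
          disjoint′ (inj₁ (_ , 0≡b)) (inj₂ d≡b) j eq = directions-differ F zero j (move-A zero) (move-B j) (trans 0≡b (trans (sym d≡b) (sym eq)))
          disjoint′ (inj₂ (_ , 0≡a)) (inj₁ d≡a) j eq = directions-differ F zero j (move-A zero) (move-B j) (trans 0≡a (trans (sym d≡a) (sym eq)))
          disjoint′ (inj₂ (i≡b , _)) (inj₂ d≡b) j eq = directions-differ F i j (move-A i) (move-B j) (trans i≡b (trans (sym d≡b) (sym eq)))
          disjoint : ∀ {d} → d ≡ a ⊎ d ≡ b → ∀ j → β j ≢ d
          disjoint = disjoint′ attained
          β∈ : ∀ j → β j ≡ e ⊎ β j ≡ f
          β∈ j = [ (λ d∈ → ⊥-elim (disjoint d∈ j refl)) , id ]′ (split-covers s (β j))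
          β-attains : ∀ d → d ≡ e ⊎ d ≡ f → ∃ λ j → β j ≡ d
          β-attains d d∈ with d∈ | β∈ j | β∈ zero
          ... | inj₁ refl | inj₁ eq | _ = j , eq
          ... | inj₁ refl | inj₂ _ | inj₁ eq = zero , eq
          ... | inj₁ refl | inj₂ eq | inj₂ eq′ = ⊥-elim (βj≢β0 (trans eq (sym eq′)))
          ... | inj₂ refl | inj₂ eq | _ = j , eq
          ... | inj₂ refl | inj₁ _ | inj₂ eq = zero , eq
          ... | inj₂ refl | inj₁ eq | inj₁ eq′ = ⊥-elim (βj≢β0 (trans eq (sym eq′)))
          α∈ : ∀ i → α i ≡ a ⊎ α i ≡ b
          α∈ i = [ id , (λ d∈ → let j , eq = β-attains (α i) d∈ in ⊥-elim (directions-differ F i j (move-A i) (move-B j) (sym eq))) ]′ (split-covers s (α i))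
          bound : SidesFor a b e f → 2 ℕ.* suc (suc k) ℕ.≤ n ℕ.+ 2 ℕ.* slack
          bound (N , 0<N , N≤ , side , side′) = relax {n = n} N≤ (frame-bound {N = N} {{ℕ.>-nonZero 0<N}} F
            side (coordinates _ _ A (λ i → step-of (move-A i) (α∈ i)))
            side′ (coordinates _ _ B (λ j → step-of (move-B j) (β∈ j))))

        moves-bound : 2 ℕ.* suc (suc k) ℕ.≤ n ℕ.+ 2 ℕ.* slack
        moves-bound with constant-or-not α | constant-or-not β
        ... | inj₁ const | _ = relax {n = n} (ℕ.s≤s ℕ.z≤n) (straight-bound F {p} {q} 2≤q (α zero) (λ i → step₁ (move-A i) 𝟎 (const i)))
        ... | inj₂ _ | inj₁ const = relax {n = n} (ℕ.s≤s ℕ.z≤n) (straight-bound (frame-swap F) {p} {q} 2≤q (β zero) (λ j → step₁ (move-B j) 𝟎 (const j)))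
        ... | inj₂ (i , αi≢α0) | inj₂ (j , βj≢β0) = two-directions-bound i j αi≢α0 βj≢β0

      upper-bound : ∀ {m n} → GridEmbedsInLeaper p q m n → 2 ℕ.* m ℕ.≤ n ℕ.+ 2 ℕ.* slack
      upper-bound {zero} _ = ℕ.z≤n
      -- A single cell has no step to read a direction from; 2 ≤ 2 `slack` holds by the leading
      -- `suc` of `slack`.
      upper-bound {suc zero} {n} _ = ℕ.≤-trans (ℕ.*-monoʳ-≤ 2 {1} {slack} (ℕ.s≤s ℕ.z≤n)) (ℕ.m≤n+m _ n)
      upper-bound {suc (suc k)} (f , f-injective , f-adjacent) = moves-bound (frame f f-injective f-adjacent)
        (rows-move f f-injective f-adjacent) (columns-move f f-injective f-adjacent)

-- The snake construction for the lower bound.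

module Snakes where

  open import Data.Integer.Base hiding (_⊖_; suc; NonZero)
  open import Data.Integer.Properties
  open import Data.Integer.Tactic.RingSolver using (solve-∀)
  open Counting using (<2⇒; small-double)
  open Lattices using (coprime-multiple)
  open Rhombi using (Unit)

  parity : ℕ → ℕ
  parity zero = 0
  parity (suc zero) = 1
  parity (suc (suc n)) = parity n

  parity<2 : ∀ n → parity n ℕ.< 2
  parity<2 zero = ℕ.s≤s ℕ.z≤n
  parity<2 (suc zero) = ℕ.s≤s (ℕ.s≤s ℕ.z≤n)
  parity<2 (suc (suc n)) = parity<2 n

  rightward : ℕ → Bool
  rightward zero = true
  rightward (suc k) = not (rightward k)

  Adjacent : ℕ → ℕ → Set
  Adjacent a b = b ≡ suc a ⊎ a ≡ suc b

  parity-adjacent : ∀ n → Adjacent (parity n) (parity (suc n))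
  parity-adjacent zero = inj₁ refl
  parity-adjacent (suc zero) = inj₂ refl
  parity-adjacent (suc (suc n)) = parity-adjacent n

  parity-double : ∀ r → parity (suc (r ℕ.+ r)) ≡ 1
  parity-double zero = refl
  parity-double (suc r) rewrite ℕ.+-suc r r = parity-double r

  digits-unique : ∀ k k′ {b b′} → b ℕ.< 2 → b′ ℕ.< 2 → k ℕ.+ k ℕ.+ b ≡ k′ ℕ.+ k′ ℕ.+ b′ → k ≡ k′ × b ≡ b′
  digits-unique zero zero _ _ eq = refl , eq
  digits-unique zero (suc k′) {b} {b′} b<2 _ eq = ⊥-elim (ℕ.<⇒≱ b<2 (subst (2 ℕ.≤_) (sym eq) (ℕ.s≤s (subst (1 ℕ.≤_) (cong (ℕ._+ b′) (sym (ℕ.+-suc k′ k′))) (ℕ.s≤s ℕ.z≤n)))))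
  digits-unique (suc k) zero {b} _ b′<2 eq = ⊥-elim (ℕ.<⇒≱ b′<2 (subst (2 ℕ.≤_) eq (ℕ.s≤s (subst (1 ℕ.≤_) (cong (ℕ._+ b) (sym (ℕ.+-suc k k))) (ℕ.s≤s ℕ.z≤n)))))
  digits-unique (suc k) (suc k′) {b} {b′} b<2 b′<2 eq with digits-unique k k′ b<2 b′<2
    (ℕ.suc-injective (subst₂ _≡_ (cong (ℕ._+ b) (ℕ.+-suc k k)) (cong (ℕ._+ b′) (ℕ.+-suc k′ k′)) (ℕ.suc-injective eq)))
  ... | refl , eq′ = refl , eq′

  -- A boustrophedon of zigzags: pass k consists of R = 2r + 2 diagonal unit steps through the heights 2k and 2k + 1.
  module Snake (r : ℕ) where

    R : ℕ
    R = suc (suc (r ℕ.+ r))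

    next : ℕ × ℕ → ℕ × ℕ
    next (k , ρ) with suc ρ ℕ.<? R
    ... | yes _ = k , suc ρ
    ... | no _ = suc k , 0

    state : ℕ → ℕ × ℕ
    state zero = 0 , 0
    state (suc i) = next (state i)

    -- Since `R` is even, a pass ends at its upper height. A leftward pass uses R - ρ and not R - 1
    -- - ρ, so that the step between two passes is diagonal as well.
    across height : ℕ × ℕ → ℕ
    across (k , ρ) = if rightward k then ρ else R ℕ.∸ ρ
    height (k , ρ) = k ℕ.+ k ℕ.+ parity ρ

    s t : ℕ → ℕ
    s i = across (state i)
    t i = height (state i)

    Consistent : ℕ → ℕ × ℕ → Set
    Consistent i (k , ρ) = i ≡ k ℕ.* R ℕ.+ ρ × ρ ℕ.< R

    next-consistent : ∀ i σ → Consistent i σ → Consistent (suc i) (next σ)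
    next-consistent i (k , ρ) (refl , ρ<R) with suc ρ ℕ.<? R
    ... | yes lt = sym (ℕ.+-suc (k ℕ.* R) ρ) , lt
    ... | no ≮R = trans (sym (ℕ.+-suc (k ℕ.* R) ρ)) (trans (cong (k ℕ.* R ℕ.+_) (ℕ.≤-antisym ρ<R (ℕ.≮⇒≥ ≮R)))
            (trans (ℕ.+-comm (k ℕ.* R) R) (sym (ℕ.+-identityʳ _)))) , ℕ.s≤s ℕ.z≤n

    consistent : ∀ i → Consistent i (state i)
    consistent zero = refl , ℕ.s≤s ℕ.z≤n
    consistent (suc i) = next-consistent i (state i) (consistent i)

    next-adjacent : ∀ σ → proj₂ σ ℕ.< R → Adjacent (across σ) (across (next σ)) × Adjacent (height σ) (height (next σ))
    next-adjacent (k , ρ) ρ<R with suc ρ ℕ.<? R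
    ... | yes lt = horizontal (rightward k) , vertical (parity-adjacent ρ)
      where
      horizontal : ∀ b → Adjacent (if b then ρ else R ℕ.∸ ρ) (if b then suc ρ else R ℕ.∸ suc ρ)
      horizontal true = inj₁ refl
      horizontal false = inj₂ (ℕ.+-∸-assoc 1 ρ<R)
      vertical : Adjacent (parity ρ) (parity (suc ρ)) → Adjacent (k ℕ.+ k ℕ.+ parity ρ) (k ℕ.+ k ℕ.+ parity (suc ρ))
      vertical (inj₁ eq) = inj₁ (trans (cong (k ℕ.+ k ℕ.+_) eq) (ℕ.+-suc (k ℕ.+ k) _))
      vertical (inj₂ eq) = inj₂ (trans (cong (k ℕ.+ k ℕ.+_) eq) (ℕ.+-suc (k ℕ.+ k) _))
    ... | no ≮R rewrite ℕ.suc-injective (ℕ.≤-antisym ρ<R (ℕ.≮⇒≥ ≮R)) = horizontal (rightward k) , inj₁ vertical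
      where
      horizontal : ∀ b → Adjacent (if b then suc (r ℕ.+ r) else R ℕ.∸ suc (r ℕ.+ r)) (if not b then 0 else R)
      horizontal true = inj₁ refl
      horizontal false = inj₂ (ℕ.m+n∸n≡m 1 (suc (r ℕ.+ r)))
      vertical : suc k ℕ.+ suc k ℕ.+ 0 ≡ suc (k ℕ.+ k ℕ.+ parity (suc (r ℕ.+ r)))
      vertical rewrite parity-double r = e k
        where e : ∀ k → suc k ℕ.+ suc k ℕ.+ 0 ≡ suc (k ℕ.+ k ℕ.+ 1)
              e = ℕ-Solver.solve-∀

    walk : ∀ i → Adjacent (s i) (s (suc i)) × Adjacent (t i) (t (suc i))
    walk i = next-adjacent (state i) (proj₂ (consistent i))

    s≤R : ∀ i → s i ℕ.≤ R
    s≤R i = bounded (rightward (proj₁ (state i))) (ℕ.<⇒≤ (proj₂ (consistent i)))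
      where
      bounded : ∀ b {ρ} → ρ ℕ.≤ R → (if b then ρ else R ℕ.∸ ρ) ℕ.≤ R
      bounded true ρ≤R = ρ≤R
      bounded false {ρ} _ = ℕ.m∸n≤m R ρ

    t<2P : ∀ {P} i → i ℕ.< P ℕ.* R → t i ℕ.< P ℕ.+ P
    t<2P {P} i i<PR = ℕ.<-≤-trans (ℕ.+-monoʳ-< (k ℕ.+ k) (parity<2 ρ)) (subst (ℕ._≤ P ℕ.+ P) (e k) (ℕ.+-mono-≤ k<P k<P))
      where
      k = proj₁ (state i)
      ρ = proj₂ (state i)
      k<P : k ℕ.< P
      k<P = ℕ.*-cancelʳ-< R k P (ℕ.≤-<-trans (subst (k ℕ.* R ℕ.≤_) (sym (proj₁ (consistent i))) (ℕ.m≤m+n _ ρ)) i<PR)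
      e : ∀ k → suc k ℕ.+ suc k ≡ k ℕ.+ k ℕ.+ 2
      e = ℕ-Solver.solve-∀

    injective : ∀ i j → s i ≡ s j → t i ≡ t j → i ≡ j
    injective i j s≡ t≡ with digits-unique (proj₁ (state i)) (proj₁ (state j)) (parity<2 (proj₂ (state i))) (parity<2 (proj₂ (state j))) t≡
    ... | k≡ , _ = trans (proj₁ (consistent i)) (trans (cong₂ (λ k ρ → k ℕ.* R ℕ.+ ρ) k≡ ρ≡) (sym (proj₁ (consistent j))))
      where
      recover : ∀ b {ρ ρ′} → ρ ℕ.< R → ρ′ ℕ.< R → (if b then ρ else R ℕ.∸ ρ) ≡ (if b then ρ′ else R ℕ.∸ ρ′) → ρ ≡ ρ′
      recover true _ _ eq = eq
      recover false lt lt′ eq = ℕ.∸-cancelˡ-≡ (ℕ.<⇒≤ lt) (ℕ.<⇒≤ lt′) eq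
      ρ≡ : proj₂ (state i) ≡ proj₂ (state j)
      ρ≡ = recover (rightward (proj₁ (state j))) (proj₂ (consistent i)) (proj₂ (consistent j))
        (subst (λ k → (if rightward k then proj₂ (state i) else R ℕ.∸ proj₂ (state i)) ≡ s j) k≡ s≡)

    -- The snake starts at the origin and each step changes both coordinates by ±1.
    even : ∀ i → ∃ λ h → + s i + + t i ≡ + 2 * h
    even zero = 0ℤ , refl
    even (suc i) = let h , eq = even i ; a , b = walk i in step h (+ s i) (+ t i) eq (differ a) (differ b)
      where
      differ : ∀ {a b} → Adjacent a b → ∃ λ c → + b ≡ + a + 1ℤ + + 2 * c
      differ {a} {b} (inj₁ refl) = 0ℤ , e (+ a)
        where e : ∀ a → 1ℤ + a ≡ a + 1ℤ + + 2 * 0ℤ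
              e = solve-∀
      differ {a} {b} (inj₂ refl) = -1ℤ , e (+ b)
        where e : ∀ b → b ≡ 1ℤ + b + 1ℤ + + 2 * -1ℤ
              e = solve-∀
      step : ∀ h s t {s′ t′} → s + t ≡ + 2 * h → (∃ λ c → s′ ≡ s + 1ℤ + + 2 * c) → (∃ λ c → t′ ≡ t + 1ℤ + + 2 * c) → ∃ λ h → s′ + t′ ≡ + 2 * h
      step h s t eq (c , refl) (d , refl) = h + 1ℤ + c + d , trans (e₁ s t c d) (trans (cong (λ z → z + + 2 * (1ℤ + c + d)) eq) (e₂ h c d))
        where
        e₁ : ∀ s t c d → (s + 1ℤ + + 2 * c) + (t + 1ℤ + + 2 * d) ≡ (s + t) + + 2 * (1ℤ + c + d)
        e₁ = solve-∀
        e₂ : ∀ h c d → + 2 * h + + 2 * (1ℤ + c + d) ≡ + 2 * (h + 1ℤ + c + d)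
        e₂ = solve-∀

  distance : ∀ a b → ℕ.∣ a - b ∣ ≡ ∣ + b - + a ∣
  distance zero b = cong ∣_∣ (sym (+-identityʳ (+ b)))
  distance (suc a) zero = refl
  distance (suc a) (suc b) = trans (distance a b) (cong ∣_∣ (e (+ a) (+ b)))
    where e : ∀ a b → b - a ≡ (1ℤ + b) - (1ℤ + a)
          e = solve-∀

  unit-distance : ∀ a b → ℕ.∣ a - b ∣ ≡ 1 → Adjacent a b
  unit-distance zero b refl = inj₁ refl
  unit-distance (suc zero) zero refl = inj₂ refl
  unit-distance (suc a) (suc b) eq = [ (λ e → inj₁ (cong suc e)) , (λ e → inj₂ (cong suc e)) ]′ (unit-distance a b eq)

  sum-of-squares-1 : ∀ a b → a ℕ.* a ℕ.+ b ℕ.* b ≡ 1 → (a ≡ 1 × b ≡ 0) ⊎ (a ≡ 0 × b ≡ 1)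
  sum-of-squares-1 zero (suc zero) eq = inj₂ (refl , refl)
  sum-of-squares-1 zero (suc (suc b)) ()
  sum-of-squares-1 (suc zero) zero eq = inj₁ (refl , refl)
  sum-of-squares-1 (suc zero) (suc b) ()
  sum-of-squares-1 (suc (suc a)) b ()

  module _ {p Q : ℕ} .{{_ : NonZero p}} {x y : ℤ} (bezout : x * + (p ℕ.+ Q) + y * + Q ≡ 1ℤ)
           {g : ℤ} (odd : + (p ℕ.+ Q) + + Q ≡ + 2 * g + 1ℤ) (r : ℕ) where
    open Snake r

    private
      P = p ℕ.+ Q
      q = P ℕ.+ Q
      instance
        P≢0 : NonZero P
        P≢0 = ℕ.≢-nonZero λ eq → ℕ.≢-nonZero⁻¹ p (ℕ.m+n≡0⇒m≡0 p eq)

    -- The snake has `P` passes of `R` points, so its heights stay below 2P, the bound that `narrow`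
    -- requires. `span` bounds P σ + Q τ.
    size span : ℕ
    size = P ℕ.* R
    span = P ℕ.* R ℕ.+ Q ℕ.* (P ℕ.+ P)

    private
      σ τ : Fin size → ℕ
      σ i = s (toℕ i)
      τ i = t (toℕ i)

      σ≤R : ∀ i → σ i ℕ.≤ R
      σ≤R i = s≤R (toℕ i)
      τ<2P : ∀ i → τ i ℕ.< P ℕ.+ P
      τ<2P i = t<2P {P} (toℕ i) (Fin.toℕ<n i)

      -- In the coordinates (x + y) / 2 and (x - y) / 2 the grid point (i , j) goes to (P σᵢ + Q τⱼ , P σⱼ + Q τᵢ);
      -- Y is the coordinate y shifted so as to be nonnegative.
      X Y : Fin size → Fin size → ℕ
      X i j = (P ℕ.* σ i ℕ.+ Q ℕ.* τ j) ℕ.+ (P ℕ.* σ j ℕ.+ Q ℕ.* τ i)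
      Y i j = (P ℕ.* σ i ℕ.+ Q ℕ.* τ j) ℕ.+ (P ℕ.* (R ℕ.∸ σ j) ℕ.+ Q ℕ.* (P ℕ.+ P ℕ.∸ τ i))

      within : ∀ {a b} → a ℕ.≤ R → b ℕ.≤ P ℕ.+ P → P ℕ.* a ℕ.+ Q ℕ.* b ℕ.≤ span
      within a≤ b≤ = ℕ.+-mono-≤ (ℕ.*-monoʳ-≤ P a≤) (ℕ.*-monoʳ-≤ Q b≤)

      X≤ : ∀ i j → X i j ℕ.≤ span ℕ.+ span
      X≤ i j = ℕ.+-mono-≤ (within (σ≤R i) (ℕ.<⇒≤ (τ<2P j))) (within (σ≤R j) (ℕ.<⇒≤ (τ<2P i)))
      Y≤ : ∀ i j → Y i j ℕ.≤ span ℕ.+ span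
      Y≤ i j = ℕ.+-mono-≤ (within (σ≤R i) (ℕ.<⇒≤ (τ<2P j))) (within (ℕ.m∸n≤m R (σ j)) (ℕ.m∸n≤m (P ℕ.+ P) (τ i)))

      +X : ∀ i j → + X i j ≡ (+ P * + σ i + + Q * + τ j) + (+ P * + σ j + + Q * + τ i)
      +X i j = cong₂ _+_ (cong₂ _+_ (pos-* P (σ i)) (pos-* Q (τ j))) (cong₂ _+_ (pos-* P (σ j)) (pos-* Q (τ i)))

      +∸ : ∀ {a b} → b ℕ.≤ a → + (a ℕ.∸ b) ≡ + a - + b
      +∸ {a} {b} b≤a = trans (sym (⊖-≥ b≤a)) (sym (m-n≡m⊖n a b))

      +Y : ∀ i j → + Y i j ≡ (+ P * + σ i + + Q * + τ j) + (+ P * (+ R - + σ j) + + Q * (+ (P ℕ.+ P) - + τ i))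
      +Y i j = cong₂ _+_ (cong₂ _+_ (pos-* P (σ i)) (pos-* Q (τ j)))
        (cong₂ _+_ (trans (pos-* P (R ℕ.∸ σ j)) (cong (+ P *_) (+∸ (σ≤R j))))
                   (trans (pos-* Q (P ℕ.+ P ℕ.∸ τ i)) (cong (+ Q *_) (+∸ (ℕ.<⇒≤ (τ<2P i))))))

    -- As P + Q is odd, adding the two hypotheses shows that κ and λ′ have the same parity, and then the first
    -- one shows that they are even.
    collision : ∀ {κ λ′ h h′} → κ * + Q + λ′ * + P ≡ + 2 * h → κ * + P + λ′ * + Q ≡ + 2 * h′ → ∃ λ w → κ ≡ w + w
    collision {κ} {λ′} {h} {h′} eq eq′ = w , (begin
      κ                                                              ≡⟨ e₁ κ λ′ (+ P) (+ Q) g ⟩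
      κ * (+ 2 * g + 1ℤ) - + 2 * (g * κ)                             ≡⟨ cong (λ z → κ * z - + 2 * (g * κ)) odd ⟨
      κ * (+ P + + Q) - + 2 * (g * κ)                                ≡⟨ e₂ κ λ′ (+ P) (+ Q) g ⟩
      (κ * + Q + λ′ * + P) + κ * + P - (λ′ + κ) * + P + κ * + P - + 2 * (g * κ)  ≡⟨ cong₂ (λ u v → u + κ * + P - v * + P + κ * + P - + 2 * (g * κ)) eq sum-even ⟩
      + 2 * h + κ * + P - (+ 2 * e) * + P + κ * + P - + 2 * (g * κ)   ≡⟨ e₃ κ (+ P) g h e ⟩
      w + w ∎)
      where
      open ≡-Reasoning
      e = h + h′ - g * (λ′ + κ)
      w = h + κ * + P - e * + P - g * κ
      e₁ : ∀ κ l P Q g → κ ≡ κ * (+ 2 * g + 1ℤ) - + 2 * (g * κ)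
      e₁ = solve-∀
      e₂ : ∀ κ l P Q g → κ * (P + Q) - + 2 * (g * κ) ≡ (κ * Q + l * P) + κ * P - (l + κ) * P + κ * P - + 2 * (g * κ)
      e₂ = solve-∀
      e₃ : ∀ κ P g h e → + 2 * h + κ * P - (+ 2 * e) * P + κ * P - + 2 * (g * κ) ≡ (h + κ * P - e * P - g * κ) + (h + κ * P - e * P - g * κ)
      e₃ = solve-∀
      f₁ : ∀ κ l g → l + κ ≡ (l + κ) * (+ 2 * g + 1ℤ) - + 2 * (g * (l + κ))
      f₁ = solve-∀
      f₂ : ∀ κ l P Q g → (l + κ) * (P + Q) - + 2 * (g * (l + κ)) ≡ (κ * Q + l * P) + (κ * P + l * Q) - + 2 * (g * (l + κ))
      f₂ = solve-∀
      f₃ : ∀ κ l g h h′ → + 2 * h + + 2 * h′ - + 2 * (g * (l + κ)) ≡ + 2 * (h + h′ - g * (l + κ))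
      f₃ = solve-∀
      sum-even : λ′ + κ ≡ + 2 * e
      sum-even = begin
        λ′ + κ                                                      ≡⟨ f₁ κ λ′ g ⟩
        (λ′ + κ) * (+ 2 * g + 1ℤ) - + 2 * (g * (λ′ + κ))            ≡⟨ cong (λ z → (λ′ + κ) * z - + 2 * (g * (λ′ + κ))) odd ⟨
        (λ′ + κ) * (+ P + + Q) - + 2 * (g * (λ′ + κ))               ≡⟨ f₂ κ λ′ (+ P) (+ Q) g ⟩
        (κ * + Q + λ′ * + P) + (κ * + P + λ′ * + Q) - + 2 * (g * (λ′ + κ)) ≡⟨ cong₂ (λ u v → u + v - + 2 * (g * (λ′ + κ))) eq eq′ ⟩
        + 2 * h + + 2 * h′ - + 2 * (g * (λ′ + κ))                   ≡⟨ f₃ κ λ′ g h h′ ⟩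
        + 2 * e ∎

    -- An even `κ` makes the difference of two heights a multiple of 2P, while the strip keeps it
    -- below 2P in absolute value. This is what fixes the height of the strip.
    narrow : ∀ κ a b → a ℕ.< P ℕ.+ P → b ℕ.< P ℕ.+ P → + a - + b ≡ κ * + P → (∃ λ w → κ ≡ w + w) → κ ≡ 0ℤ
    narrow κ a b a< b< eq (w , refl) = cong₂ _+_ w≡0 w≡0
      where
      below : ∀ a b → a ℕ.< P ℕ.+ P → + a - + b < + (2 ℕ.* P)
      below a b a< = ≤-<-trans (i-j≤i (+ a) (+ b)) (+<+ (subst (a ℕ.<_) (cong (P ℕ.+_) (sym (ℕ.+-identityʳ P))) a<))
      negate : ∀ a b → b - a ≡ - (a - b)
      negate = solve-∀
      w≡0 : w ≡ 0ℤ
      w≡0 = small-double w (<2⇒ P (w + w) (subst (_< + (2 ℕ.* P)) eq (below a b a<)))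
        (<2⇒ P (- (w + w)) (subst (_< + (2 ℕ.* P)) (trans (negate (+ a) (+ b)) (trans (cong -_ eq) (neg-distribˡ-* (w + w) (+ P)))) (below b a b<)))

    -- The sum and the difference of the two equations decouple them: one relates σᵢ to τⱼ, the
    -- other σⱼ to τᵢ. By coprimality their solutions are κ (P , Q) and λ′ (P , Q), so the
    -- differences of (σᵢ , τᵢ) are (κ Q , λ′ P), and the parity of the snake makes κ and λ′ even.
    separate : ∀ i j i′ j′ → X i j ≡ X i′ j′ → Y i j ≡ Y i′ j′ → i ≡ i′ × j ≡ j′
    separate i j i′ j′ X≡ Y≡ = Fin.toℕ-injective (injective (toℕ i) (toℕ i′) (same (proj₂ b₁) κ≡0) (same (proj₁ b₂) λ≡0)) ,
                               Fin.toℕ-injective (injective (toℕ j) (toℕ j′) (same′ (proj₂ b₂) λ≡0) (same′ (proj₁ b₁) κ≡0))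
      where
      open ≡-Reasoning
      A = + σ i
      A′ = + σ i′
      B = + τ j
      B′ = + τ j′
      C = + τ i
      C′ = + τ i′
      D = + σ j
      D′ = + σ j′
      sumX : (+ P * A + + Q * B) + (+ P * D + + Q * C) ≡ (+ P * A′ + + Q * B′) + (+ P * D′ + + Q * C′)
      sumX = trans (sym (+X i j)) (trans (cong +_ X≡) (+X i′ j′))
      sumY : (+ P * A + + Q * B) + (+ P * (+ R - D) + + Q * (+ (P ℕ.+ P) - C)) ≡ (+ P * A′ + + Q * B′) + (+ P * (+ R - D′) + + Q * (+ (P ℕ.+ P) - C′))
      sumY = trans (sym (+Y i j)) (trans (cong +_ Y≡) (+Y i′ j′))
      half : ∀ {i j} → + 2 * i ≡ + 2 * j → i ≡ j
      half {i} {j} = *-cancelˡ-≡ (+ 2) i j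
      Qb≡Pa : + Q * (B′ - B) ≡ + P * (A - A′)
      Qb≡Pa = half (begin
        + 2 * (+ Q * (B′ - B))   ≡⟨ e₁ (+ P) (+ Q) A A′ B B′ C C′ D D′ (+ R) (+ (P ℕ.+ P)) ⟩
        _ ≡⟨ cong₂ (λ u v → (((+ P * A′ + + Q * B′) + (+ P * D′ + + Q * C′)) + ((+ P * A′ + + Q * B′) + (+ P * (+ R - D′) + + Q * (+ (P ℕ.+ P) - C′)))) - (u + v) + + 2 * (+ P * (A - A′))) sumX sumY ⟩
        _ ≡⟨ e₂ ((+ P * A′ + + Q * B′) + (+ P * D′ + + Q * C′)) ((+ P * A′ + + Q * B′) + (+ P * (+ R - D′) + + Q * (+ (P ℕ.+ P) - C′))) (+ 2 * (+ P * (A - A′))) ⟩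
        + 2 * (+ P * (A - A′)) ∎)
        where
        e₁ : ∀ P Q A A′ B B′ C C′ D D′ R T → + 2 * (Q * (B′ - B)) ≡
          (((P * A′ + Q * B′) + (P * D′ + Q * C′)) + ((P * A′ + Q * B′) + (P * (R - D′) + Q * (T - C′)))) -
          (((P * A + Q * B) + (P * D + Q * C)) + ((P * A + Q * B) + (P * (R - D) + Q * (T - C)))) + + 2 * (P * (A - A′))
        e₁ = solve-∀
        e₂ : ∀ u v w → (u + v) - (u + v) + w ≡ w
        e₂ = solve-∀
      Qc≡Pd : + Q * (C - C′) ≡ + P * (D′ - D)
      Qc≡Pd = half (begin
        + 2 * (+ Q * (C - C′))   ≡⟨ e₁ (+ P) (+ Q) A A′ B B′ C C′ D D′ (+ R) (+ (P ℕ.+ P)) ⟩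
        _ ≡⟨ cong₂ (λ u v → (u - ((+ P * A′ + + Q * B′) + (+ P * D′ + + Q * C′))) - (v - ((+ P * A′ + + Q * B′) + (+ P * (+ R - D′) + + Q * (+ (P ℕ.+ P) - C′)))) + + 2 * (+ P * (D′ - D))) sumX sumY ⟩
        _ ≡⟨ e₂ ((+ P * A′ + + Q * B′) + (+ P * D′ + + Q * C′)) ((+ P * A′ + + Q * B′) + (+ P * (+ R - D′) + + Q * (+ (P ℕ.+ P) - C′))) (+ 2 * (+ P * (D′ - D))) ⟩
        + 2 * (+ P * (D′ - D)) ∎)
        where
        e₁ : ∀ P Q A A′ B B′ C C′ D D′ R T → + 2 * (Q * (C - C′)) ≡
          (((P * A + Q * B) + (P * D + Q * C)) - ((P * A′ + Q * B′) + (P * D′ + Q * C′))) -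
          (((P * A + Q * B) + (P * (R - D) + Q * (T - C))) - ((P * A′ + Q * B′) + (P * (R - D′) + Q * (T - C′)))) + + 2 * (P * (D′ - D))
        e₁ = solve-∀
        e₂ : ∀ u v w → (u - u) - (v - v) + w ≡ w
        e₂ = solve-∀
      b₁ = coprime-multiple (+ P) (+ Q) x y (B′ - B) (A - A′) bezout Qb≡Pa
      b₂ = coprime-multiple (+ P) (+ Q) x y (C - C′) (D′ - D) bezout Qc≡Pd
      κ = x * (B′ - B) + y * (A - A′)
      λ′ = x * (C - C′) + y * (D′ - D)
      even-difference : ∀ i i′ → ∃ λ h → (+ s i - + s i′) + (+ t i - + t i′) ≡ + 2 * h
      even-difference i i′ = let h , eq = even i ; h′ , eq′ = even i′ in h - h′ ,
        trans (e₁ (+ s i) (+ s i′) (+ t i) (+ t i′)) (trans (cong₂ _-_ eq eq′) (e₂ h h′))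
        where
        e₁ : ∀ a b c d → (a - b) + (c - d) ≡ (a + c) - (b + d)
        e₁ = solve-∀
        e₂ : ∀ h h′ → + 2 * h - + 2 * h′ ≡ + 2 * (h - h′)
        e₂ = solve-∀
      parity₁ : κ * + Q + λ′ * + P ≡ + 2 * proj₁ (even-difference (toℕ i) (toℕ i′))
      parity₁ = trans (sym (cong₂ _+_ (proj₂ b₁) (proj₁ b₂))) (proj₂ (even-difference (toℕ i) (toℕ i′)))
      parity₂ : κ * + P + λ′ * + Q ≡ + 2 * proj₁ (even-difference (toℕ j′) (toℕ j))
      parity₂ = trans (sym (cong₂ _+_ (proj₁ b₁) (proj₂ b₂))) (trans (+-comm (B′ - B) (D′ - D)) (proj₂ (even-difference (toℕ j′) (toℕ j))))
      κ≡0 : κ ≡ 0ℤ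
      κ≡0 = narrow κ (τ j′) (τ j) (τ<2P j′) (τ<2P j) (proj₁ b₁) (collision {κ} {λ′} parity₁ parity₂)
      λ≡0 : λ′ ≡ 0ℤ
      λ≡0 = narrow λ′ (τ i) (τ i′) (τ<2P i) (τ<2P i′) (proj₁ b₂) (collision {λ′} {κ}
        (trans (+-comm (λ′ * + Q) (κ * + P)) parity₂) (trans (+-comm (λ′ * + P) (κ * + Q)) parity₁))
      same : ∀ {a b m c} → + a - + b ≡ m * c → m ≡ 0ℤ → a ≡ b
      same {a} {b} eq refl = +-injective (i-j≡0⇒i≡j (+ a) (+ b) eq)
      same′ : ∀ {a b m c} → + b - + a ≡ m * c → m ≡ 0ℤ → a ≡ b
      same′ eq m≡0 = sym (same eq m≡0)

    Leap : ℕ → ℕ → Set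
    Leap a b = (a ≡ p × b ≡ q) ⊎ (a ≡ q × b ≡ p)

    -- A diagonal unit step changes the half-sum and half-difference coordinates by ±P and ±Q, and P
    -- + Q = q, P - Q = p.
    unit-leap : ∀ {ε δ a b} → Unit ε → Unit δ → a ≡ ∣ ε * + P + δ * + Q ∣ → b ≡ ∣ ε * + P - δ * + Q ∣ → Leap a b
    unit-leap (inj₁ refl) (inj₁ refl) refl refl = inj₂ (cong ∣_∣ (e₁ (+ P) (+ Q)) , cong ∣_∣ (e₂ (+ p) (+ Q)))
      where
      e₁ : ∀ P Q → 1ℤ * P + 1ℤ * Q ≡ P + Q
      e₁ = solve-∀
      e₂ : ∀ p Q → 1ℤ * (p + Q) - 1ℤ * Q ≡ p
      e₂ = solve-∀
    unit-leap (inj₁ refl) (inj₂ refl) refl refl = inj₁ (cong ∣_∣ (e₂ (+ p) (+ Q)) , cong ∣_∣ (e₁ (+ P) (+ Q)))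
      where
      e₁ : ∀ P Q → 1ℤ * P - -1ℤ * Q ≡ P + Q
      e₁ = solve-∀
      e₂ : ∀ p Q → 1ℤ * (p + Q) + -1ℤ * Q ≡ p
      e₂ = solve-∀
    unit-leap (inj₂ refl) (inj₁ refl) refl refl = inj₁ (trans (cong ∣_∣ (e₂ (+ p) (+ Q))) (∣-i∣≡∣i∣ (+ p)) , trans (cong ∣_∣ (e₁ (+ P) (+ Q))) (∣-i∣≡∣i∣ (+ q)))
      where
      e₁ : ∀ P Q → -1ℤ * P - 1ℤ * Q ≡ - (P + Q)
      e₁ = solve-∀
      e₂ : ∀ p Q → -1ℤ * (p + Q) + 1ℤ * Q ≡ - p
      e₂ = solve-∀
    unit-leap (inj₂ refl) (inj₂ refl) refl refl = inj₂ (trans (cong ∣_∣ (e₁ (+ P) (+ Q))) (∣-i∣≡∣i∣ (+ q)) , trans (cong ∣_∣ (e₂ (+ p) (+ Q))) (∣-i∣≡∣i∣ (+ p)))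
      where
      e₁ : ∀ P Q → -1ℤ * P + -1ℤ * Q ≡ - (P + Q)
      e₁ = solve-∀
      e₂ : ∀ p Q → -1ℤ * (p + Q) - -1ℤ * Q ≡ - p
      e₂ = solve-∀

    UnitSteps : Fin size → Fin size → Set
    UnitSteps i i′ = ∃₂ λ ε δ → Unit ε × Unit δ × + σ i′ ≡ + σ i + ε × + τ i′ ≡ + τ i + δ

    unit-steps : ∀ i i′ → Adjacent (toℕ i) (toℕ i′) → UnitSteps i i′
    unit-steps i i′ adj = let ε , uε , eq = unit (proj₁ both) ; δ , uδ , eq′ = unit (proj₂ both) in ε , δ , uε , uδ , eq , eq′
      where
      unit : ∀ {a b} → Adjacent a b → ∃ λ ε → Unit ε × + b ≡ + a + ε
      unit {a} (inj₁ refl) = 1ℤ , inj₁ refl , +-comm 1ℤ (+ a)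
      unit {b = b} (inj₂ refl) = -1ℤ , inj₂ refl , e (+ b)
        where e : ∀ b → b ≡ 1ℤ + b + -1ℤ
              e = solve-∀
      flip : ∀ {a b} → Adjacent a b → Adjacent b a
      flip (inj₁ eq) = inj₂ eq
      flip (inj₂ eq) = inj₁ eq
      both′ : Adjacent (toℕ i) (toℕ i′) → Adjacent (σ i) (σ i′) × Adjacent (τ i) (τ i′)
      both′ (inj₁ eq) rewrite eq = walk (toℕ i)
      both′ (inj₂ eq) rewrite eq = flip (proj₁ (walk (toℕ i′))) , flip (proj₂ (walk (toℕ i′)))
      both = both′ adj

    row-leap : ∀ i i′ j → UnitSteps i i′ → Leap ℕ.∣ X i j - X i′ j ∣ ℕ.∣ Y i j - Y i′ j ∣
    row-leap i i′ j (ε , δ , uε , uδ , eqσ , eqτ) = unit-leap uε uδ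
      (trans (distance (X i j) (X i′ j)) (cong ∣_∣ (trans (cong₂ _-_ (+X i′ j) (+X i j))
        (trans (cong₂ (λ u v → (+ P * u + + Q * + τ j) + (+ P * + σ j + + Q * v) - ((+ P * + σ i + + Q * + τ j) + (+ P * + σ j + + Q * + τ i))) eqσ eqτ)
          (e₁ (+ P) (+ Q) (+ σ i) (+ τ j) (+ σ j) (+ τ i) ε δ)))))
      (trans (distance (Y i j) (Y i′ j)) (cong ∣_∣ (trans (cong₂ _-_ (+Y i′ j) (+Y i j))
        (trans (cong₂ (λ u v → (+ P * u + + Q * + τ j) + (+ P * (+ R - + σ j) + + Q * (+ (P ℕ.+ P) - v)) - ((+ P * + σ i + + Q * + τ j) + (+ P * (+ R - + σ j) + + Q * (+ (P ℕ.+ P) - + τ i)))) eqσ eqτ)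
          (e₂ (+ P) (+ Q) (+ σ i) (+ τ j) (+ σ j) (+ τ i) ε δ (+ R) (+ (P ℕ.+ P)))))))
      where
      e₁ : ∀ P Q a b d c ε δ → (P * (a + ε) + Q * b) + (P * d + Q * (c + δ)) - ((P * a + Q * b) + (P * d + Q * c)) ≡ ε * P + δ * Q
      e₁ = solve-∀
      e₂ : ∀ P Q a b d c ε δ R T → (P * (a + ε) + Q * b) + (P * (R - d) + Q * (T - (c + δ))) - ((P * a + Q * b) + (P * (R - d) + Q * (T - c))) ≡ ε * P - δ * Q
      e₂ = solve-∀

    column-leap : ∀ i j j′ → UnitSteps j j′ → Leap ℕ.∣ X i j - X i j′ ∣ ℕ.∣ Y i j - Y i j′ ∣
    column-leap i j j′ (ε , δ , uε , uδ , eqσ , eqτ) = unit-leap uε uδ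
      (trans (distance (X i j) (X i j′)) (cong ∣_∣ (trans (cong₂ _-_ (+X i j′) (+X i j))
        (trans (cong₂ (λ u v → (+ P * + σ i + + Q * v) + (+ P * u + + Q * + τ i) - ((+ P * + σ i + + Q * + τ j) + (+ P * + σ j + + Q * + τ i))) eqσ eqτ)
          (e₁ (+ P) (+ Q) (+ σ i) (+ τ j) (+ σ j) (+ τ i) ε δ)))))
      (trans (distance (Y i j) (Y i j′)) (trans (cong ∣_∣ (trans (cong₂ _-_ (+Y i j′) (+Y i j))
        (trans (cong₂ (λ u v → (+ P * + σ i + + Q * v) + (+ P * (+ R - u) + + Q * (+ (P ℕ.+ P) - + τ i)) - ((+ P * + σ i + + Q * + τ j) + (+ P * (+ R - + σ j) + + Q * (+ (P ℕ.+ P) - + τ i)))) eqσ eqτ)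
          (e₂ (+ P) (+ Q) (+ σ i) (+ τ j) (+ σ j) (+ τ i) ε δ (+ R) (+ (P ℕ.+ P))))))
        (∣-i∣≡∣i∣ (ε * + P - δ * + Q))))
      where
      e₁ : ∀ P Q a b d c ε δ → (P * a + Q * (b + δ)) + (P * (d + ε) + Q * c) - ((P * a + Q * b) + (P * d + Q * c)) ≡ ε * P + δ * Q
      e₁ = solve-∀
      e₂ : ∀ P Q a b d c ε δ R T → (P * a + Q * (b + δ)) + (P * (R - (d + ε)) + Q * (T - c)) - ((P * a + Q * b) + (P * (R - d) + Q * (T - c))) ≡ - (ε * P - δ * Q)
      e₂ = solve-∀

    snake-embeds : ∀ {n} → span ℕ.+ span ℕ.< n → GridEmbedsInLeaper p q size n
    snake-embeds {n} fits = f , f-injective , f-adjacent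
      where
      X< : ∀ i j → X i j ℕ.< n
      X< i j = ℕ.≤-<-trans (X≤ i j) fits
      Y< : ∀ i j → Y i j ℕ.< n
      Y< i j = ℕ.≤-<-trans (Y≤ i j) fits
      f : Cell size → Cell n
      f (i , j) = fromℕ< (X< i j) , fromℕ< (Y< i j)
      f-injective : ∀ {u v} → f u ≡ f v → u ≡ v
      f-injective {i , j} {i′ , j′} eq = cong₂ _,_ (proj₁ both) (proj₂ both)
        where both = separate i j i′ j′ (Fin.fromℕ<-injective _ _ _ _ (cong proj₁ eq)) (Fin.fromℕ<-injective _ _ _ _ (cong proj₂ eq))
      on-board : ∀ i j i′ j′ → Leap ℕ.∣ X i j - X i′ j′ ∣ ℕ.∣ Y i j - Y i′ j′ ∣ → LeaperAdj p q n (f (i , j)) (f (i′ , j′))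
      on-board i j i′ j′ = subst₂ Leap (sym (cong₂ ℕ.∣_-_∣ (Fin.toℕ-fromℕ< (X< i j)) (Fin.toℕ-fromℕ< (X< i′ j′))))
                                       (sym (cong₂ ℕ.∣_-_∣ (Fin.toℕ-fromℕ< (Y< i j)) (Fin.toℕ-fromℕ< (Y< i′ j′))))
      f-adjacent : ∀ u v → GridAdj size u v → LeaperAdj p q n (f u) (f v)
      f-adjacent (i , j) (i′ , j′) adj with sum-of-squares-1 ℕ.∣ toℕ i - toℕ i′ ∣ ℕ.∣ toℕ j - toℕ j′ ∣ adj
      ... | inj₁ (one , zero′) with Fin.toℕ-injective (ℕ.∣m-n∣≡0⇒m≡n {toℕ j} {toℕ j′} zero′)
      ... | refl = on-board i j i′ j (row-leap i i′ j (unit-steps i i′ (unit-distance _ _ one)))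
      f-adjacent (i , j) (i′ , j′) adj | inj₂ (zero′ , one) with Fin.toℕ-injective (ℕ.∣m-n∣≡0⇒m≡n {toℕ i} {toℕ i′} zero′)
      ... | refl = on-board i j i j′ (column-leap i j j′ (unit-steps j j′ (unit-distance _ _ one)))

open import Data.Integer.Base as ℤ using (ℤ; +_; 1ℤ)
import Data.Integer.Properties as ℤ
import Data.Integer.Tactic.RingSolver as ℤ-Solver
open import Data.Nat using (_*_; _≤_; ∣_-_∣; _+_; _∸_; _^_; _<_; s≤s; s≤s⁻¹; z≤n; >-nonZero⁻¹; ≢-nonZero; ≢-nonZero⁻¹)
open import Data.Nat.DivMod using (_/_; m/n*n≤m; m≡m%n+[m/n]*n; m%n<n)
open import Data.Nat.GCD using (gcd; gcd-comm; gcd-GCD; module Bézout; module GCD)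
open import Data.Nat.Properties
open import Data.Nat.Tactic.RingSolver using (solve-∀)
open GCD using (GCD)
open UpperBound using (slack; upper-bound)
open Snakes using (snake-embeds)

-- Decidability of embeddings and existence of the maximum.

Embedding : (p q m n : ℕ) → (Cell m → Cell n) → Set
Embedding p q m n f = Injective _≡_ _≡_ f × (∀ u v → GridAdj m u v → LeaperAdj p q n (f u) (f v))

embedding? : ∀ p q m n f → Dec (Embedding p q m n f)
embedding? p q m n f = injective? ×-dec adjacent?
  where
  all-cells? : ∀ {P : Cell m → Set} → (∀ u → Dec (P u)) → Dec (∀ u → P u)
  all-cells? P? = map′ (λ h (i , j) → h i j) (λ h i j → h (i , j)) (Fin.all? λ i → Fin.all? λ j → P? (i , j))
  injective? : Dec (Injective _≡_ _≡_ f)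
  injective? = map′ (λ h {u} {v} → h u v) (λ h u v → h)
    (all-cells? λ u → all-cells? λ v → ≡-dec Fin._≟_ Fin._≟_ (f u) (f v) →-dec ≡-dec Fin._≟_ Fin._≟_ u v)
  adjacent? : Dec (∀ u v → GridAdj m u v → LeaperAdj p q n (f u) (f v))
  adjacent? = all-cells? λ u → all-cells? λ v → (_ ≟ 1) →-dec
    (((_ ≟ p) ×-dec (_ ≟ q)) ⊎-dec ((_ ≟ q) ×-dec (_ ≟ p)))

-- `decode (encode f)` agrees with `f` pointwise, so being an embedding has to respect pointwise
-- equality.
embedding-cong : ∀ {p q m n f g} → f ≗ g → Embedding p q m n f → Embedding p q m n g
embedding-cong {p} {q} {n = n} f≗g (inj , adj) =
  (λ eq → inj (trans (f≗g _) (trans eq (sym (f≗g _))))) ,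
  (λ u v a → subst₂ (LeaperAdj p q n) (f≗g u) (f≗g v) (adj u v a))

decode : ∀ {m n} → Fin ((n * n) ^ (m * m)) → Cell m → Cell n
decode {m} {n} e (i , j) = remQuot n (finToFun e (combine i j))

encode : ∀ {m n} → (Cell m → Cell n) → Fin ((n * n) ^ (m * m))
encode {m} f = funToFin λ c → let i , j = f (remQuot m c) in combine i j

decode-encode : ∀ {m n} (f : Cell m → Cell n) → f ≗ decode (encode f)
decode-encode {m} {n} f (i , j) = sym (begin
  remQuot n (finToFun (encode f) (combine i j))   ≡⟨ cong (remQuot n) (Fin.finToFun-funToFin _ (combine i j)) ⟩
  remQuot n (combine (proj₁ (f c)) (proj₂ (f c)))  ≡⟨ Fin.remQuot-combine (proj₁ (f c)) (proj₂ (f c)) ⟩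
  f c                                             ≡⟨ cong f (Fin.remQuot-combine i j) ⟩
  f (i , j)                                       ∎)
  where
  open ≡-Reasoning
  c = remQuot m (combine i j)

-- Maps between two boards are coded as numbers below `(n * n) ^ (m * m)`, so an exhaustive search
-- decides. With the upper bound on m this makes m(n) computable.
embeds? : ∀ p q m n → Dec (GridEmbedsInLeaper p q m n)
embeds? p q m n = map′ (λ (e , emb) → decode {m} {n} e , emb)
  (λ (f , emb) → encode f , embedding-cong {p} {q} (decode-encode f) emb)
  (Fin.any? λ e → embedding? p q m n (decode {m} {n} e))

maximum : ∀ {P : ℕ → Set} → (∀ m → Dec (P m)) → ∀ B m₀ → P m₀ → (∀ m → P m → m ≤ B) →
  ∃ λ m → m₀ ≤ m × P m × (∀ m′ → P m′ → m′ ≤ m)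
maximum P? zero m₀ Pm₀ bound = m₀ , ≤-refl , Pm₀ , λ m′ Pm′ → ≤-trans (bound m′ Pm′) z≤n
maximum P? (suc B) m₀ Pm₀ bound with P? (suc B)
... | yes PB = suc B , bound m₀ Pm₀ , PB , bound
... | no ¬PB = maximum P? B m₀ Pm₀ λ m Pm → s≤s⁻¹ (≤∧≢⇒< (bound m Pm) λ { refl → ¬PB Pm })

single-cell : ∀ p q {n} → 1 ≤ n → GridEmbedsInLeaper p q 1 n
single-cell p q {suc n} _ = (λ _ → zero , zero) , (λ { {zero , zero} {zero , zero} _ → refl }) , λ { (zero , zero) (zero , zero) () }

-- As p = P - Q and q = P + Q, a Bézout relation for p and q is also one for P and Q.
bezout : ∀ {p Q} → gcd p (p + Q + Q) ≡ 1 → ∃₂ λ x y → x ℤ.* + (p + Q) ℤ.+ y ℤ.* + Q ≡ 1ℤ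
bezout {p} {Q} gcd≡1 = convert (Bézout.identity (subst (GCD p q) gcd≡1 (gcd-GCD p q)))
  where
  q = p + Q + Q
  convert : Bézout.Identity 1 p q → ∃₂ λ x y → x ℤ.* + (p + Q) ℤ.+ y ℤ.* + Q ≡ 1ℤ
  convert (Bézout.+- u v eq) = + u ℤ.- + v , ℤ.- + u ℤ.- + v , trans (e₁ (+ u) (+ v) (+ p) (+ Q))
    (trans (cong (ℤ._- + v ℤ.* + q) (trans (sym (ℤ.pos-* u p)) (trans (sym (cong +_ eq)) (cong (λ z → 1ℤ ℤ.+ z) (ℤ.pos-* v q))))) (e₂ (+ v ℤ.* + q)))
    where
    e₁ : ∀ u v p Q → (u ℤ.- v) ℤ.* (p ℤ.+ Q) ℤ.+ (ℤ.- u ℤ.- v) ℤ.* Q ≡ u ℤ.* p ℤ.- v ℤ.* (p ℤ.+ Q ℤ.+ Q)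
    e₁ = ℤ-Solver.solve-∀
    e₂ : ∀ a → 1ℤ ℤ.+ a ℤ.- a ≡ 1ℤ
    e₂ = ℤ-Solver.solve-∀
  convert (Bézout.-+ u v eq) = + v ℤ.- + u , + v ℤ.+ + u , trans (e₁ (+ u) (+ v) (+ p) (+ Q))
    (trans (cong (ℤ._- + u ℤ.* + p) (trans (sym (ℤ.pos-* v q)) (trans (sym (cong +_ eq)) (cong (λ z → 1ℤ ℤ.+ z) (ℤ.pos-* u p))))) (e₂ (+ u ℤ.* + p)))
    where
    e₁ : ∀ u v p Q → (v ℤ.- u) ℤ.* (p ℤ.+ Q) ℤ.+ (v ℤ.+ u) ℤ.* Q ≡ v ℤ.* (p ℤ.+ Q ℤ.+ Q) ℤ.- u ℤ.* p
    e₁ = ℤ-Solver.solve-∀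
    e₂ : ∀ a → 1ℤ ℤ.+ a ℤ.- a ≡ 1ℤ
    e₂ = ℤ-Solver.solve-∀

-- The constant, and the reduction to p < q.

Bounded : (p q C : ℕ) → Set
Bounded p q C = (n : ℕ) → 1 ≤ n → Σ ℕ λ m → IsMaxGrid p q n m × ∣ 2 * m - n ∣ ≤ C

∣-∣≤ : ∀ {a b c d} → a ≤ b + c → b ≤ a + d → ∣ a - b ∣ ≤ c + d
∣-∣≤ {a} {b} {c} {d} le ge with ≤-total a b
... | inj₁ a≤b = subst (_≤ c + d) (sym (m≤n⇒∣m-n∣≡n∸m a≤b)) (≤-trans (m≤n+o⇒m∸n≤o b a ge) (m≤n+m d c))
... | inj₂ b≤a = subst (_≤ c + d) (sym (m≤n⇒∣n-m∣≡n∸m b≤a)) (≤-trans (m≤n+o⇒m∸n≤o a b le) (m≤m+n c d))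

module _ {p Q : ℕ} .{{_ : NonZero p}} .{{_ : NonZero Q}} {x y : ℤ} (bez : x ℤ.* + (p + Q) ℤ.+ y ℤ.* + Q ≡ 1ℤ)
         {g : ℤ} (odd : + (p + Q) ℤ.+ + Q ≡ + 2 ℤ.* g ℤ.+ 1ℤ) where

  private
    P = p + Q
    q = P + Q
    -- Twice the `span` of the snake is 2 m + 4 P Q, and the board needs one more cell.
    K : ℕ
    K = suc (4 * (P * Q))
    instance
      P≢0 : NonZero P
      P≢0 = ≢-nonZero λ eq → ≢-nonZero⁻¹ p (m+n≡0⇒m≡0 p eq)
      4P≢0 : NonZero (4 * P)
      4P≢0 = m*n≢0 4 P

  -- The snake has m = 2 P (r + 1), and it fits once 4 P (r + 1) ≤ n - K, so r + 1 is taken as the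
  -- quotient of n - K by 4P. Rounding costs at most 4P; for quotient 0 a single cell serves.
  lower-bound : ∀ n → 1 ≤ n → ∃ λ m → 1 ≤ m × GridEmbedsInLeaper p q m n × n ≤ 2 * m + (K + 4 * P)
  lower-bound n 1≤n = cases ((n ∸ K) / (4 * P)) refl
    where
    n< : ∀ w → (n ∸ K) / (4 * P) ≡ w → n ≤ K + (4 * P + w * (4 * P))
    n< w refl = ≤-trans (m≤n+m∸n n K) (+-monoʳ-≤ K (≤-trans (≤-reflexive (m≡m%n+[m/n]*n (n ∸ K) (4 * P)))
      (+-monoˡ-≤ _ (<⇒≤ (m%n<n (n ∸ K) (4 * P))))))
    cases : ∀ w → (n ∸ K) / (4 * P) ≡ w → ∃ λ m → 1 ≤ m × GridEmbedsInLeaper p q m n × n ≤ 2 * m + (K + 4 * P)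
    cases zero eq = 1 , ≤-refl , single-cell p q 1≤n , ≤-trans (n< 0 eq) (≤-trans (≤-reflexive (cong (_+_ K) (+-identityʳ (4 * P)))) (m≤n+m _ 2))
    cases (suc r) eq = m , 1≤m , snake-embeds {p} {Q} {x} {y} bez {g} odd r fits , n≤
      where
      m = P * suc (suc (r + r))
      1≤m : 1 ≤ m
      1≤m = >-nonZero⁻¹ m {{m*n≢0 P (suc (suc (r + r)))}}
      room : suc r * (4 * P) ≤ n ∸ K
      room = subst (λ w → w * (4 * P) ≤ n ∸ K) eq (m/n*n≤m (n ∸ K) (4 * P))
      K≤n : K ≤ n
      K≤n = <⇒≤ (m∸n≢0⇒n<m λ n∸K≡0 → <⇒≱ (>-nonZero⁻¹ (4 * P)) (≤-trans (m≤m+n (4 * P) (r * (4 * P))) (≤-trans room (≤-reflexive n∸K≡0))))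
      fits : m + Q * (P + P) + (m + Q * (P + P)) < n
      fits = ≤-trans (≤-reflexive (e P Q r)) (≤-trans (+-monoʳ-≤ K room) (≤-reflexive (m+[n∸m]≡n K≤n)))
        where e : ∀ P Q r → suc (P * suc (suc (r + r)) + Q * (P + P) + (P * suc (suc (r + r)) + Q * (P + P))) ≡ suc (4 * (P * Q)) + suc r * (4 * P)
              e = solve-∀
      n≤ : n ≤ 2 * m + (K + 4 * P)
      n≤ = ≤-trans (n< (suc r) eq) (≤-reflexive (e K P r))
        where e : ∀ K P r → K + (4 * P + suc r * (4 * P)) ≡ 2 * (P * suc (suc (r + r))) + (K + 4 * P)
              e = solve-∀

  bounded : Bounded p q (2 * slack {p} {Q} {x} {y} + (K + 4 * P))
  bounded n 1≤n = let m₀ , 1≤m₀ , emb₀ , n≤ = lower-bound n 1≤n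
                      m , m₀≤m , emb , max = maximum (λ m → embeds? p q m n) (n + 2 * S) m₀ emb₀ (λ m emb → ≤-trans (m≤m+n m _) (upper m emb)) in
      m , (≤-trans 1≤m₀ m₀≤m , emb , λ m′ _ → max m′) , ∣-∣≤ (upper m emb) (≤-trans n≤ (+-monoˡ-≤ _ (*-monoʳ-≤ 2 m₀≤m)))
    where
    S = slack {p} {Q} {x} {y}
    upper : ∀ m → GridEmbedsInLeaper p q m n → 2 * m ≤ n + 2 * S
    upper m = upper-bound {p} {Q} {x} {y} bez

embeds-swap : ∀ {p q m n} → GridEmbedsInLeaper p q m n → GridEmbedsInLeaper q p m n
embeds-swap (f , inj , adj) = f , inj , λ u v a → Sum.swap (adj u v a)

bounded-swap : ∀ {p q C} → Bounded p q C → Bounded q p C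
bounded-swap {p} {q} bd n 1≤n = let m , (1≤m , emb , max) , close = bd n 1≤n in
  m , (1≤m , embeds-swap {p} {q} emb , λ m′ 1≤m′ emb′ → max m′ 1≤m′ (embeds-swap {q} {p} emb′)) , close

-- The difference of two odd numbers is even, which gives Q = `suc d`; then P + Q = q is odd, as the
-- parity argument for the snakes requires.
odd-bounded : ∀ {p q} → p < q → Odd p → Odd q → gcd p q ≡ 1 → ∃ (Bounded p q)
odd-bounded p<q (a , refl) (b , refl) gcd≡1
  with m≤n⇒∃[o]m+o≡n (*-cancelˡ-< 2 a b (+-cancelʳ-< 1 (2 * a) (2 * b) p<q))
... | d , refl = subst (λ q → ∃ (Bounded p q)) q≡ (_ , bounded {p} {suc d} {{m+1≢0}} {proj₁ xy} {proj₁ (proj₂ xy)} (proj₂ (proj₂ xy)) {+ (suc a + d)} odd)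
  where
  p = 2 * a + 1
  m+1≢0 : NonZero p
  m+1≢0 = subst NonZero (+-comm 1 (2 * a)) _
  q≡ : p + suc d + suc d ≡ 2 * (suc a + d) + 1
  q≡ = e a d
    where e : ∀ a d → 2 * a + 1 + suc d + suc d ≡ 2 * (suc a + d) + 1
          e = solve-∀
  xy = bezout {p} {suc d} (trans (cong (gcd p) q≡) gcd≡1)
  odd : + (p + suc d) ℤ.+ + suc d ≡ + 2 ℤ.* + (suc a + d) ℤ.+ 1ℤ
  odd = trans (cong +_ q≡) (cong (ℤ._+ 1ℤ) (ℤ.pos-* 2 (suc a + d)))

theorem2 : (p q : ℕ) → 1 ≤ p → 1 ≤ q → p ≢ q → Odd p → Odd q → gcd p q ≡ 1 →
    ∃ λ (C : ℕ) → (n : ℕ) → 1 ≤ n →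
    Σ ℕ λ m → IsMaxGrid p q n m × ∣ 2 * m - n ∣ ≤ C
theorem2 p q _ _ p≢q odd-p odd-q gcd≡1 = by-order (<-cmp p q)
  where
  by-order : Tri (p < q) (p ≡ q) (q < p) → ∃ (Bounded p q)
  by-order (tri< p<q _ _) = odd-bounded p<q odd-p odd-q gcd≡1
  by-order (tri≈ _ p≡q _) = ⊥-elim (p≢q p≡q)
  by-order (tri> _ _ q<p) = let C , bd = odd-bounded q<p odd-q odd-p (trans (gcd-comm q p) gcd≡1) in C , bounded-swap {q} {p} bd
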